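{- Let $s \geq 3$ be a fixed integer. Suppose there are constants $C, c > 0$ such that for every sufficiently large $n$ there exists a $K_s$-free $(n,d,\lambda)$-graph with $\lambda \leq C\sqrt{d}$ and $d \geq c\, n^{1 - \frac{1}{2s-3}}$. Then there is a constant $c' > 0$ (depending on $s$, $C$, $c$) such that for all sufficiently large $t$, \[ r(s,t) \;\geq\; c'\,\frac{t^{s-1}}{(\log t)^{2s-4}}. \]
   Context: For integers $s,t \geq 2$, the Ramsey number $r(s,t)$ is the minimum $n$ such that every $n$-vertex graph contains either a clique of order $s$ or an independent set of size $t$. An $(n,d,\lambda)$-graph is an $n$-vertex $d$-regular graph whose adjacency matrix has eigenvalues $\lambda_1 \geq \lambda_2 \geq \dots \geq \lambda_n$ with $\max\{|\lambda_2|,|\lambda_n|\} = \lambda$. A graph is $K_s$-free if it contains no complete subgraph on $s$ vertices. An $(n,d,\lambda)$-graph with $\lambda = O(\sqrt{d})$ is called spectrally extremal. -}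

module Defs where

open import Algebra.Bundles.Raw using (RawRing)
import Algebra.Definitions.RawSemiring as RawSemiringDefs
open import Data.Bool.Base using (Bool; true; false; if_then_else_)
open import Data.Fin.Base using (Fin; zero; suc; toℕ; punchIn)
open import Data.Fin.Properties using () renaming (_≟_ to _≟ᶠ_)
open import Data.Fin.Subset using (Subset; _∈_; ∣_∣)
open import Data.Integer.Base as ℤ using (+_; +[1+_]; -[1+_])
import Data.Integer.Properties as ℤP
import Data.Integer.Solver as ℤSolver
open import Data.Nat.Base as ℕ using (ℕ; zero; suc; _≤_; _<_; z≤n; s≤s; _∸_)
import Data.Nat.Properties as ℕP
import Data.Nat.Solver as ℕSolver
open import Data.Product.Base using (∃-syntax; _×_; _,_)
open import Data.Rational.Base as ℚ using (ℚ; 0ℚ; 1ℚ; ½; mkℚ)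
import Data.Rational.Properties as ℚP
import Data.Rational.Solver as ℚSolver
open import Data.Rational.Unnormalised.Base as ℚᵘ using (mkℚᵘ)
import Data.Rational.Unnormalised.Properties as ℚᵘP
open import Data.Sum.Base using (_⊎_; inj₁; inj₂)
open import Data.Vec.Base using (tabulate)
open import Level using (0ℓ)
open import Relation.Binary.PropositionalEquality
  using (_≡_; _≢_; refl; sym; trans; cong; cong₂; subst; subst₂)
open import Relation.Nullary using (¬_; yes; no)
open import Relation.Nullary.Decidable using (does)

IsCauchy : (ℕ → ℚ) → Set
IsCauchy x = ∀ ε → 0ℚ ℚ.< ε →
  ∃[ N ] (∀ m n → N ≤ m → N ≤ n → ℚ.∣ x m ℚ.- x n ∣ ℚ.≤ ε)

record ℝ : Set where
  constructor mkℝ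
  field
    seq    : ℕ → ℚ
    cauchy : IsCauchy seq

open ℝ public

infix 4 _≈_ _≤ᵣ_ _<ᵣ_

_≈_ : ℝ → ℝ → Set
x ≈ y = ∀ ε → 0ℚ ℚ.< ε →
  ∃[ N ] (∀ n → N ≤ n → ℚ.∣ seq x n ℚ.- seq y n ∣ ℚ.≤ ε)

_≤ᵣ_ : ℝ → ℝ → Set
x ≤ᵣ y = ∀ ε → 0ℚ ℚ.< ε →
  ∃[ N ] (∀ n → N ≤ n → seq x n ℚ.≤ seq y n ℚ.+ ε)

_<ᵣ_ : ℝ → ℝ → Set
x <ᵣ y = ∃[ ε ] (0ℚ ℚ.< ε) ×
  (∃[ N ] (∀ n → N ≤ n → seq x n ℚ.+ ε ℚ.≤ seq y n))

module RationalLemmas where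
  p≤∣p∣ : ∀ p → p ℚ.≤ ℚ.∣ p ∣
  p≤∣p∣ p with ℚP.≤-total 0ℚ p
  ... | inj₁ 0≤p = ℚP.≤-reflexive (sym (ℚP.0≤p⇒∣p∣≡p 0≤p))
  ... | inj₂ p≤0 = ℚP.≤-trans p≤0 (ℚP.0≤∣p∣ p)

  -p≤∣p∣ : ∀ p → ℚ.- p ℚ.≤ ℚ.∣ p ∣
  -p≤∣p∣ p = subst (ℚ.- p ℚ.≤_) (ℚP.∣-p∣≡∣p∣ p) (p≤∣p∣ (ℚ.- p))

  ∣∣-swap : ∀ p q → ℚ.∣ p ℚ.- q ∣ ≡ ℚ.∣ q ℚ.- p ∣
  ∣∣-swap p q = trans (sym (ℚP.∣-p∣≡∣p∣ (p ℚ.- q)))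
    (cong ℚ.∣_∣ (solve 2 (λ p q → :- (p :- q) := q :- p) refl p q))
    where open ℚSolver.+-*-Solver

  ∣-∣≤⇒≤+ : ∀ p q {ε} → ℚ.∣ p ℚ.- q ∣ ℚ.≤ ε → p ℚ.≤ q ℚ.+ ε
  ∣-∣≤⇒≤+ p q {ε} h = subst (ℚ._≤ q ℚ.+ ε)
    (solve 2 (λ p q → q :+ (p :- q) := p) refl p q)
    (ℚP.+-monoʳ-≤ q (ℚP.≤-trans (p≤∣p∣ (p ℚ.- q)) h))
    where open ℚSolver.+-*-Solver

  ≤+⇒-≤ : ∀ p q {ε} → p ℚ.≤ q ℚ.+ ε → p ℚ.- q ℚ.≤ ε
  ≤+⇒-≤ p q {ε} h = subst (p ℚ.- q ℚ.≤_)
    (solve 2 (λ q ε → (q :+ ε) :- q := ε) refl q ε)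
    (ℚP.+-monoˡ-≤ (ℚ.- q) h)
    where open ℚSolver.+-*-Solver

  ≤+⇒∣-∣≤ : ∀ p q {ε} → p ℚ.≤ q ℚ.+ ε → q ℚ.≤ p ℚ.+ ε → ℚ.∣ p ℚ.- q ∣ ℚ.≤ ε
  ≤+⇒∣-∣≤ p q {ε} h k with ℚP.∣p∣≡p∨∣p∣≡-p (p ℚ.- q)
  ... | inj₁ e = subst (ℚ._≤ ε) (sym e) (≤+⇒-≤ p q h)
  ... | inj₂ e = subst (ℚ._≤ ε)
    (sym (trans e (solve 2 (λ p q → :- (p :- q) := q :- p) refl p q)))
    (≤+⇒-≤ q p k)
    where open ℚSolver.+-*-Solver

  0<½*ε : ∀ {ε} → 0ℚ ℚ.< ε → 0ℚ ℚ.< ½ ℚ.* ε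
  0<½*ε {ε} 0<ε = ℚP.positive⁻¹ (½ ℚ.* ε)
    {{ℚP.pos*pos⇒pos ½ ε {{ℚ.positive 0<ε}}}}

open RationalLemmas

fromℚ : ℚ → ℝ
fromℚ q = mkℝ (λ _ → q) λ ε 0<ε → 0 , λ _ _ _ _ →
  subst (λ p → ℚ.∣ p ∣ ℚ.≤ ε) (sym (ℚP.+-inverseʳ q)) (ℚP.<⇒≤ 0<ε)

fromℕᵣ : ℕ → ℝ
fromℕᵣ n = fromℚ (+ n ℚ./ 1)

0ℝ 1ℝ : ℝ
0ℝ = fromℚ 0ℚ
1ℝ = fromℚ 1ℚ

module CauchyLemmas where
  abstract
    +-cauchy : ∀ {x y} → IsCauchy x → IsCauchy y → IsCauchy (λ n → x n ℚ.+ y n)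
    +-cauchy {x} {y} cx cy ε 0<ε
      with cx (½ ℚ.* ε) (0<½*ε 0<ε) | cy (½ ℚ.* ε) (0<½*ε 0<ε)
    ... | N , hx | M , hy = N ℕ.⊔ M , λ m n Nm Nn → begin
      ℚ.∣ (x m ℚ.+ y m) ℚ.- (x n ℚ.+ y n) ∣
        ≡⟨ cong ℚ.∣_∣ (solve 4 (λ a b c d → (a :+ b) :- (c :+ d) := (a :- c) :+ (b :- d))
                         refl (x m) (y m) (x n) (y n)) ⟩
      ℚ.∣ (x m ℚ.- x n) ℚ.+ (y m ℚ.- y n) ∣
        ≤⟨ ℚP.∣p+q∣≤∣p∣+∣q∣ (x m ℚ.- x n) (y m ℚ.- y n) ⟩
      ℚ.∣ x m ℚ.- x n ∣ ℚ.+ ℚ.∣ y m ℚ.- y n ∣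
        ≤⟨ ℚP.+-mono-≤
             (hx m n (ℕP.≤-trans (ℕP.m≤m⊔n N M) Nm) (ℕP.≤-trans (ℕP.m≤m⊔n N M) Nn))
             (hy m n (ℕP.≤-trans (ℕP.m≤n⊔m N M) Nm) (ℕP.≤-trans (ℕP.m≤n⊔m N M) Nn)) ⟩
      ½ ℚ.* ε ℚ.+ ½ ℚ.* ε ≡⟨ sym (ℚP.*-distribʳ-+ ε ½ ½) ⟩
      1ℚ ℚ.* ε            ≡⟨ ℚP.*-identityˡ ε ⟩
      ε                   ∎
      where open ℚSolver.+-*-Solver
            open ℚP.≤-Reasoning

  abstract
    neg-cauchy : ∀ {x} → IsCauchy x → IsCauchy (λ n → ℚ.- x n)
    neg-cauchy {x} cx ε 0<ε with cx ε 0<ε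
    ... | N , hx = N , λ m n Nm Nn → subst (ℚ._≤ ε)
      (trans (∣∣-swap (x m) (x n))
        (cong ℚ.∣_∣ (solve 2 (λ p q → q :- p := :- p :- (:- q)) refl (x m) (x n))))
      (hx m n Nm Nn)
      where open ℚSolver.+-*-Solver

  abstract
    ⊔-cauchy : ∀ {x y} → IsCauchy x → IsCauchy y → IsCauchy (λ n → x n ℚ.⊔ y n)
    ⊔-cauchy {x} {y} cx cy ε 0<ε with cx ε 0<ε | cy ε 0<ε
    ... | N , hx | M , hy = N ℕ.⊔ M , λ m n Nm Nn →
      ≤+⇒∣-∣≤ (x m ℚ.⊔ y m) (x n ℚ.⊔ y n) (half m n Nm Nn) (half n m Nn Nm)
      where
      half : ∀ m n → N ℕ.⊔ M ≤ m → N ℕ.⊔ M ≤ n →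
        x m ℚ.⊔ y m ℚ.≤ (x n ℚ.⊔ y n) ℚ.+ ε
      half m n Nm Nn = ℚP.⊔-lub
        (ℚP.≤-trans
          (∣-∣≤⇒≤+ (x m) (x n) (hx m n (ℕP.≤-trans (ℕP.m≤m⊔n N M) Nm) (ℕP.≤-trans (ℕP.m≤m⊔n N M) Nn)))
          (ℚP.+-monoˡ-≤ ε (ℚP.p≤p⊔q (x n) (y n))))
        (ℚP.≤-trans
          (∣-∣≤⇒≤+ (y m) (y n) (hy m n (ℕP.≤-trans (ℕP.m≤n⊔m N M) Nm) (ℕP.≤-trans (ℕP.m≤n⊔m N M) Nn)))
          (ℚP.+-monoˡ-≤ ε (ℚP.p≤q⊔p (x n) (y n))))

  bounded : ∀ {x} → IsCauchy x →
    ∃[ B ] ℚ.Positive B × (∃[ N ] (∀ n → N ≤ n → ℚ.∣ x n ∣ ℚ.≤ B))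
  bounded {x} cx with cx 1ℚ (ℚP.positive⁻¹ 1ℚ)
  ... | N , hx = ℚ.∣ x N ∣ ℚ.+ 1ℚ
    , ℚP.nonNeg+pos⇒pos ℚ.∣ x N ∣ {{ℚP.∣-∣-nonNeg (x N)}} 1ℚ
    , N , λ n Nn → begin
      ℚ.∣ x n ∣ ≡⟨ cong ℚ.∣_∣ (solve 2 (λ a b → a := b :+ (a :- b)) refl (x n) (x N)) ⟩
      ℚ.∣ x N ℚ.+ (x n ℚ.- x N) ∣ ≤⟨ ℚP.∣p+q∣≤∣p∣+∣q∣ (x N) (x n ℚ.- x N) ⟩
      ℚ.∣ x N ∣ ℚ.+ ℚ.∣ x n ℚ.- x N ∣ ≤⟨ ℚP.+-monoʳ-≤ ℚ.∣ x N ∣ (hx n N Nn ℕP.≤-refl) ⟩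
      ℚ.∣ x N ∣ ℚ.+ 1ℚ ∎
    where open ℚSolver.+-*-Solver
          open ℚP.≤-Reasoning

  ∣∣*-bound : ∀ a b {B δ} → ℚ.∣ a ∣ ℚ.≤ B → ℚ.∣ b ∣ ℚ.≤ δ → ℚ.∣ a ℚ.* b ∣ ℚ.≤ B ℚ.* δ
  ∣∣*-bound a b {B} {δ} ha hb = begin
    ℚ.∣ a ℚ.* b ∣         ≡⟨ ℚP.∣p*q∣≡∣p∣*∣q∣ a b ⟩
    ℚ.∣ a ∣ ℚ.* ℚ.∣ b ∣
      ≤⟨ ℚP.*-monoʳ-≤-nonNeg ℚ.∣ b ∣ {{ℚP.∣-∣-nonNeg b}} ha ⟩
    B ℚ.* ℚ.∣ b ∣
      ≤⟨ ℚP.*-monoˡ-≤-nonNeg B {{ℚ.nonNegative (ℚP.≤-trans (ℚP.0≤∣p∣ a) ha)}} hb ⟩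
    B ℚ.* δ ∎
    where open ℚP.≤-Reasoning

  divide : ∀ B ε → ℚ.Positive B → 0ℚ ℚ.< ε → ∃[ δ ] (0ℚ ℚ.< δ) × (B ℚ.* δ ≡ ε)
  divide B ε posB 0<ε = scale ((ℚ.1/ B) {{nzB}}) (ℚP.1/pos⇒pos B {{posB}})
                              (ℚP.*-inverseʳ B {{nzB}})
    where
    nzB : ℚ.NonZero B
    nzB = ℚP.pos⇒nonZero B {{posB}}
    scale : ∀ r → ℚ.Positive r → B ℚ.* r ≡ 1ℚ → ∃[ δ ] (0ℚ ℚ.< δ) × (B ℚ.* δ ≡ ε)
    scale r posr Br≡1 = r ℚ.* ε
      , ℚP.positive⁻¹ (r ℚ.* ε) {{ℚP.pos*pos⇒pos r {{posr}} ε {{ℚ.positive 0<ε}}}}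
      , trans (sym (ℚP.*-assoc B r ε))
          (trans (cong (ℚ._* ε) Br≡1) (ℚP.*-identityˡ ε))

  *-close : ∀ a b c d {A D δ ε} → (A ℚ.+ D) ℚ.* δ ≡ ε →
    ℚ.∣ a ∣ ℚ.≤ A → ℚ.∣ d ∣ ℚ.≤ D →
    ℚ.∣ a ℚ.- c ∣ ℚ.≤ δ → ℚ.∣ b ℚ.- d ∣ ℚ.≤ δ → ℚ.∣ a ℚ.* b ℚ.- c ℚ.* d ∣ ℚ.≤ ε
  *-close a b c d {A} {D} {δ} {ε} eq ha hd hac hbd = begin
    ℚ.∣ a ℚ.* b ℚ.- c ℚ.* d ∣
      ≡⟨ cong ℚ.∣_∣ (solve 4 (λ a b c d → a :* b :- c :* d := a :* (b :- d) :+ d :* (a :- c))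
                       refl a b c d) ⟩
    ℚ.∣ a ℚ.* (b ℚ.- d) ℚ.+ d ℚ.* (a ℚ.- c) ∣
      ≤⟨ ℚP.∣p+q∣≤∣p∣+∣q∣ (a ℚ.* (b ℚ.- d)) (d ℚ.* (a ℚ.- c)) ⟩
    ℚ.∣ a ℚ.* (b ℚ.- d) ∣ ℚ.+ ℚ.∣ d ℚ.* (a ℚ.- c) ∣
      ≤⟨ ℚP.+-mono-≤ (∣∣*-bound a (b ℚ.- d) {A} {δ} ha hbd) (∣∣*-bound d (a ℚ.- c) {D} {δ} hd hac) ⟩
    A ℚ.* δ ℚ.+ D ℚ.* δ ≡⟨ sym (ℚP.*-distribʳ-+ δ A D) ⟩
    (A ℚ.+ D) ℚ.* δ     ≡⟨ eq ⟩
    ε                   ∎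
    where open ℚSolver.+-*-Solver
          open ℚP.≤-Reasoning

  Eventually-bounded : (ℕ → ℚ) → ℚ → Set
  Eventually-bounded x B = ∃[ N ] (∀ n → N ≤ n → ℚ.∣ x n ∣ ℚ.≤ B)

  Eventually-close : (ℕ → ℚ) → ℚ → Set
  Eventually-close x ε = ∃[ N ] (∀ m n → N ≤ m → N ≤ n → ℚ.∣ x m ℚ.- x n ∣ ℚ.≤ ε)

  *-eventually : ∀ x y {A D δ ε} → (A ℚ.+ D) ℚ.* δ ≡ ε →
    Eventually-bounded x A → Eventually-bounded y D →
    Eventually-close x δ → Eventually-close y δ →
    Eventually-close (λ n → x n ℚ.* y n) ε
  *-eventually x y {A} {D} {δ} {ε} eq (Nx , bx) (Ny , by) (N , hx) (M , hy) =
    K , λ m n Km Kn → *-close (x m) (y m) (x n) (y n) {A} {D} {δ} {ε} eq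
      (bx m (ℕP.≤-trans Nx≤K Km)) (by n (ℕP.≤-trans Ny≤K Kn))
      (hx m n (ℕP.≤-trans N≤K Km) (ℕP.≤-trans N≤K Kn))
      (hy m n (ℕP.≤-trans M≤K Km) (ℕP.≤-trans M≤K Kn))
    where
    K = (Nx ℕ.⊔ Ny) ℕ.⊔ (N ℕ.⊔ M)
    Nx≤K : Nx ≤ K
    Nx≤K = ℕP.≤-trans (ℕP.m≤m⊔n Nx Ny) (ℕP.m≤m⊔n (Nx ℕ.⊔ Ny) (N ℕ.⊔ M))
    Ny≤K : Ny ≤ K
    Ny≤K = ℕP.≤-trans (ℕP.m≤n⊔m Nx Ny) (ℕP.m≤m⊔n (Nx ℕ.⊔ Ny) (N ℕ.⊔ M))
    N≤K : N ≤ K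
    N≤K = ℕP.≤-trans (ℕP.m≤m⊔n N M) (ℕP.m≤n⊔m (Nx ℕ.⊔ Ny) (N ℕ.⊔ M))
    M≤K : M ≤ K
    M≤K = ℕP.≤-trans (ℕP.m≤n⊔m N M) (ℕP.m≤n⊔m (Nx ℕ.⊔ Ny) (N ℕ.⊔ M))

  abstract
    *-cauchy : ∀ {x y} → IsCauchy x → IsCauchy y → IsCauchy (λ n → x n ℚ.* y n)
    *-cauchy {x} {y} cx cy ε 0<ε = go (bounded {x} cx) (bounded {y} cy)
      where
      go : ∃[ A ] ℚ.Positive A × Eventually-bounded x A →
           ∃[ D ] ℚ.Positive D × Eventually-bounded y D →
           Eventually-close (λ n → x n ℚ.* y n) ε
      go (A , posA , bx) (D , posD , by) =
        finish (divide (A ℚ.+ D) ε (ℚP.pos+pos⇒pos A {{posA}} D {{posD}}) 0<ε)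
        where
        finish : ∃[ δ ] (0ℚ ℚ.< δ) × ((A ℚ.+ D) ℚ.* δ ≡ ε) →
          Eventually-close (λ n → x n ℚ.* y n) ε
        finish (δ , 0<δ , eq) =
          *-eventually x y {A} {D} {δ} {ε} eq bx by (cx δ 0<δ) (cy δ 0<δ)

open CauchyLemmas

infixl 6 _+ᵣ_ _-ᵣ_ _⊔ᵣ_
infixl 7 _*ᵣ_
infix  8 -ᵣ_

_+ᵣ_ : ℝ → ℝ → ℝ
x +ᵣ y = mkℝ (λ n → seq x n ℚ.+ seq y n) (+-cauchy {seq x} {seq y} (cauchy x) (cauchy y))

-ᵣ_ : ℝ → ℝ
-ᵣ x = mkℝ (λ n → ℚ.- seq x n) (neg-cauchy {seq x} (cauchy x))

_-ᵣ_ : ℝ → ℝ → ℝ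
x -ᵣ y = x +ᵣ (-ᵣ y)

_*ᵣ_ : ℝ → ℝ → ℝ
x *ᵣ y = mkℝ (λ n → seq x n ℚ.* seq y n) (*-cauchy {seq x} {seq y} (cauchy x) (cauchy y))

_⊔ᵣ_ : ℝ → ℝ → ℝ
x ⊔ᵣ y = mkℝ (λ n → seq x n ℚ.⊔ seq y n) (⊔-cauchy {seq x} {seq y} (cauchy x) (cauchy y))

∣_∣ᵣ : ℝ → ℝ
∣ x ∣ᵣ = x ⊔ᵣ (-ᵣ x)

ℝ-rawRing : RawRing 0ℓ 0ℓ
ℝ-rawRing = record
  { _≈_ = _≈_ ; _+_ = _+ᵣ_ ; _*_ = _*ᵣ_ ; -_ = -ᵣ_ ; 0# = 0ℝ ; 1# = 1ℝ }

open RawSemiringDefs (RawRing.rawSemiring ℝ-rawRing) public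
  using (sum; product) renaming (_^_ to _^ᵣ_)

module FractionLemmas where
  frac : ℕ → ℕ → ℚ
  frac a b = + a ℚ./ suc b

  frac-≤ : ∀ {a b c d} → a ℕ.* suc d ≤ c ℕ.* suc b → frac a b ℚ.≤ frac c d
  frac-≤ {a} {b} {c} {d} h = ℚP.toℚᵘ-cancel-≤
    (ℚᵘP.≤-respˡ-≃ (ℚᵘP.≃-sym (ℚP.toℚᵘ-fromℚᵘ (mkℚᵘ (+ a) b)))
      (ℚᵘP.≤-respʳ-≃ (ℚᵘP.≃-sym (ℚP.toℚᵘ-fromℚᵘ (mkℚᵘ (+ c) d)))
        (ℚᵘ.*≤* (subst₂ ℤ._≤_ (ℤP.pos-* a (suc d)) (ℤP.pos-* c (suc b)) (ℤ.+≤+ h)))))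

  frac-≡ : ∀ {a b c d} → a ℕ.* suc d ≡ c ℕ.* suc b → frac a b ≡ frac c d
  frac-≡ {a} {b} {c} {d} h = ℚP.≤-antisym
    (frac-≤ {a} {b} {c} {d} (ℕP.≤-reflexive h))
    (frac-≤ {c} {d} {a} {b} (ℕP.≤-reflexive (sym h)))

  frac-suc : ∀ a d → frac a d ℚ.+ frac 1 d ≡ frac (suc a) d
  frac-suc a d = ℚP.toℚᵘ-injective
    (ℚᵘP.≃-trans (ℚP.toℚᵘ-homo-+ (frac a d) (frac 1 d))
    (ℚᵘP.≃-trans (ℚᵘP.+-cong (ℚP.toℚᵘ-fromℚᵘ (mkℚᵘ (+ a) d)) (ℚP.toℚᵘ-fromℚᵘ (mkℚᵘ (+ 1) d)))
    (ℚᵘP.≃-trans (ℚᵘ.*≡* eq) (ℚᵘP.≃-sym (ℚP.toℚᵘ-fromℚᵘ (mkℚᵘ (+ suc a) d))))))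
    where
    open ℤSolver.+-*-Solver
    eq : (+ a ℤ.* + suc d ℤ.+ + 1 ℤ.* + suc d) ℤ.* + suc d
       ≡ + suc a ℤ.* (+ (suc d ℕ.* suc d))
    eq = trans
      (solve 2 (λ a d → (a :* d :+ con (+ 1) :* d) :* d := (con (+ 1) :+ a) :* (d :* d))
        refl (+ a) (+ suc d))
      (cong (+ suc a ℤ.*_) (sym (ℤP.pos-* (suc d) (suc d))))

  archimedean : ∀ {ε} → 0ℚ ℚ.< ε → ∃[ N ] (∀ n → N ≤ n → frac 1 n ℚ.≤ ε)
  archimedean {mkℚ +[1+ p ] q c} _ = q , λ n q≤n →
    subst (frac 1 n ℚ.≤_) (ℚP.↥p/↧p≡p (mkℚ +[1+ p ] q c))
      (frac-≤ {1} {n} {suc p} {q} (ℕP.≤-trans (ℕP.≤-reflexive (ℕP.*-identityˡ (suc q)))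
        (ℕP.≤-trans (s≤s q≤n) (ℕP.m≤n*m (suc n) (suc p)))))
  archimedean {mkℚ (+ 0) q c} 0<ε with ℚ.positive 0<ε
  ... | ()
  archimedean {mkℚ -[1+ p ] q c} 0<ε with ℚ.positive 0<ε
  ... | ()

  rate⇒cauchy : ∀ {x} → (∀ m n → x m ℚ.≤ x n ℚ.+ frac 1 n) → IsCauchy x
  rate⇒cauchy {x} h ε 0<ε with archimedean 0<ε
  ... | N , small = N , λ m n Nm Nn → ≤+⇒∣-∣≤ (x m) (x n)
    (ℚP.≤-trans (h m n) (ℚP.+-monoʳ-≤ (x n) (small n Nn)))
    (ℚP.≤-trans (h n m) (ℚP.+-monoʳ-≤ (x m) (small m Nm)))

open FractionLemmas

-- The largest j ≤ b with j ^ k ≤ a, or 0 if there is none.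
search : (k a b : ℕ) → ℕ
search k a zero    = 0
search k a (suc b) with suc b ℕ.^ k ℕP.≤? a
... | yes _ = suc b
... | no  _ = search k a b

-- The integer part of the k-th root of a, for k ≥ 1.
⌊_^1/_⌋ : ℕ → ℕ → ℕ
⌊ a ^1/ k ⌋ = search k a a

module SearchLemmas where
  search-lower : ∀ k a b → search (suc k) a b ℕ.^ suc k ≤ a
  search-lower k a zero    = z≤n
  search-lower k a (suc b) with suc b ℕ.^ suc k ℕP.≤? a
  ... | yes p = p
  ... | no  _ = search-lower k a b

  search-upper : ∀ k a b → a < suc b ℕ.^ k → a < suc (search k a b) ℕ.^ k
  search-upper k a zero    h = h
  search-upper k a (suc b) h with suc b ℕ.^ k ℕP.≤? a
  ... | yes _ = h
  ... | no ¬p = search-upper k a b (ℕP.≰⇒> ¬p)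

  iroot-upper : ∀ k a → a < suc ⌊ a ^1/ suc k ⌋ ℕ.^ suc k
  iroot-upper k a = search-upper (suc k) a a
    (ℕP.m≤m*n (suc a) (suc a ℕ.^ k) {{ℕP.m^n≢0 (suc a) k}})

  *-^ : ∀ a b k → (a ℕ.* b) ℕ.^ k ≡ a ℕ.^ k ℕ.* b ℕ.^ k
  *-^ a b zero    = refl
  *-^ a b (suc k) = trans (cong (a ℕ.* b ℕ.*_) (*-^ a b k))
    (solve 4 (λ a b c d → a :* b :* (c :* d) := a :* c :* (b :* d))
      refl a b (a ℕ.^ k) (b ℕ.^ k))
    where open ℕSolver.+-*-Solver

open SearchLemmas

rootSeq : ℕ → ℕ → ℕ → ℚ
rootSeq k a m = + ⌊ a ℕ.* suc m ℕ.^ k ^1/ k ⌋ ℚ./ suc m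

module RootLemmas where
  rootSeq-rate : ∀ k a m n →
    rootSeq (suc k) a m ℚ.≤ rootSeq (suc k) a n ℚ.+ frac 1 n
  rootSeq-rate k a m n = subst (rootSeq (suc k) a m ℚ.≤_) (sym (frac-suc j n))
    (frac-≤ {i} {m} {suc j} {n} (ℕP.<⇒≤ (ℕP.≰⇒> λ bad → ℕP.<-irrefl refl
      (ℕP.<-≤-trans powers (ℕP.^-monoˡ-≤ (suc k) bad)))))
    where
    open ℕSolver.+-*-Solver
    K = suc k
    i = ⌊ a ℕ.* suc m ℕ.^ K ^1/ K ⌋
    j = ⌊ a ℕ.* suc n ℕ.^ K ^1/ K ⌋
    open ℕP.≤-Reasoning
    powers : (i ℕ.* suc n) ℕ.^ K < (suc j ℕ.* suc m) ℕ.^ K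
    powers = begin-strict
      (i ℕ.* suc n) ℕ.^ K ≡⟨ *-^ i (suc n) K ⟩
      i ℕ.^ K ℕ.* suc n ℕ.^ K
        ≤⟨ ℕP.*-monoˡ-≤ (suc n ℕ.^ K)
             (search-lower k (a ℕ.* suc m ℕ.^ K) (a ℕ.* suc m ℕ.^ K)) ⟩
      a ℕ.* suc m ℕ.^ K ℕ.* suc n ℕ.^ K
        ≡⟨ solve 3 (λ a b c → a :* b :* c := a :* c :* b)
             refl a (suc m ℕ.^ K) (suc n ℕ.^ K) ⟩
      a ℕ.* suc n ℕ.^ K ℕ.* suc m ℕ.^ K
        <⟨ ℕP.*-monoˡ-< (suc m ℕ.^ K) {{ℕP.m^n≢0 (suc m) K}}
             (iroot-upper k (a ℕ.* suc n ℕ.^ K)) ⟩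
      suc j ℕ.^ K ℕ.* suc m ℕ.^ K ≡⟨ sym (*-^ (suc j) (suc m) K) ⟩
      (suc j ℕ.* suc m) ℕ.^ K ∎

  abstract
    root-cauchy : ∀ k a → IsCauchy (rootSeq (suc k) a)
    root-cauchy k a = rate⇒cauchy {rootSeq (suc k) a} (rootSeq-rate k a)

open RootLemmas

-- The k-th root of a: the m-th approximant is its truncation to a
-- multiple of 1/(m+1).  The value at k = 0 is a convention.
root : (k a : ℕ) → ℝ
root zero    a = 0ℝ
root (suc k) a = mkℝ (rootSeq (suc k) a) (root-cauchy k a)

√ : ℕ → ℝ
√ = root 2

-- n ^ (1 - 1/k) = (n ^ (k - 1)) ^ (1/k), for k ≥ 1.
_^[1-1/_] : ℕ → ℕ → ℝ
n ^[1-1/ k ] = root k (n ℕ.^ (k ∸ 1))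

harmonic : ℕ → ℚ
harmonic zero    = 0ℚ
harmonic (suc n) = harmonic n ℚ.+ (+ 1 ℚ./ suc n)

-- With M = m + 1 this is 1/(M+1) + 1/(M+2) + ... + 1/(tM), the lower
-- Riemann sum of the integral of 1/x over [1,t] with step 1/M.
logSeq : ℕ → ℕ → ℚ
logSeq t m = harmonic (t ℕ.* suc m) ℚ.- harmonic (suc m)

module HarmonicLemmas where
  H = harmonic

  block-lower : ∀ D a r → a ℕ.+ r ≤ suc D → H a ℚ.+ frac r D ℚ.≤ H (a ℕ.+ r)
  block-lower D a zero h = ℚP.≤-reflexive
    (trans (cong (H a ℚ.+_) (frac-≡ {0} {D} {0} {0} refl))
      (trans (ℚP.+-identityʳ (H a)) (cong H (sym (ℕP.+-identityʳ a)))))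
  block-lower D a (suc r) h = begin
    H a ℚ.+ frac (suc r) D             ≡⟨ cong (H a ℚ.+_) (sym (frac-suc r D)) ⟩
    H a ℚ.+ (frac r D ℚ.+ frac 1 D)    ≡⟨ sym (ℚP.+-assoc (H a) (frac r D) (frac 1 D)) ⟩
    H a ℚ.+ frac r D ℚ.+ frac 1 D
      ≤⟨ ℚP.+-mono-≤ (block-lower D a r (ℕP.≤-trans (ℕP.n≤1+n _) h'))
           (frac-≤ {1} {D} {1} {a ℕ.+ r} (ℕP.*-monoʳ-≤ 1 h')) ⟩
    H (suc (a ℕ.+ r))                  ≡⟨ cong H (sym (ℕP.+-suc a r)) ⟩
    H (a ℕ.+ suc r)                    ∎
    where
    open ℚP.≤-Reasoning
    h' : suc (a ℕ.+ r) ≤ suc D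
    h' = subst (_≤ suc D) (ℕP.+-suc a r) h

  block-upper : ∀ D a r → suc D ≤ suc a → H (a ℕ.+ r) ℚ.≤ H a ℚ.+ frac r D
  block-upper D a zero h = ℚP.≤-reflexive
    (sym (trans (cong (H a ℚ.+_) (frac-≡ {0} {D} {0} {0} refl))
      (trans (ℚP.+-identityʳ (H a)) (cong H (sym (ℕP.+-identityʳ a))))))
  block-upper D a (suc r) h = begin
    H (a ℕ.+ suc r)                    ≡⟨ cong H (ℕP.+-suc a r) ⟩
    H (a ℕ.+ r) ℚ.+ frac 1 (a ℕ.+ r)
      ≤⟨ ℚP.+-mono-≤ (block-upper D a r h)
           (frac-≤ {1} {a ℕ.+ r} {1} {D}
             (ℕP.*-monoʳ-≤ 1 (ℕP.≤-trans h (s≤s (ℕP.m≤m+n a r))))) ⟩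
    H a ℚ.+ frac r D ℚ.+ frac 1 D      ≡⟨ ℚP.+-assoc (H a) (frac r D) (frac 1 D) ⟩
    H a ℚ.+ (frac r D ℚ.+ frac 1 D)    ≡⟨ cong (H a ℚ.+_) (frac-suc r D) ⟩
    H a ℚ.+ frac (suc r) D             ∎
    where open ℚP.≤-Reasoning

  step-lower : ∀ n k → H (k ℕ.* suc n) ℚ.+ frac 1 k ℚ.≤ H (suc k ℕ.* suc n)
  step-lower n k = begin
    H (k ℕ.* suc n) ℚ.+ frac 1 k
      ≡⟨ cong (H (k ℕ.* suc n) ℚ.+_)
           (frac-≡ {1} {k} {suc n} {n ℕ.+ k ℕ.* suc n}
             (trans (ℕP.*-identityˡ _) (ℕP.*-comm (suc k) (suc n)))) ⟩
    H (k ℕ.* suc n) ℚ.+ frac (suc n) (n ℕ.+ k ℕ.* suc n)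
      ≤⟨ block-lower (n ℕ.+ k ℕ.* suc n) (k ℕ.* suc n) (suc n)
           (ℕP.≤-reflexive (ℕP.+-comm (k ℕ.* suc n) (suc n))) ⟩
    H (k ℕ.* suc n ℕ.+ suc n) ≡⟨ cong H (ℕP.+-comm (k ℕ.* suc n) (suc n)) ⟩
    H (suc k ℕ.* suc n) ∎
    where open ℚP.≤-Reasoning

  step-upper : ∀ m k → H (suc (suc k) ℕ.* suc m) ℚ.≤ H (suc k ℕ.* suc m) ℚ.+ frac 1 k
  step-upper m k = begin
    H (suc (suc k) ℕ.* suc m)
      ≡⟨ cong H (ℕP.+-comm (suc m) (suc k ℕ.* suc m)) ⟩
    H (suc k ℕ.* suc m ℕ.+ suc m)
      ≤⟨ block-upper (m ℕ.+ k ℕ.* suc m) (suc k ℕ.* suc m) (suc m) (ℕP.n≤1+n _) ⟩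
    H (suc k ℕ.* suc m) ℚ.+ frac (suc m) (m ℕ.+ k ℕ.* suc m)
      ≡⟨ cong (H (suc k ℕ.* suc m) ℚ.+_)
           (frac-≡ {suc m} {m ℕ.+ k ℕ.* suc m} {1} {k}
             (trans (ℕP.*-comm (suc m) (suc k)) (sym (ℕP.*-identityˡ _)))) ⟩
    H (suc k ℕ.* suc m) ℚ.+ frac 1 k ∎
    where open ℚP.≤-Reasoning

  refine-lower : ∀ n k r →
    H (r ℕ.+ k) ℚ.+ H (k ℕ.* suc n) ℚ.≤ H ((r ℕ.+ k) ℕ.* suc n) ℚ.+ H k
  refine-lower n k zero = ℚP.≤-reflexive (ℚP.+-comm (H k) (H (k ℕ.* suc n)))
  refine-lower n k (suc r) = begin
    H (r ℕ.+ k) ℚ.+ frac 1 (r ℕ.+ k) ℚ.+ H (k ℕ.* suc n)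
      ≡⟨ solve 3 (λ a b c → a :+ b :+ c := (a :+ c) :+ b) refl
           (H (r ℕ.+ k)) (frac 1 (r ℕ.+ k)) (H (k ℕ.* suc n)) ⟩
    H (r ℕ.+ k) ℚ.+ H (k ℕ.* suc n) ℚ.+ frac 1 (r ℕ.+ k)
      ≤⟨ ℚP.+-monoˡ-≤ (frac 1 (r ℕ.+ k)) (refine-lower n k r) ⟩
    H ((r ℕ.+ k) ℕ.* suc n) ℚ.+ H k ℚ.+ frac 1 (r ℕ.+ k)
      ≡⟨ solve 3 (λ a b c → a :+ b :+ c := (a :+ c) :+ b) refl
           (H ((r ℕ.+ k) ℕ.* suc n)) (H k) (frac 1 (r ℕ.+ k)) ⟩
    H ((r ℕ.+ k) ℕ.* suc n) ℚ.+ frac 1 (r ℕ.+ k) ℚ.+ H k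
      ≤⟨ ℚP.+-monoˡ-≤ (H k) (step-lower n (r ℕ.+ k)) ⟩
    H (suc (r ℕ.+ k) ℕ.* suc n) ℚ.+ H k ∎
    where open ℚP.≤-Reasoning
          open ℚSolver.+-*-Solver

  refine-upper : ∀ m k r →
    H (suc (r ℕ.+ k) ℕ.* suc m) ℚ.+ H (suc k) ℚ.+ frac 1 (r ℕ.+ k)
      ℚ.≤ H (suc (r ℕ.+ k)) ℚ.+ H (suc k ℕ.* suc m) ℚ.+ frac 1 k
  refine-upper m k zero = ℚP.≤-reflexive
    (cong (ℚ._+ frac 1 k) (ℚP.+-comm (H (suc k ℕ.* suc m)) (H (suc k))))
  refine-upper m k (suc r) = begin
    H (suc (suc q) ℕ.* suc m) ℚ.+ H (suc k) ℚ.+ frac 1 (suc q)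
      ≤⟨ ℚP.+-monoˡ-≤ (frac 1 (suc q)) (ℚP.+-monoˡ-≤ (H (suc k)) (step-upper m q)) ⟩
    H (suc q ℕ.* suc m) ℚ.+ frac 1 q ℚ.+ H (suc k) ℚ.+ frac 1 (suc q)
      ≡⟨ solve 4 (λ a b c d → a :+ b :+ c :+ d := (a :+ c :+ b) :+ d) refl
           (H (suc q ℕ.* suc m)) (frac 1 q) (H (suc k)) (frac 1 (suc q)) ⟩
    H (suc q ℕ.* suc m) ℚ.+ H (suc k) ℚ.+ frac 1 q ℚ.+ frac 1 (suc q)
      ≤⟨ ℚP.+-monoˡ-≤ (frac 1 (suc q)) (refine-upper m k r) ⟩
    H (suc q) ℚ.+ H (suc k ℕ.* suc m) ℚ.+ frac 1 k ℚ.+ frac 1 (suc q)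
      ≡⟨ solve 4 (λ a b c d → a :+ b :+ c :+ d := (a :+ d) :+ b :+ c) refl
           (H (suc q)) (H (suc k ℕ.* suc m)) (frac 1 k) (frac 1 (suc q)) ⟩
    H (suc (suc q)) ℚ.+ H (suc k ℕ.* suc m) ℚ.+ frac 1 k ∎
    where open ℚP.≤-Reasoning
          open ℚSolver.+-*-Solver
          q = r ℕ.+ k

  combine : ∀ a b c e f g i → a ℚ.+ c ℚ.≤ e ℚ.+ b → e ℚ.+ g ℚ.≤ f ℚ.+ c ℚ.+ i →
    a ℚ.- b ℚ.≤ (f ℚ.- g) ℚ.+ i
  combine a b c e f g i lower upper = begin
    a ℚ.- b
      ≡⟨ solve 3 (λ a b c → a :- b := (a :+ c) :- (b :+ c)) refl a b c ⟩
    (a ℚ.+ c) ℚ.- (b ℚ.+ c)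
      ≤⟨ ℚP.+-monoˡ-≤ (ℚ.- (b ℚ.+ c)) lower ⟩
    (e ℚ.+ b) ℚ.- (b ℚ.+ c)
      ≡⟨ solve 4 (λ e b c g → (e :+ b) :- (b :+ c) := (e :+ g) :- (c :+ g)) refl e b c g ⟩
    (e ℚ.+ g) ℚ.- (c ℚ.+ g)
      ≤⟨ ℚP.+-monoˡ-≤ (ℚ.- (c ℚ.+ g)) upper ⟩
    (f ℚ.+ c ℚ.+ i) ℚ.- (c ℚ.+ g)
      ≡⟨ solve 4 (λ f c g i → (f :+ c :+ i) :- (c :+ g) := (f :- g) :+ i) refl f c g i ⟩
    (f ℚ.- g) ℚ.+ i ∎
    where
    open ℚP.≤-Reasoning
    open ℚSolver.+-*-Solver

  drop-frac : ∀ a b k → a ℚ.+ frac 1 k ℚ.≤ b → a ℚ.≤ b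
  drop-frac a b k h = ℚP.≤-trans
    (subst (ℚ._≤ a ℚ.+ frac 1 k) (ℚP.+-identityʳ a)
      (ℚP.+-monoʳ-≤ a (frac-≤ {0} {0} {1} {k} z≤n)))
    h

  lower-bound : ∀ u m n →
    H (suc u ℕ.* suc m) ℚ.+ H (suc m ℕ.* suc n)
      ℚ.≤ H ((suc u ℕ.* suc m) ℕ.* suc n) ℚ.+ H (suc m)
  lower-bound u m n = subst
    (λ z → H z ℚ.+ H (suc m ℕ.* suc n) ℚ.≤ H (z ℕ.* suc n) ℚ.+ H (suc m))
    (ℕP.+-comm (u ℕ.* suc m) (suc m)) (refine-lower n (suc m) (u ℕ.* suc m))

  upper-bound : ∀ u m n →
    H ((suc u ℕ.* suc m) ℕ.* suc n) ℚ.+ H (suc n)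
      ℚ.≤ H (suc u ℕ.* suc n) ℚ.+ H (suc m ℕ.* suc n) ℚ.+ frac 1 n
  upper-bound u m n = rearrange _ _ _
    (cong suc (ℕP.+-comm r n)) eq (ℕP.*-comm (suc n) (suc m))
    (drop-frac (H (suc (r ℕ.+ n) ℕ.* suc m) ℚ.+ H (suc n))
      (H (suc (r ℕ.+ n)) ℚ.+ H (suc n ℕ.* suc m) ℚ.+ frac 1 n) (r ℕ.+ n)
      (refine-upper m n r))
    where
    r = u ℕ.* suc n
    rearrange : ∀ {p q w} p′ q′ w′ → p ≡ p′ → q ≡ q′ → w ≡ w′ →
      H q ℚ.+ H (suc n) ℚ.≤ H p ℚ.+ H w ℚ.+ frac 1 n →
      H q′ ℚ.+ H (suc n) ℚ.≤ H p′ ℚ.+ H w′ ℚ.+ frac 1 n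
    rearrange _ _ _ refl refl refl h = h
    eq : suc (r ℕ.+ n) ℕ.* suc m ≡ (suc u ℕ.* suc m) ℕ.* suc n
    eq = trans (cong (λ z → suc z ℕ.* suc m) (ℕP.+-comm r n))
      (trans (ℕP.*-assoc (suc u) (suc n) (suc m))
      (trans (cong (suc u ℕ.*_) (ℕP.*-comm (suc n) (suc m)))
        (sym (ℕP.*-assoc (suc u) (suc m) (suc n)))))

  logSeq-rate : ∀ u m n → logSeq (suc u) m ℚ.≤ logSeq (suc u) n ℚ.+ frac 1 n
  logSeq-rate u m n = combine
    (H (suc u ℕ.* suc m)) (H (suc m)) (H (suc m ℕ.* suc n))
    (H ((suc u ℕ.* suc m) ℕ.* suc n)) (H (suc u ℕ.* suc n)) (H (suc n)) (frac 1 n)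
    (lower-bound u m n) (upper-bound u m n)

  abstract
    log-cauchy : ∀ u → IsCauchy (logSeq (suc u))
    log-cauchy u = rate⇒cauchy {logSeq (suc u)} (logSeq-rate u)

open HarmonicLemmas

-- The natural logarithm; the value at 0 is a convention.
log : ℕ → ℝ
log zero    = 0ℝ
log (suc u) = mkℝ (logSeq (suc u)) (log-cauchy u)

record Graph (n : ℕ) : Set where
  field
    adj        : Fin n → Fin n → Bool
    adj-sym    : ∀ i j → adj i j ≡ adj j i
    adj-irrefl : ∀ i → adj i i ≡ false

open Graph public

IsClique IsIndependent : ∀ {n} → Graph n → Subset n → Set
IsClique      G S = ∀ i j → i ∈ S → j ∈ S → i ≢ j → adj G i j ≡ true
IsIndependent G S = ∀ i j → i ∈ S → j ∈ S → adj G i j ≡ false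

HasClique HasIndependent : ∀ {n} → Graph n → ℕ → Set
HasClique      G s = ∃[ S ] ∣ S ∣ ≡ s × IsClique G S
HasIndependent G t = ∃[ S ] ∣ S ∣ ≡ t × IsIndependent G S

K[_]-Free : ∀ {n} → ℕ → Graph n → Set
K[ s ]-Free G = ¬ HasClique G s

Forces : ℕ → ℕ → ℕ → Set
Forces s t n = (G : Graph n) → HasClique G s ⊎ HasIndependent G t

IsRamseyNumber : (s t r : ℕ) → Set
IsRamseyNumber s t r = Forces s t r × (∀ n → Forces s t n → r ≤ n)

Matrix : ℕ → Set
Matrix n = Fin n → Fin n → ℝ

det : ∀ {n} → Matrix n → ℝ
det {zero}  A = 1ℝ
det {suc n} A = sum λ j →
  ((-ᵣ 1ℝ) ^ᵣ toℕ j) *ᵣ (A zero j *ᵣ det (λ i k → A (suc i) (punchIn j k)))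

charPoly : ∀ {n} → Matrix n → ℝ → ℝ
charPoly A x = det λ i j → (if does (i ≟ᶠ j) then x else 0ℝ) -ᵣ A i j

adjacencyMatrix : ∀ {n} → Graph n → Matrix n
adjacencyMatrix G i j = if adj G i j then 1ℝ else 0ℝ

-- μ lists the eigenvalues of A in decreasing order, with algebraic
-- multiplicity: det (xI - A) is the product of the x - μᵢ.
IsSpectrum : ∀ {n} → Matrix n → (Fin n → ℝ) → Set
IsSpectrum A μ =
  (∀ i j → toℕ i ≤ toℕ j → μ j ≤ᵣ μ i) ×
  (∀ x → charPoly A x ≈ product (λ i → x -ᵣ μ i))

degree : ∀ {n} → Graph n → Fin n → ℕ
degree G i = ∣ tabulate (adj G i) ∣

-- In particular n ≥ 2, since λ₂ has to exist.
record IsNDλGraph {n : ℕ} (G : Graph n) (d : ℕ) (ev : ℝ) : Set where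
  field
    regular     : ∀ i → degree G i ≡ d
    μ           : Fin n → ℝ
    spectrum    : IsSpectrum (adjacencyMatrix G) μ
    second last : Fin n
    second≡     : toℕ second ≡ 1
    last≡       : suc (toℕ last) ≡ n
    ev≈         : ev ≈ ∣ μ second ∣ᵣ ⊔ᵣ ∣ μ last ∣ᵣ

{-# OPTIONS --safe #-}

-- An (n,d,λ)-graph satisfies e(U) ≥ d|U|²/n - λ|U| for every vertex set U, so
-- each set of more than R ≈ 2λn/d vertices has a vertex joined to a fraction
-- d/2n of it.  By the Kleitman–Winston algorithm the independent sets then lie
-- in at most 2^O((n/d) log² n) containers of about R vertices each.  If t is a
-- large multiple of (n/d) log² n, a random map from t n / R vertices to the
-- graph hits every container fewer than t times, so the pulled back graph,
-- still K_s-free, has no independent set of size t; with n ≈ (t / log² t)^(2s-3)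
-- the number of its vertices is of order t^(s-1) / (log t)^(2s-4).
--
-- No spectral theorem is needed for the first step: by the product formula
-- det (xI - A) is bounded away from 0 for all rational x ≤ -y, where y > λ,
-- and a form that is semidefinite with determinant bounded away from 0 is
-- definite by a fixed margin.  Hence v·Av ≥ x v·v, which is clear for x = -n,
-- persists while x increases in steps of that margin up to -y.
module Submission where

open import Defs
open import Algebra.Bundles using (CommutativeRing)
import Algebra.Properties.Semiring.Sum as SemiringSum
open import Data.Bool.Base using (Bool; if_then_else_; true; false; _∧_; not)
import Data.Bool.Properties as BoolP
open import Data.Fin.Base using (Fin; zero; suc; toℕ; punchIn; punchOut)
open import Data.Fin.Properties as FinP using () renaming (_≟_ to _≟ᶠ_)
import Data.Fin.Subset as Subset
import Data.Integer.Base as ℤ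
open import Data.List.Base as List using (List; []; _∷_; _++_; length)
import Data.List.Properties as ListP
open import Data.List.Relation.Unary.All as All using (All; []; _∷_)
import Data.List.Relation.Unary.All.Properties as AllP
open import Data.List.Relation.Unary.Any as Any using (Any; here; there)
import Data.List.Relation.Unary.Any.Properties as AnyP
open import Data.Nat.Base as ℕ using (ℕ; zero; suc)
open import Data.Nat.DivMod using (_/_; m/n*n≤m; m*n/n≡m; /-monoˡ-≤; m≡m%n+[m/n]*n; m%n<n)
import Data.Nat.Properties as ℕP
import Data.Nat.Solver as ℕSolver
open import Data.Product.Base using (∃-syntax; _×_; _,_; proj₁; proj₂)
open import Data.Rational.Base as ℚ using (ℚ; 0ℚ; 1ℚ; ½)
import Data.Rational.Properties as ℚP
import Data.Rational.Solver as ℚSolver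
open import Data.Sum.Base using (_⊎_; inj₁; inj₂)
open import Data.Vec.Base as Vec using (tabulate)
import Data.Vec.Functional as Vector
import Data.Vec.Properties as VecP
open import Function.Base using (_∘_)
open import Relation.Binary.PropositionalEquality
open import Relation.Nullary using (¬_; Dec; yes; no; contradiction)
open import Relation.Nullary.Decidable using (does; _×-dec_; dec-true)

open RationalLemmas
open CauchyLemmas using (divide; bounded)
open FractionLemmas using (frac; frac-≤; frac-≡; frac-suc; archimedean)
open SearchLemmas using (search-lower; iroot-upper; *-^)
open RootLemmas using (rootSeq-rate)
open HarmonicLemmas using (block-lower)

-- The eigenvalues are given only as Cauchy sequences and eigenvectors are not given at all. The
-- spectrum is therefore used solely through values of the characteristic polynomial at rational
-- points, which are exact rationals, and all linear algebra takes place over ℚ. The exponents arise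
-- as follows. Put σ = s - 2 and k = 2σ + 1, and take n = a^k with a = P e, a perfect power, so that
-- n^(1 - 1/k) is the integer a^(2σ) and d is at least of that order. Then n/d is at most of order
-- a, and λn/d, at most of order n/√d, is at most of order a^(σ+1). Dividing n by the latter leaves
-- a^σ, so a container fills at most a fraction 1/(2b) of the graph for b = e^σ, once P is large.
-- Hence of order b t vertices can be mapped, and the logarithms enter only through e, which is of
-- order t / (log t)².

module ∑ℕ = SemiringSum ℕP.+-*-semiring
module ℕS = ℕSolver.+-*-Solver

-- Determinants over ℚ: alternation in the rows and the adjugate.

module Determinant where
  open import Data.Rational.Base using (_+_; _*_; -_; _-_)
  open ℚSolver.+-*-Solver using (solve; _:=_; _:+_; _:*_; _:-_; :-_; con)
  open SemiringSum (CommutativeRing.semiring ℚP.+-*-commutativeRing) public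
    using (sum-cong-≗; sum-remove; sum-replicate-zero; ∑-distrib-+; ∑-comm; *-distribˡ-sum; *-distribʳ-sum)
    renaming (sum to ∑)

  Mat : ℕ → Set
  Mat n = Fin n → Fin n → ℚ

  sign : ℕ → ℚ
  sign zero    = 1ℚ
  sign (suc k) = (- 1ℚ) * sign k

  minor : ∀ {n} → Mat (suc n) → Fin (suc n) → Mat n
  minor A j i k = A (suc i) (punchIn j k)

  detℚ : ∀ {n} → Mat n → ℚ
  detℚ {zero}  A = 1ℚ
  detℚ {suc n} A = ∑ λ j → sign (toℕ j) * (A zero j * detℚ (minor A j))

  detℚ-cong : ∀ {n} {A B : Mat n} → (∀ i j → A i j ≡ B i j) → detℚ A ≡ detℚ B
  detℚ-cong {zero}  h = refl
  detℚ-cong {suc n} h = sum-cong-≗ λ j → cong (sign (toℕ j) *_)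
    (cong₂ _*_ (h zero j) (detℚ-cong λ i k → h (suc i) (punchIn j k)))

  swap₀₁ : ∀ {n} → Mat (suc (suc n)) → Mat (suc (suc n))
  swap₀₁ A zero          = A (suc zero)
  swap₀₁ A (suc zero)    = A zero
  swap₀₁ A (suc (suc i)) = A (suc (suc i))

  punchIn-swap : ∀ {n} {j l : Fin (suc (suc n))} (j≢l : j ≢ l) (l≢j : l ≢ j) x →
    punchIn j (punchIn (punchOut j≢l) x) ≡ punchIn l (punchIn (punchOut l≢j) x)
  punchIn-swap {j = zero}  {zero}  j≢l l≢j x = contradiction refl j≢l
  punchIn-swap {j = zero}  {suc l} j≢l l≢j x = refl
  punchIn-swap {j = suc j} {zero}  j≢l l≢j x = refl
  punchIn-swap {suc n} {j = suc j} {suc l} j≢l l≢j zero    = refl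
  punchIn-swap {suc n} {j = suc j} {suc l} j≢l l≢j (suc x) =
    cong suc (punchIn-swap (j≢l ∘ cong suc) (l≢j ∘ cong suc) x)

  -- `punchOut` lowers only the larger of the two indices, so the exponents on the two sides differ
  -- by exactly one.
  sign-swap : ∀ {n} {j l : Fin (suc (suc n))} (j≢l : j ≢ l) (l≢j : l ≢ j) →
    sign (toℕ j) * sign (toℕ (punchOut j≢l)) ≡ - (sign (toℕ l) * sign (toℕ (punchOut l≢j)))
  sign-swap {j = zero} {zero} j≢l l≢j = contradiction refl j≢l
  sign-swap {j = zero} {suc l} j≢l l≢j =
    solve 1 (λ x → con 1ℚ :* x := :- (:- con 1ℚ :* x :* con 1ℚ)) refl (sign (toℕ l))
  sign-swap {j = suc j} {zero} j≢l l≢j =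
    solve 1 (λ x → :- con 1ℚ :* x :* con 1ℚ := :- (con 1ℚ :* x)) refl (sign (toℕ j))
  sign-swap {zero} {suc zero} {suc zero} j≢l l≢j = contradiction refl j≢l
  sign-swap {suc n} {suc j} {suc l} j≢l l≢j = trans
    (lemma (sign (toℕ j)) (sign (toℕ (punchOut (j≢l ∘ cong suc)))))
    (trans (sign-swap (j≢l ∘ cong suc) (l≢j ∘ cong suc))
      (cong -_ (sym (lemma (sign (toℕ l)) (sign (toℕ (punchOut (l≢j ∘ cong suc))))))))
    where
    lemma : ∀ x y → (- 1ℚ) * x * ((- 1ℚ) * y) ≡ x * y
    lemma = solve 2 (λ x y → :- con 1ℚ :* x :* (:- con 1ℚ :* y) := x :* y) refl

  neg-∑ : ∀ {n} (f : Fin n → ℚ) → ∑ (λ i → - f i) ≡ - ∑ f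
  neg-∑ {zero}  f = refl
  neg-∑ {suc n} f = trans (cong (- f zero +_) (neg-∑ (f ∘ suc))) (sym (ℚP.neg-distrib-+ (f zero) _))

  module _ {n : ℕ} (R : Fin n → Fin (suc (suc n)) → ℚ) where

    minor² : Fin (suc (suc n)) → Fin (suc n) → ℚ
    minor² j k = sign (toℕ j) * sign (toℕ k) *
      detℚ λ i l → R i (punchIn j (punchIn k l))

    minor²-swap : ∀ {j l} (j≢l : j ≢ l) (l≢j : l ≢ j) →
      minor² j (punchOut j≢l) ≡ - minor² l (punchOut l≢j)
    minor²-swap {j} {l} j≢l l≢j = trans
      (cong₂ _*_ (sign-swap j≢l l≢j)
        (detℚ-cong λ i x → cong (R i) (punchIn-swap j≢l l≢j x)))
      (sym (ℚP.neg-distribˡ-* (sign (toℕ l) * sign (toℕ (punchOut l≢j))) _))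

    -- The coefficient of A₀ⱼA₁ₗ in the determinant.
    cof² : Fin (suc (suc n)) → Fin (suc (suc n)) → ℚ
    cof² j l with j ≟ᶠ l
    ... | yes _   = 0ℚ
    ... | no  j≢l = minor² j (punchOut j≢l)

    cof²-diag : ∀ j → cof² j j ≡ 0ℚ
    cof²-diag j with j ≟ᶠ j
    ... | yes _   = refl
    ... | no  j≢j = contradiction refl j≢j

    cof²-off : ∀ j k → cof² j (punchIn j k) ≡ minor² j k
    cof²-off j k with j ≟ᶠ punchIn j k
    ... | yes e = contradiction (sym e) (FinP.punchInᵢ≢i j k)
    ... | no  p = cong (minor² j) (trans (FinP.punchOut-cong j refl) (FinP.punchOut-punchIn j))

    cof²-swap : ∀ j l → cof² j l ≡ - cof² l j
    cof²-swap j l with j ≟ᶠ l | l ≟ᶠ j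
    ... | yes _ | yes _ = refl
    ... | yes e | no  p = contradiction (sym e) p
    ... | no  p | yes e = contradiction (sym e) p
    ... | no  p | no  p′ = minor²-swap p p′

  -- Since `cof²` vanishes on the diagonal, `l` may range over all columns and not only over those
  -- other than `j`; the square double sum can then be transposed.
  detℚ-double : ∀ {n} (A : Mat (suc (suc n))) → detℚ A ≡ ∑ λ j → ∑ λ l → A zero j * A (suc zero) l * cof² (λ i → A (suc (suc i))) j l
  detℚ-double {n} A = sum-cong-≗ λ j → begin
    sign (toℕ j) * (A zero j * ∑ (λ k → inner j k))
      ≡⟨ sym (ℚP.*-assoc (sign (toℕ j)) (A zero j) _) ⟩
    sign (toℕ j) * A zero j * ∑ (λ k → inner j k)
      ≡⟨ *-distribˡ-sum (sign (toℕ j) * A zero j) (inner j) ⟩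
    ∑ (λ k → sign (toℕ j) * A zero j * inner j k)
      ≡⟨ sum-cong-≗ (λ k → trans
           (solve 5 (λ a b c d e → a :* b :* (c :* (d :* e)) := b :* d :* (a :* c :* e)) refl
             (sign (toℕ j)) (A zero j) (sign (toℕ k)) (A (suc zero) (punchIn j k))
             (detℚ λ i l → A (suc (suc i)) (punchIn j (punchIn k l))))
           (cong (A zero j * A (suc zero) (punchIn j k) *_) (sym (cof²-off (λ i → A (suc (suc i))) j k)))) ⟩
    ∑ (λ k → term j (punchIn j k))
      ≡⟨ sym (ℚP.+-identityˡ _) ⟩
    0ℚ + ∑ (λ k → term j (punchIn j k))
      ≡⟨ cong (_+ ∑ (λ k → term j (punchIn j k)))
           (sym (trans (cong (A zero j * A (suc zero) j *_) (cof²-diag (λ i → A (suc (suc i))) j)) (ℚP.*-zeroʳ (A zero j * A (suc zero) j)))) ⟩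
    term j j + ∑ (λ k → term j (punchIn j k))
      ≡⟨ sym (sum-remove {i = j} (term j)) ⟩
    ∑ (term j) ∎
    where
    open ≡-Reasoning
    inner : Fin (suc (suc n)) → Fin (suc n) → ℚ
    inner j k = sign (toℕ k) * (A (suc zero) (punchIn j k) *
      detℚ λ i l → A (suc (suc i)) (punchIn j (punchIn k l)))
    term : Fin (suc (suc n)) → Fin (suc (suc n)) → ℚ
    term j l = A zero j * A (suc zero) l * cof² (λ i → A (suc (suc i))) j l

  detℚ-swap₀₁ : ∀ {n} (A : Mat (suc (suc n))) → detℚ A ≡ - detℚ (swap₀₁ A)
  detℚ-swap₀₁ A = begin
    detℚ A ≡⟨ detℚ-double A ⟩
    ∑ (λ j → ∑ λ l → A zero j * A (suc zero) l * cof² R j l)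
      ≡⟨ ∑-comm (λ j l → A zero j * A (suc zero) l * cof² R j l) ⟩
    ∑ (λ l → ∑ λ j → A zero j * A (suc zero) l * cof² R j l)
      ≡⟨ sum-cong-≗ (λ l → trans
           (sum-cong-≗ λ j → trans (cong (A zero j * A (suc zero) l *_) (cof²-swap R j l))
             (solve 3 (λ a b c → a :* b :* (:- c) := :- (b :* a :* c)) refl
               (A zero j) (A (suc zero) l) (cof² R l j)))
           (neg-∑ λ j → A (suc zero) l * A zero j * cof² R l j)) ⟩
    ∑ (λ l → - ∑ λ j → A (suc zero) l * A zero j * cof² R l j)
      ≡⟨ neg-∑ (λ l → ∑ λ j → A (suc zero) l * A zero j * cof² R l j) ⟩
    - ∑ (λ l → ∑ λ j → A (suc zero) l * A zero j * cof² R l j)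
      ≡⟨ cong -_ (sym (detℚ-double (swap₀₁ A))) ⟩
    - detℚ (swap₀₁ A) ∎
    where
    open ≡-Reasoning
    R = λ i → A (suc (suc i))

  x≡-x⇒x≡0 : ∀ x → x ≡ - x → x ≡ 0ℚ
  x≡-x⇒x≡0 x e = begin
    x              ≡⟨ solve 1 (λ x → x := con ½ :* (x :+ x)) refl x ⟩
    ½ * (x + x)    ≡⟨ cong (λ z → ½ * (x + z)) e ⟩
    ½ * (x + - x)  ≡⟨ solve 1 (λ x → con ½ :* (x :+ (:- x)) := con 0ℚ) refl x ⟩
    0ℚ             ∎
    where open ≡-Reasoning

  -- If the equal rows are the first two, exchanging them gives det = - det. Otherwise exchange the
  -- first two rows all the same: the repeated row then heads every minor of the expansion, and
  -- induction applies.
  detℚ-alternating : ∀ {n} (B : Mat (suc n)) r → (∀ c → B zero c ≡ B (suc r) c) → detℚ B ≡ 0ℚ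
  detℚ-alternating {suc n} B zero h = x≡-x⇒x≡0 (detℚ B)
    (trans (detℚ-swap₀₁ B) (cong -_ (detℚ-cong {A = swap₀₁ B} {B} λ where
      zero          c → sym (h c)
      (suc zero)    c → h c
      (suc (suc i)) c → refl)))
  detℚ-alternating {suc n} B (suc r) h = trans (detℚ-swap₀₁ B) (cong -_ (trans
    (sum-cong-≗ λ j → trans
      (cong (λ z → sign (toℕ j) * (B (suc zero) j * z))
        (detℚ-alternating (minor (swap₀₁ B) j) r λ c → h (punchIn j c)))
      (solve 2 (λ a b → a :* (b :* con 0ℚ) := con 0ℚ) refl (sign (toℕ j)) (B (suc zero) j)))
    (sum-replicate-zero (suc (suc n)))))

  δ : ∀ {n} → Fin n → Fin n → ℚ
  δ i j = if does (i ≟ᶠ j) then 1ℚ else 0ℚ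

  -- Column `j` is replaced by eᵢ and moved to the front; the sign in `adjugate` undoes the move. In
  -- this form the matrix is, entry by entry, a minor of the bordered matrix in `adjugate-inverse`.
  replaceColumn : ∀ {n} → Mat (suc n) → Fin (suc n) → Fin (suc n) → Mat (suc n)
  replaceColumn P i j k zero    = δ i k
  replaceColumn P i j k (suc c) = P k (punchIn j c)

  adjugate : ∀ {n} → Mat (suc n) → Mat (suc n)
  adjugate P j i = sign (toℕ j) * detℚ (replaceColumn P i j)

  -- Expand the determinant of P bordered by the column eᵢ and by a second copy of row r.
  adjugate-inverse : ∀ {n} (P : Mat (suc n)) r i → ∑ (λ j → P r j * adjugate P j i) ≡ δ i r * detℚ P
  adjugate-inverse {n} P r i = begin
    ∑ (λ j → P r j * adjugate P j i)
      ≡⟨ solve 2 (λ a b → b := a :- (a :+ (:- b))) refl (1ℚ * (δ i r * detℚ P)) (∑ (λ j → P r j * adjugate P j i)) ⟩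
    1ℚ * (δ i r * detℚ P) - (1ℚ * (δ i r * detℚ P) + - ∑ (λ j → P r j * adjugate P j i))
      ≡⟨ cong (λ z → 1ℚ * (δ i r * detℚ P) - z) (trans (sym expansion) (detℚ-alternating bordered r λ where
           zero    → refl
           (suc c) → refl)) ⟩
    1ℚ * (δ i r * detℚ P) - 0ℚ
      ≡⟨ solve 1 (λ a → con 1ℚ :* a :- con 0ℚ := a) refl (δ i r * detℚ P) ⟩
    δ i r * detℚ P ∎
    where
    open ≡-Reasoning
    row : Fin (suc n) → Fin (suc (suc n)) → ℚ
    row k zero    = δ i k
    row k (suc c) = P k c
    bordered : Mat (suc (suc n))
    bordered zero    = row r
    bordered (suc k) = row k
    expansion : detℚ bordered ≡ 1ℚ * (δ i r * detℚ P) + - ∑ (λ j → P r j * adjugate P j i)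
    expansion = cong (1ℚ * (δ i r * detℚ P) +_) (trans
      (sum-cong-≗ λ j → trans
        (cong (λ z → (- 1ℚ) * sign (toℕ j) * (P r j * z))
          (detℚ-cong {A = minor bordered (suc j)} {replaceColumn P i j} λ where
            k zero    → refl
            k (suc c) → refl))
        (solve 3 (λ s p d → :- con 1ℚ :* s :* (p :* d) := :- (p :* (s :* d))) refl
          (sign (toℕ j)) (P r j) (detℚ (replaceColumn P i j))))
      (neg-∑ λ j → P r j * adjugate P j i))

-- Quadratic forms over ℚ: from a determinant bound to definiteness.

module QuadraticForm where
  open import Data.Rational.Base using (_+_; _*_; -_; _-_; ∣_∣; _≤_; _<_)
  open ℚSolver.+-*-Solver using (solve; _:=_; _:+_; _:*_; _:-_; :-_; con)
  open Determinant

  0≤p*q : ∀ {p q} → 0ℚ ≤ p → 0ℚ ≤ q → 0ℚ ≤ p * q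
  0≤p*q {p} {q} 0≤p 0≤q = ℚP.nonNegative⁻¹ (p * q)
    {{ℚP.nonNeg*nonNeg⇒nonNeg p {{ℚ.nonNegative 0≤p}} q {{ℚ.nonNegative 0≤q}}}}

  0<p*q : ∀ {p q} → 0ℚ < p → 0ℚ < q → 0ℚ < p * q
  0<p*q {p} {q} 0<p 0<q = ℚP.positive⁻¹ (p * q)
    {{ℚP.pos*pos⇒pos p {{ℚ.positive 0<p}} q {{ℚ.positive 0<q}}}}

  0≤p+q : ∀ {p q} → 0ℚ ≤ p → 0ℚ ≤ q → 0ℚ ≤ p + q
  0≤p+q = ℚP.+-mono-≤

  *-monoˡ : ∀ {r p q} → 0ℚ ≤ r → p ≤ q → r * p ≤ r * q
  *-monoˡ {r} 0≤r = ℚP.*-monoˡ-≤-nonNeg r {{ℚ.nonNegative 0≤r}}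

  *-monoʳ : ∀ {r p q} → 0ℚ ≤ r → p ≤ q → p * r ≤ q * r
  *-monoʳ {r} 0≤r = ℚP.*-monoʳ-≤-nonNeg r {{ℚ.nonNegative 0≤r}}

  0≤q-p⇒p≤q : ∀ {p q} → 0ℚ ≤ q - p → p ≤ q
  0≤q-p⇒p≤q {p} {q} h = subst₂ _≤_ (ℚP.+-identityʳ p)
    (solve 2 (λ p q → p :+ (q :- p) := q) refl p q) (ℚP.+-monoʳ-≤ p h)

  p≤q⇒0≤q-p : ∀ {p q} → p ≤ q → 0ℚ ≤ q - p
  p≤q⇒0≤q-p {p} {q} h = subst (_≤ q - p) (ℚP.+-inverseʳ p) (ℚP.+-monoˡ-≤ (- p) h)

  0≤p*p : ∀ p → 0ℚ ≤ p * p
  0≤p*p p with ℚP.≤-total 0ℚ p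
  ... | inj₁ 0≤p = 0≤p*q 0≤p 0≤p
  ... | inj₂ p≤0 = ℚP.nonNegative⁻¹ (p * p)
    {{ℚP.nonPos*nonPos⇒nonPos p {{ℚ.nonPositive p≤0}} p {{ℚ.nonPositive p≤0}}}}

  ∑-mono : ∀ {n} {f g : Fin n → ℚ} → (∀ i → f i ≤ g i) → ∑ f ≤ ∑ g
  ∑-mono {zero}  h = ℚP.≤-refl
  ∑-mono {suc n} h = ℚP.+-mono-≤ (h zero) (∑-mono (h ∘ suc))

  ∑-nonNeg : ∀ {n} {f : Fin n → ℚ} → (∀ i → 0ℚ ≤ f i) → 0ℚ ≤ ∑ f
  ∑-nonNeg {zero}  h = ℚP.≤-refl
  ∑-nonNeg {suc n} h = 0≤p+q (h zero) (∑-nonNeg (h ∘ suc))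

  ∣∑∣≤∑∣∣ : ∀ {n} (f : Fin n → ℚ) → ∣ ∑ f ∣ ≤ ∑ λ i → ∣ f i ∣
  ∣∑∣≤∑∣∣ {zero}  f = ℚP.≤-refl
  ∣∑∣≤∑∣∣ {suc n} f = ℚP.≤-trans (ℚP.∣p+q∣≤∣p∣+∣q∣ (f zero) (∑ (f ∘ suc)))
    (ℚP.+-monoʳ-≤ ∣ f zero ∣ (∣∑∣≤∑∣∣ (f ∘ suc)))

  ∑-δ : ∀ {n} (r : Fin n) (x : Fin n → ℚ) → ∑ (λ i → δ i r * x i) ≡ x r
  ∑-δ {suc n} r x = begin
    ∑ (λ i → δ i r * x i)
      ≡⟨ sum-remove {i = r} (λ i → δ i r * x i) ⟩
    δ r r * x r + ∑ (λ k → δ (punchIn r k) r * x (punchIn r k))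
      ≡⟨ cong₂ _+_ diag (trans (sum-cong-≗ off) (sum-replicate-zero n)) ⟩
    x r + 0ℚ ≡⟨ ℚP.+-identityʳ (x r) ⟩
    x r ∎
    where
    open ≡-Reasoning
    diag : δ r r * x r ≡ x r
    diag with r ≟ᶠ r
    ... | yes _ = ℚP.*-identityˡ (x r)
    ... | no  p = contradiction refl p
    off : ∀ k → δ (punchIn r k) r * x (punchIn r k) ≡ 0ℚ
    off k with punchIn r k ≟ᶠ r
    ... | yes e = contradiction e (FinP.punchInᵢ≢i r k)
    ... | no  _ = ℚP.*-zeroˡ (x (punchIn r k))

  ∣sign∣≡1 : ∀ k → ∣ sign k ∣ ≡ 1ℚ
  ∣sign∣≡1 zero    = refl
  ∣sign∣≡1 (suc k) = trans (ℚP.∣p*q∣≡∣p∣*∣q∣ (- 1ℚ) (sign k)) (cong (1ℚ *_) (∣sign∣≡1 k))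

  ∣sign*∣ : ∀ k x → ∣ sign k * x ∣ ≡ ∣ x ∣
  ∣sign*∣ k x = trans (ℚP.∣p*q∣≡∣p∣*∣q∣ (sign k) x)
    (trans (cong (_* ∣ x ∣) (∣sign∣≡1 k)) (ℚP.*-identityˡ ∣ x ∣))

  -- This is n! Kⁿ, in the shape that expansion along a row produces.
  detBound : ℕ → ℚ → ℚ
  detBound zero    K = 1ℚ
  detBound (suc n) K = ∑ {suc n} λ _ → K * detBound n K

  ∣*∣-mono : ∀ {a b} x y → ∣ x ∣ ≤ a → ∣ y ∣ ≤ b → ∣ x * y ∣ ≤ a * b
  ∣*∣-mono {a} {b} x y hx hy = subst (_≤ a * b) (sym (ℚP.∣p*q∣≡∣p∣*∣q∣ x y))
    (ℚP.≤-trans (*-monoʳ (ℚP.0≤∣p∣ y) hx) (*-monoˡ (ℚP.≤-trans (ℚP.0≤∣p∣ x) hx) hy))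

  ∣detℚ∣≤ : ∀ {n} (A : Mat n) {K} → (∀ i j → ∣ A i j ∣ ≤ K) → ∣ detℚ A ∣ ≤ detBound n K
  ∣detℚ∣≤ {zero}  A h = ℚP.≤-refl
  ∣detℚ∣≤ {suc n} A {K} h = ℚP.≤-trans
    (∣∑∣≤∑∣∣ λ j → sign (toℕ j) * (A zero j * detℚ (minor A j)))
    (∑-mono λ j → subst (_≤ K * detBound n K)
      (sym (∣sign*∣ (toℕ j) (A zero j * detℚ (minor A j))))
      (∣*∣-mono (A zero j) (detℚ (minor A j)) (h zero j)
        (∣detℚ∣≤ (minor A j) λ i k → h (suc i) (punchIn j k))))

  ∣δ∣≤1 : ∀ {n} (i j : Fin n) → ∣ δ i j ∣ ≤ 1ℚ
  ∣δ∣≤1 i j with does (i ≟ᶠ j)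
  ... | true  = ℚP.≤-refl
  ... | false = ℚP.nonNegative⁻¹ 1ℚ

  ∣adjugate∣≤ : ∀ {n} (P : Mat (suc n)) {K} → 1ℚ ≤ K → (∀ i j → ∣ P i j ∣ ≤ K) →
    ∀ j i → ∣ adjugate P j i ∣ ≤ detBound (suc n) K
  ∣adjugate∣≤ {n} P {K} 1≤K h j i = subst (_≤ detBound (suc n) K)
    (sym (∣sign*∣ (toℕ j) (detℚ (replaceColumn P i j))))
    (∣detℚ∣≤ (replaceColumn P i j) λ where
      k zero    → ℚP.≤-trans (∣δ∣≤1 i k) 1≤K
      k (suc c) → h k (punchIn j c))

  infix 8 _·_
  _·_ : ∀ {n} → (Fin n → ℚ) → (Fin n → ℚ) → ℚ
  u · v = ∑ λ i → u i * v i

  _⊛_ : ∀ {n} → Mat n → (Fin n → ℚ) → Fin n → ℚ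
  (M ⊛ v) i = ∑ λ j → M i j * v j

  ·-comm : ∀ {n} (u v : Fin n → ℚ) → u · v ≡ v · u
  ·-comm u v = sum-cong-≗ λ i → ℚP.*-comm (u i) (v i)

  ·-⊛ : ∀ {n} (M : Mat n) u v → u · (M ⊛ v) ≡ ∑ λ i → ∑ λ j → u i * (M i j * v j)
  ·-⊛ M u v = sum-cong-≗ λ i → *-distribˡ-sum (u i) λ j → M i j * v j

  ·-⊛-sym : ∀ {n} (M : Mat n) → (∀ i j → M i j ≡ M j i) → ∀ u v → u · (M ⊛ v) ≡ v · (M ⊛ u)
  ·-⊛-sym M M-sym u v = begin
    u · (M ⊛ v)                                ≡⟨ ·-⊛ M u v ⟩
    ∑ (λ i → ∑ λ j → u i * (M i j * v j))      ≡⟨ ∑-comm (λ i j → u i * (M i j * v j)) ⟩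
    ∑ (λ j → ∑ λ i → u i * (M i j * v j))
      ≡⟨ (sum-cong-≗ λ j → sum-cong-≗ λ i → trans
           (solve 3 (λ a b c → a :* (b :* c) := c :* (b :* a)) refl (u i) (M i j) (v j))
           (cong (λ z → v j * (z * u i)) (M-sym i j))) ⟩
    ∑ (λ j → ∑ λ i → v j * (M j i * u i))      ≡⟨ sym (·-⊛ M v u) ⟩
    v · (M ⊛ u)                                ∎
    where open ≡-Reasoning

  ∑-linear : ∀ {n} c d (f g : Fin n → ℚ) → ∑ (λ i → c * f i + d * g i) ≡ c * ∑ f + d * ∑ g
  ∑-linear c d f g = trans (∑-distrib-+ (λ i → c * f i) (λ i → d * g i))
    (sym (cong₂ _+_ (*-distribˡ-sum c f) (*-distribˡ-sum d g)))

  ⊛-linear : ∀ {n} (M : Mat n) c d u v i →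
    (M ⊛ λ j → c * u j + d * v j) i ≡ c * (M ⊛ u) i + d * (M ⊛ v) i
  ⊛-linear M c d u v i = trans
    (sum-cong-≗ λ j → solve 5 (λ m c u d v → m :* (c :* u :+ d :* v) := c :* (m :* u) :+ d :* (m :* v))
      refl (M i j) c (u j) d (v j))
    (∑-linear c d (λ j → M i j * u j) (λ j → M i j * v j))

  ·-linearʳ : ∀ {n} c d (w u v : Fin n → ℚ) →
    w · (λ j → c * u j + d * v j) ≡ c * (w · u) + d * (w · v)
  ·-linearʳ c d w u v = trans
    (sum-cong-≗ λ j → solve 5 (λ m c u d v → m :* (c :* u :+ d :* v) := c :* (m :* u) :+ d :* (m :* v))
      refl (w j) c (u j) d (v j))
    (∑-linear c d (λ j → w j * u j) (λ j → w j * v j))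

  ·-linearˡ : ∀ {n} c d (u v w : Fin n → ℚ) →
    (λ j → c * u j + d * v j) · w ≡ c * (u · w) + d * (v · w)
  ·-linearˡ c d u v w = trans (·-comm _ w) (trans (·-linearʳ c d w u v)
    (cong₂ (λ x y → c * x + d * y) (·-comm w u) (·-comm w v)))

  ·-congʳ : ∀ {n} (w : Fin n → ℚ) {u v} → (∀ i → u i ≡ v i) → w · u ≡ w · v
  ·-congʳ w h = sum-cong-≗ λ i → cong (w i *_) (h i)

  count : ℕ → ℚ
  count n = ∑ {n} λ _ → 1ℚ

  0≤v·v : ∀ {n} (v : Fin n → ℚ) → 0ℚ ≤ v · v
  0≤v·v v = ∑-nonNeg λ i → 0≤p*p (v i)

  -- Each term is at most b (vᵢ² + vⱼ²) / 2 in absolute value.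
  quadratic-lower : ∀ {n} (M : Mat n) {b} → (∀ i j → ∣ M i j ∣ ≤ b) →
    ∀ v → - (b * count n * (v · v)) ≤ v · (M ⊛ v)
  quadratic-lower {n} M {b} h v = 0≤q-p⇒p≤q (subst (0ℚ ≤_) total
    (∑-nonNeg λ i → ∑-nonNeg λ j → term i j))
    where
    open ≡-Reasoning
    amgm : ∀ x y → x * y ≤ ½ * (x * x + y * y)
    amgm x y = 0≤q-p⇒p≤q (subst (0ℚ ≤_)
      (solve 2 (λ x y → con ½ :* ((x :- y) :* (x :- y)) := con ½ :* (x :* x :+ y :* y) :- x :* y) refl x y)
      (0≤p*q (ℚP.nonNegative⁻¹ ½) (0≤p*p (x - y))))
    sq : ∀ x → ∣ x ∣ * ∣ x ∣ ≡ x * x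
    sq x = trans (sym (ℚP.∣p*q∣≡∣p∣*∣q∣ x x)) (ℚP.0≤p⇒∣p∣≡p (0≤p*p x))
    ∣∣amgm : ∀ x y → ∣ x * y ∣ ≤ ½ * (x * x + y * y)
    ∣∣amgm x y = subst₂ _≤_ (sym (ℚP.∣p*q∣≡∣p∣*∣q∣ x y))
      (cong₂ (λ p q → ½ * (p + q)) (sq x) (sq y)) (amgm ∣ x ∣ ∣ y ∣)
    avg : Fin n → Fin n → ℚ
    avg i j = ½ * (v i * v i + v j * v j)
    term : ∀ i j → 0ℚ ≤ v i * (M i j * v j) + b * avg i j
    term i j = subst (0ℚ ≤_)
      (solve 4 (λ a m c d → d :- (:- (m :* (a :* c))) := a :* (m :* c) :+ d) refl (v i) (M i j) (v j) (b * avg i j))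
      (p≤q⇒0≤q-p (ℚP.≤-trans (-p≤∣p∣ (M i j * (v i * v j)))
        (∣*∣-mono (M i j) (v i * v j) (h i j) (∣∣amgm (v i) (v j)))))
    const-sum : ∀ c → ∑ {n} (λ _ → c) ≡ count n * c
    const-sum c = sym (trans (*-distribʳ-sum {n} c (λ _ → 1ℚ)) (sum-cong-≗ {n} λ _ → ℚP.*-identityˡ c))
    row : ∀ i → ∑ (λ j → avg i j) ≡ (½ * count n) * (v i * v i) + (½ * (v · v)) * 1ℚ
    row i = begin
      ∑ (avg i) ≡⟨ sym (*-distribˡ-sum ½ λ j → v i * v i + v j * v j) ⟩
      ½ * ∑ (λ j → v i * v i + v j * v j)
        ≡⟨ cong (½ *_) (trans (∑-distrib-+ (λ _ → v i * v i) (λ j → v j * v j))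
             (cong (_+ (v · v)) (const-sum (v i * v i)))) ⟩
      ½ * (count n * (v i * v i) + v · v)
        ≡⟨ solve 4 (λ h c x s → h :* (c :* x :+ s) := h :* c :* x :+ h :* s :* con 1ℚ) refl
             ½ (count n) (v i * v i) (v · v) ⟩
      (½ * count n) * (v i * v i) + (½ * (v · v)) * 1ℚ ∎
    total : ∑ (λ i → ∑ λ j → v i * (M i j * v j) + b * avg i j)
          ≡ v · (M ⊛ v) - - (b * count n * (v · v))
    total = begin
      ∑ (λ i → ∑ λ j → v i * (M i j * v j) + b * avg i j)
        ≡⟨ (sum-cong-≗ λ i → trans (∑-distrib-+ (λ j → v i * (M i j * v j)) (λ j → b * avg i j))
             (cong₂ _+_ (sym (*-distribˡ-sum (v i) λ j → M i j * v j))
               (trans (sym (*-distribˡ-sum b (avg i))) (cong (b *_) (row i))))) ⟩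
      ∑ (λ i → v i * (M ⊛ v) i + b * ((½ * count n) * (v i * v i) + (½ * (v · v)) * 1ℚ))
        ≡⟨ ∑-distrib-+ (λ i → v i * (M ⊛ v) i) _ ⟩
      v · (M ⊛ v) + ∑ (λ i → b * ((½ * count n) * (v i * v i) + (½ * (v · v)) * 1ℚ))
        ≡⟨ cong (v · (M ⊛ v) +_) (trans
             (sym (*-distribˡ-sum b λ i → (½ * count n) * (v i * v i) + (½ * (v · v)) * 1ℚ))
             (cong (b *_) (∑-linear (½ * count n) (½ * (v · v)) (λ i → v i * v i) (λ _ → 1ℚ)))) ⟩
      v · (M ⊛ v) + b * ((½ * count n) * (v · v) + (½ * (v · v)) * count n)
        ≡⟨ solve 4 (λ q b c s → q :+ b :* (con ½ :* c :* s :+ con ½ :* s :* c) := q :- (:- (b :* c :* s)))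
             refl (v · (M ⊛ v)) b (count n) (v · v) ⟩
      v · (M ⊛ v) - - (b * count n * (v · v)) ∎

  -- The form is tested at v + τw with Pw = |det P| v.
  semidefinite⇒definite : ∀ {n} (P : Mat (suc n)) {K η τ} → 1ℚ ≤ K → (∀ i j → ∣ P i j ∣ ≤ K) →
    (∀ i j → P i j ≡ P j i) → (∀ v → v · (P ⊛ v) ≤ 0ℚ) →
    η ≤ ∣ detℚ P ∣ → 0ℚ ≤ τ → τ * (detBound (suc n) K * count (suc n)) ≤ 1ℚ →
    ∀ v → v · (P ⊛ v) ≤ - (τ * η * (v · v))
  semidefinite⇒definite {n} P {K} {η} {τ} 1≤K bound P-sym nonpos η≤D 0≤τ τB≤1 v
    = conclude (ℚP.∣p∣≡p∨∣p∣≡-p (detℚ P))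
    where
    D = ∣ detℚ P ∣
    S = v · v
    B = detBound (suc n) K * count (suc n)
    0≤S = 0≤v·v v
    -- `σ` is the sign of the determinant, so W = σ adj P satisfies PW = |det P|. The adjugate
    -- stands in for the inverse because its entries are bounded without any division.
    module _ (σ : ℚ) (∣σ∣≡1 : ∣ σ ∣ ≡ 1ℚ) (σdet : σ * detℚ P ≡ D) where
      W : Mat (suc n)
      W j i = σ * adjugate P j i
      w = W ⊛ v
      ∣W∣≤ : ∀ j i → ∣ W j i ∣ ≤ detBound (suc n) K
      ∣W∣≤ j i = subst (_≤ detBound (suc n) K)
        (sym (trans (ℚP.∣p*q∣≡∣p∣*∣q∣ σ (adjugate P j i))
          (trans (cong (_* ∣ adjugate P j i ∣) ∣σ∣≡1) (ℚP.*-identityˡ ∣ adjugate P j i ∣))))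
        (∣adjugate∣≤ P 1≤K bound j i)
      Pw : ∀ r → (P ⊛ w) r ≡ D * v r
      Pw r = begin
        ∑ (λ j → P r j * ∑ (λ i → W j i * v i))
          ≡⟨ (sum-cong-≗ λ j → *-distribˡ-sum (P r j) (λ i → W j i * v i)) ⟩
        ∑ (λ j → ∑ λ i → P r j * (W j i * v i))
          ≡⟨ ∑-comm (λ j i → P r j * (W j i * v i)) ⟩
        ∑ (λ i → ∑ λ j → P r j * (W j i * v i))
          ≡⟨ (sum-cong-≗ λ i → trans
               (sum-cong-≗ λ j → solve 4 (λ p s a x → p :* (s :* a :* x) := (s :* x) :* (p :* a)) refl
                 (P r j) σ (adjugate P j i) (v i))
               (sym (*-distribˡ-sum (σ * v i) λ j → P r j * adjugate P j i))) ⟩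
        ∑ (λ i → σ * v i * ∑ (λ j → P r j * adjugate P j i))
          ≡⟨ (sum-cong-≗ λ i → trans (cong (σ * v i *_) (adjugate-inverse P r i))
               (solve 4 (λ s x d e → s :* x :* (d :* e) := d :* (s :* e :* x)) refl
                 σ (v i) (δ i r) (detℚ P))) ⟩
        ∑ (λ i → δ i r * (σ * detℚ P * v i))
          ≡⟨ ∑-δ r (λ i → σ * detℚ P * v i) ⟩
        σ * detℚ P * v r
          ≡⟨ cong (_* v r) σdet ⟩
        D * v r ∎
        where open ≡-Reasoning
      z = v · w
      q = v · (P ⊛ v)
      u : Fin (suc n) → ℚ
      u j = 1ℚ * v j + τ * w j
      vPw : v · (P ⊛ w) ≡ D * S
      vPw = trans (·-congʳ v Pw) (trans
        (sum-cong-≗ λ i → solve 2 (λ x d → x :* (d :* x) := d :* (x :* x)) refl (v i) D)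
        (sym (*-distribˡ-sum D λ i → v i * v i)))
      wPw : w · (P ⊛ w) ≡ D * z
      wPw = trans (·-congʳ w Pw) (trans
        (sum-cong-≗ λ i → solve 3 (λ x d y → y :* (d :* x) := d :* (x :* y)) refl (v i) D (w i))
        (sym (*-distribˡ-sum D λ i → v i * w i)))
      expand : u · (P ⊛ u) ≡ q + (τ * D * S + τ * D * S) + τ * (τ * D) * z
      expand = begin
        u · (P ⊛ u)
          ≡⟨ ·-congʳ u (⊛-linear P 1ℚ τ v w) ⟩
        u · (λ i → 1ℚ * (P ⊛ v) i + τ * (P ⊛ w) i)
          ≡⟨ ·-linearʳ 1ℚ τ u (P ⊛ v) (P ⊛ w) ⟩
        1ℚ * (u · (P ⊛ v)) + τ * (u · (P ⊛ w))
          ≡⟨ cong₂ (λ x y → 1ℚ * x + τ * y) (·-linearˡ 1ℚ τ v w (P ⊛ v)) (·-linearˡ 1ℚ τ v w (P ⊛ w)) ⟩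
        1ℚ * (1ℚ * q + τ * (w · (P ⊛ v))) + τ * (1ℚ * (v · (P ⊛ w)) + τ * (w · (P ⊛ w)))
          ≡⟨ cong₂ (λ x y → 1ℚ * (1ℚ * q + τ * x) + τ * y)
               (trans (·-⊛-sym P P-sym w v) vPw)
               (cong₂ (λ x y → 1ℚ * x + τ * y) vPw wPw) ⟩
        1ℚ * (1ℚ * q + τ * (D * S)) + τ * (1ℚ * (D * S) + τ * (D * z))
          ≡⟨ solve 5 (λ q t d s z → con 1ℚ :* (con 1ℚ :* q :+ t :* (d :* s)) :+ t :* (con 1ℚ :* (d :* s) :+ t :* (d :* z))
               := q :+ (t :* d :* s :+ t :* d :* s) :+ t :* (t :* d) :* z) refl q τ D S z ⟩
        q + (τ * D * S + τ * D * S) + τ * (τ * D) * z ∎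
        where open ≡-Reasoning
      0≤D = ℚP.0≤∣p∣ (detℚ P)
      -- z ≥ − B S and τ B ≤ 1.
      cross : - (τ * D * S) ≤ τ * (τ * D) * z
      cross = begin
        - (τ * D * S)
          ≡⟨ solve 1 (λ x → :- x := :- (con 1ℚ :* x)) refl (τ * D * S) ⟩
        - (1ℚ * (τ * D * S))
          ≤⟨ ℚP.neg-antimono-≤ (*-monoʳ (0≤p*q (0≤p*q 0≤τ 0≤D) 0≤S) τB≤1) ⟩
        - (τ * B * (τ * D * S))
          ≡⟨ solve 4 (λ t b d s → :- (t :* b :* (t :* d :* s)) := t :* (t :* d) :* (:- (b :* s))) refl τ B D S ⟩
        τ * (τ * D) * (- (B * S))
          ≤⟨ *-monoˡ (0≤p*q 0≤τ (0≤p*q 0≤τ 0≤D)) (quadratic-lower W ∣W∣≤ v) ⟩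
        τ * (τ * D) * z ∎
        where open ℚP.≤-Reasoning
      -- Here 0 ≥ u·Pu = q + 2τDS + τ²Dz, and by `cross` the last term consumes at most one of the
      -- two copies of τDS.
      result : q ≤ - (τ * η * S)
      result = begin
        q ≡⟨ solve 2 (λ q x → q := q :+ (x :+ x) :+ (:- x) :+ (:- x)) refl q (τ * D * S) ⟩
        q + (τ * D * S + τ * D * S) + - (τ * D * S) + - (τ * D * S)
          ≤⟨ ℚP.+-monoˡ-≤ (- (τ * D * S)) (ℚP.+-monoʳ-≤ (q + (τ * D * S + τ * D * S)) cross) ⟩
        q + (τ * D * S + τ * D * S) + τ * (τ * D) * z + - (τ * D * S)
          ≡⟨ cong (_+ - (τ * D * S)) (sym expand) ⟩
        u · (P ⊛ u) + - (τ * D * S)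
          ≤⟨ ℚP.+-monoˡ-≤ (- (τ * D * S)) (nonpos u) ⟩
        0ℚ + - (τ * D * S)
          ≡⟨ ℚP.+-identityˡ (- (τ * D * S)) ⟩
        - (τ * D * S)
          ≤⟨ ℚP.neg-antimono-≤ (*-monoʳ 0≤S (*-monoˡ 0≤τ η≤D)) ⟩
        - (τ * η * S) ∎
        where open ℚP.≤-Reasoning
    conclude : D ≡ detℚ P ⊎ D ≡ - detℚ P → v · (P ⊛ v) ≤ - (τ * η * S)
    conclude (inj₁ e) = result 1ℚ refl (trans (ℚP.*-identityˡ (detℚ P)) (sym e))
    conclude (inj₂ e) = result (- 1ℚ) refl
      (trans (solve 1 (λ x → :- con 1ℚ :* x := :- x) refl (detℚ P)) (sym e))

  ι : ℕ → ℚ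
  ι n = frac n 0

  ι-suc : ∀ n → ι (suc n) ≡ ι n + 1ℚ
  ι-suc n = sym (frac-suc n 0)

  ι-+ : ∀ m n → ι (m ℕ.+ n) ≡ ι m + ι n
  ι-+ zero    n = sym (ℚP.+-identityˡ (ι n))
  ι-+ (suc m) n = begin
    ι (suc (m ℕ.+ n)) ≡⟨ ι-suc (m ℕ.+ n) ⟩
    ι (m ℕ.+ n) + 1ℚ  ≡⟨ cong (_+ 1ℚ) (ι-+ m n) ⟩
    ι m + ι n + 1ℚ    ≡⟨ solve 3 (λ a b c → a :+ b :+ c := a :+ c :+ b) refl (ι m) (ι n) 1ℚ ⟩
    ι m + 1ℚ + ι n    ≡⟨ cong (_+ ι n) (sym (ι-suc m)) ⟩
    ι (suc m) + ι n   ∎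
    where open ≡-Reasoning

  ι-* : ∀ m n → ι (m ℕ.* n) ≡ ι m * ι n
  ι-* zero    n = sym (ℚP.*-zeroˡ (ι n))
  ι-* (suc m) n = begin
    ι (n ℕ.+ m ℕ.* n)   ≡⟨ ι-+ n (m ℕ.* n) ⟩
    ι n + ι (m ℕ.* n)   ≡⟨ cong (ι n +_) (ι-* m n) ⟩
    ι n + ι m * ι n     ≡⟨ solve 2 (λ m n → n :+ m :* n := (m :+ con 1ℚ) :* n) refl (ι m) (ι n) ⟩
    (ι m + 1ℚ) * ι n    ≡⟨ cong (_* ι n) (sym (ι-suc m)) ⟩
    ι (suc m) * ι n     ∎
    where open ≡-Reasoning

  ι-mono : ∀ {m n} → m ℕ.≤ n → ι m ≤ ι n
  ι-mono {m} {n} h = frac-≤ {m} {0} {n} {0} (ℕP.*-monoˡ-≤ 1 h)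

  0≤ι : ∀ n → 0ℚ ≤ ι n
  0≤ι n = ι-mono {0} {n} ℕ.z≤n

  p<p+1 : ∀ p → p < p + 1ℚ
  p<p+1 p = subst (_< p + 1ℚ) (ℚP.+-identityʳ p) (ℚP.+-monoʳ-< p (ℚP.positive⁻¹ 1ℚ))

  ι-cancel-< : ∀ {m n} → ι m < ι n → m ℕ.< n
  ι-cancel-< {m} {n} h with ℕP.<-≤-connex m n
  ... | inj₁ m<n = m<n
  ... | inj₂ n≤m = contradiction (ℚP.<-≤-trans h (ι-mono n≤m)) (ℚP.<-irrefl refl)

  ι-cancel-≤ : ∀ {m n} → ι m ≤ ι n → m ℕ.≤ n
  ι-cancel-≤ {m} {n} h = ℕ.s≤s⁻¹ (ι-cancel-< (ℚP.≤-<-trans h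
    (subst (ι n <_) (sym (ι-suc n)) (p<p+1 (ι n)))))

  frac≡ι* : ∀ a d → frac a d ≡ ι a * frac 1 d
  frac≡ι* zero    d = trans (frac-≡ {0} {d} {0} {0} refl) (sym (ℚP.*-zeroˡ (frac 1 d)))
  frac≡ι* (suc a) d = begin
    frac (suc a) d              ≡⟨ sym (frac-suc a d) ⟩
    frac a d + frac 1 d         ≡⟨ cong (_+ frac 1 d) (frac≡ι* a d) ⟩
    ι a * frac 1 d + frac 1 d   ≡⟨ solve 2 (λ a f → a :* f :+ f := (a :+ con 1ℚ) :* f) refl (ι a) (frac 1 d) ⟩
    (ι a + 1ℚ) * frac 1 d       ≡⟨ cong (_* frac 1 d) (sym (ι-suc a)) ⟩
    ι (suc a) * frac 1 d        ∎
    where open ≡-Reasoning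

  ι*frac : ∀ a d → ι (suc d) * frac a d ≡ ι a
  ι*frac a d = begin
    ι (suc d) * frac a d            ≡⟨ cong (ι (suc d) *_) (frac≡ι* a d) ⟩
    ι (suc d) * (ι a * frac 1 d)    ≡⟨ solve 3 (λ d a f → d :* (a :* f) := a :* (d :* f)) refl (ι (suc d)) (ι a) (frac 1 d) ⟩
    ι a * (ι (suc d) * frac 1 d)    ≡⟨ cong (ι a *_) (sym (frac≡ι* (suc d) d)) ⟩
    ι a * frac (suc d) d            ≡⟨ cong (ι a *_) (frac-≡ {suc d} {d} {1} {0} (ℕP.*-comm (suc d) 1)) ⟩
    ι a * 1ℚ                        ≡⟨ ℚP.*-identityʳ (ι a) ⟩
    ι a                             ∎
    where open ≡-Reasoning

  multiples-unbounded : ∀ {p q} → 0ℚ < p → 0ℚ < q → ∃[ j ] p ≤ ι j * q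
  multiples-unbounded {p} {q} 0<p 0<q with divide p q (ℚ.positive 0<p) 0<q
  ... | ε , 0<ε , pε≡q with archimedean 0<ε
  ... | N , small = suc N , (begin
    p                              ≡⟨ sym (ℚP.*-identityʳ p) ⟩
    p * ι 1                        ≡⟨ cong (p *_) (sym (ι*frac 1 N)) ⟩
    p * (ι (suc N) * frac 1 N)
      ≤⟨ *-monoˡ (ℚP.<⇒≤ 0<p) (*-monoˡ (0≤ι (suc N)) (small N ℕP.≤-refl)) ⟩
    p * (ι (suc N) * ε)            ≡⟨ solve 3 (λ p i e → p :* (i :* e) := i :* (p :* e)) refl p (ι (suc N)) ε ⟩
    ι (suc N) * (p * ε)            ≡⟨ cong (ι (suc N) *_) pε≡q ⟩
    ι (suc N) * q                  ∎)
    where open ℚP.≤-Reasoning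

  0≤count : ∀ n → 0ℚ ≤ count n
  0≤count n = ∑-nonNeg {n} λ _ → ℚP.nonNegative⁻¹ 1ℚ

  0<count : ∀ n → 0ℚ < count (suc n)
  0<count n = ℚP.+-mono-<-≤ (ℚP.positive⁻¹ 1ℚ) (0≤count n)

  0≤detBound : ∀ n {K} → 0ℚ ≤ K → 0ℚ ≤ detBound n K
  0≤detBound zero    h = ℚP.nonNegative⁻¹ 1ℚ
  0≤detBound (suc n) h = ∑-nonNeg {suc n} λ _ → 0≤p*q h (0≤detBound n h)

  -- Characteristic matrices and the stepwise lower bound for the form.

  charMat : ∀ {n} → Mat n → ℚ → Mat n
  charMat A x i j = (if does (i ≟ᶠ j) then x else 0ℚ) - A i j

  charMat-form : ∀ {n} (A : Mat n) x v → v · (charMat A x ⊛ v) ≡ x * (v · v) - v · (A ⊛ v)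
  charMat-form A x v = begin
    v · (charMat A x ⊛ v)
      ≡⟨ ·-congʳ v row ⟩
    v · (λ i → x * v i + (- 1ℚ) * (A ⊛ v) i)
      ≡⟨ ·-linearʳ x (- 1ℚ) v v (A ⊛ v) ⟩
    x * (v · v) + (- 1ℚ) * (v · (A ⊛ v))
      ≡⟨ solve 2 (λ a b → a :+ (:- con 1ℚ) :* b := a :- b) refl (x * (v · v)) (v · (A ⊛ v)) ⟩
    x * (v · v) - v · (A ⊛ v) ∎
    where
    open ≡-Reasoning
    entry : ∀ i j → charMat A x i j * v j ≡ x * (δ j i * v j) + (- 1ℚ) * (A i j * v j)
    entry i j with i ≟ᶠ j | j ≟ᶠ i
    ... | yes _ | yes _ = solve 3 (λ x a v → (x :- a) :* v := x :* (con 1ℚ :* v) :+ (:- con 1ℚ) :* (a :* v)) refl x (A i j) (v j)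
    ... | no  _ | no  _ = solve 3 (λ x a v → (con 0ℚ :- a) :* v := x :* (con 0ℚ :* v) :+ (:- con 1ℚ) :* (a :* v)) refl x (A i j) (v j)
    ... | yes e | no  p = contradiction (sym e) p
    ... | no  p | yes e = contradiction (sym e) p
    row : ∀ i → (charMat A x ⊛ v) i ≡ x * v i + (- 1ℚ) * (A ⊛ v) i
    row i = trans (sum-cong-≗ (entry i)) (trans
      (∑-linear x (- 1ℚ) (λ j → δ j i * v j) (λ j → A i j * v j))
      (cong (λ z → x * z + (- 1ℚ) * (A ⊛ v) i) (∑-δ i v)))

  charMat-sym : ∀ {n} (A : Mat n) x → (∀ i j → A i j ≡ A j i) → ∀ i j → charMat A x i j ≡ charMat A x j i
  charMat-sym A x A-sym i j with i ≟ᶠ j | j ≟ᶠ i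
  ... | yes _ | yes _ = cong (λ z → x - z) (A-sym i j)
  ... | no  _ | no  _ = cong (λ z → 0ℚ - z) (A-sym i j)
  ... | yes e | no  p = contradiction (sym e) p
  ... | no  p | yes e = contradiction (sym e) p

  ∣charMat∣≤ : ∀ {n} (A : Mat n) x → (∀ i j → ∣ A i j ∣ ≤ 1ℚ) → ∀ i j → ∣ charMat A x i j ∣ ≤ ∣ x ∣ + 1ℚ
  ∣charMat∣≤ A x A≤1 i j = ℚP.≤-trans (ℚP.∣p-q∣≤∣p∣+∣q∣ (if does (i ≟ᶠ j) then x else 0ℚ) (A i j))
    (ℚP.+-mono-≤ diag (A≤1 i j))
    where
    diag : ∣ if does (i ≟ᶠ j) then x else 0ℚ ∣ ≤ ∣ x ∣
    diag with does (i ≟ᶠ j)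
    ... | true  = ℚP.≤-refl
    ... | false = ℚP.0≤∣p∣ x

  p-q≤p : ∀ p {q} → 0ℚ ≤ q → p - q ≤ p
  p-q≤p p {q} h = 0≤q-p⇒p≤q (subst (0ℚ ≤_) (solve 2 (λ p q → q := p :- (p :- q)) refl p q) h)

  shift-zero : ∀ p q → - p + ι 0 * q ≡ - p
  shift-zero p q = trans (cong (- p +_) (ℚP.*-zeroˡ q)) (ℚP.+-identityʳ (- p))

  shift-suc : ∀ x p q j → x ≤ - p + ι (suc j) * q → x - q ≤ - p + ι j * q
  shift-suc x p q j h = begin
    x - q                            ≤⟨ ℚP.+-monoˡ-≤ (- q) h ⟩
    - p + ι (suc j) * q - q          ≡⟨ cong (λ z → - p + z * q - q) (ι-suc j) ⟩
    - p + (ι j + 1ℚ) * q - q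
      ≡⟨ solve 3 (λ p j q → :- p :+ (j :+ con 1ℚ) :* q :- q := :- p :+ j :* q) refl p (ι j) q ⟩
    - p + ι j * q                    ∎
    where open ℚP.≤-Reasoning

  module Descent {n : ℕ} (A : Mat (suc n)) {x₀ η : ℚ} (A≤1 : ∀ i j → ∣ A i j ∣ ≤ 1ℚ)
    (A-sym : ∀ i j → A i j ≡ A j i) (x₀≤0 : x₀ ≤ 0ℚ) (0<η : 0ℚ < η)
    (det-bounded : ∀ x → x ≤ x₀ → η ≤ ∣ detℚ (charMat A x) ∣) where

    -- The climb starts at -Y, where Y is the order of the matrix, and uses definiteness only at
    -- points of [-Y - η, 0], where the entries of `charMat A x` are at most `K`. One margin
    -- therefore serves for every step.
    Y K B : ℚ
    Y = count (suc n)
    K = Y + η + 1ℚ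
    B = detBound (suc n) K * Y

    Below : ℚ → Set
    Below x = ∀ v → x * (v · v) ≤ v · (A ⊛ v)
    0≤Y+η : 0ℚ ≤ Y + η
    0≤Y+η = 0≤p+q (0≤count (suc n)) (ℚP.<⇒≤ 0<η)
    0≤K : 0ℚ ≤ K
    0≤K = 0≤p+q 0≤Y+η (ℚP.nonNegative⁻¹ 1ℚ)
    0≤B : 0ℚ ≤ B
    0≤B = 0≤p*q (0≤detBound (suc n) 0≤K) (0≤count (suc n))

    -- τ = 1/(B + 1) gives both τB ≤ 1, which `semidefinite⇒definite` asks for, and τ ≤ 1, which
    -- keeps the step d = τη at most η.
    module _ (τ : ℚ) (0<τ : 0ℚ < τ) (eq : (B + 1ℚ) * τ ≡ 1ℚ) where
      0≤τ : 0ℚ ≤ τ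
      0≤τ = ℚP.<⇒≤ 0<τ
      τB≤1 : τ * B ≤ 1ℚ
      τB≤1 = begin
        τ * B        ≤⟨ *-monoˡ 0≤τ (ℚP.<⇒≤ (p<p+1 B)) ⟩
        τ * (B + 1ℚ) ≡⟨ trans (ℚP.*-comm τ (B + 1ℚ)) eq ⟩
        1ℚ           ∎
        where open ℚP.≤-Reasoning
      τ≤1 : τ ≤ 1ℚ
      τ≤1 = begin
        τ            ≡⟨ sym (ℚP.*-identityʳ τ) ⟩
        τ * 1ℚ       ≤⟨ *-monoˡ 0≤τ (ℚP.+-monoˡ-≤ 1ℚ 0≤B) ⟩
        τ * (B + 1ℚ) ≡⟨ trans (ℚP.*-comm τ (B + 1ℚ)) eq ⟩
        1ℚ           ∎
        where open ℚP.≤-Reasoning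
      d : ℚ
      d = τ * η
      0<d : 0ℚ < d
      0<d = 0<p*q 0<τ 0<η
      d≤η : d ≤ η
      d≤η = subst (d ≤_) (ℚP.*-identityˡ η) (*-monoʳ (ℚP.<⇒≤ 0<η) τ≤1)
      start : ∀ x → x ≤ - Y → Below x
      start x x≤-Y v = begin
        x * (v · v)        ≤⟨ *-monoʳ (0≤v·v v) x≤-Y ⟩
        - Y * (v · v)      ≡⟨ solve 2 (λ y s → :- y :* s := :- (con 1ℚ :* y :* s)) refl Y (v · v) ⟩
        - (1ℚ * Y * (v · v)) ≤⟨ quadratic-lower A A≤1 v ⟩
        v · (A ⊛ v)        ∎
        where open ℚP.≤-Reasoning
      -- The margin obtained at x - d is d v·v, exactly what the step back up to x costs.
      step : ∀ x → x ≤ x₀ → - Y ≤ x → Below (x - d) → Below x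
      step x x≤x₀ -Y≤x below v = 0≤q-p⇒p≤q (subst (0ℚ ≤_)
        (trans (cong (λ z → - (d * S) - z) (charMat-form A x′ v))
          (solve 4 (λ x d s q → :- (d :* s) :- ((x :- d) :* s :- q) := q :- x :* s) refl x d S (v · (A ⊛ v))))
        (p≤q⇒0≤q-p (semidefinite⇒definite (charMat A x′) {K} {η} {τ} 1≤K bound
          (charMat-sym A x′ A-sym) nonpos (det-bounded x′ x′≤x₀) 0≤τ τB≤1 v)))
        where
        x′ = x - d
        S = v · v
        x′≤x₀ : x′ ≤ x₀
        x′≤x₀ = ℚP.≤-trans (p-q≤p x (ℚP.<⇒≤ 0<d)) x≤x₀
        1≤K : 1ℚ ≤ K
        1≤K = subst (_≤ K) (ℚP.+-identityˡ 1ℚ) (ℚP.+-monoˡ-≤ 1ℚ 0≤Y+η)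
        ∣x′∣≤ : ∣ x′ ∣ ≤ Y + η
        ∣x′∣≤ = subst₂ _≤_ (trans (sym (ℚP.0≤p⇒∣p∣≡p (ℚP.neg-antimono-≤ (ℚP.≤-trans x′≤x₀ x₀≤0)))) (ℚP.∣-p∣≡∣p∣ x′))
          (solve 2 (λ y e → :- (:- y :- e) := y :+ e) refl Y η)
          (ℚP.neg-antimono-≤ (ℚP.+-mono-≤ -Y≤x (ℚP.neg-antimono-≤ d≤η)))
        bound : ∀ i j → ∣ charMat A x′ i j ∣ ≤ K
        bound i j = ℚP.≤-trans (∣charMat∣≤ A x′ A≤1 i j) (ℚP.+-monoˡ-≤ 1ℚ ∣x′∣≤)
        nonpos : ∀ u → u · (charMat A x′ ⊛ u) ≤ 0ℚ
        nonpos u = 0≤q-p⇒p≤q (subst (0ℚ ≤_)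
          (trans (solve 2 (λ a q → q :- a := con 0ℚ :- (a :- q)) refl (x′ * (u · u)) (u · (A ⊛ u)))
            (cong (λ z → 0ℚ - z) (sym (charMat-form A x′ u))))
          (p≤q⇒0≤q-p (below u)))
      -- `j` bounds the number of steps above -Y. Points at or below -Y are settled by `start`, so
      -- the entry bound is available whenever `step` is applied.
      climb : ∀ j x → x ≤ x₀ → x ≤ - Y + ι j * d → Below x
      climb zero x _ h = start x (subst (x ≤_) (shift-zero Y d) h)
      climb (suc j) x x≤x₀ h with ℚP.≤-total x (- Y)
      ... | inj₁ x≤-Y = start x x≤-Y
      ... | inj₂ -Y≤x = step x x≤x₀ -Y≤x
        (climb j (x - d) (ℚP.≤-trans (p-q≤p x (ℚP.<⇒≤ 0<d)) x≤x₀) (shift-suc x Y d j h))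
      climb-to-x₀ : ∃[ j ] Y ≤ ι j * d → Below x₀
      climb-to-x₀ (j , Y≤jd) = climb j x₀ ℚP.≤-refl (ℚP.≤-trans x₀≤0
        (subst (_≤ - Y + ι j * d) (ℚP.+-inverseˡ Y) (ℚP.+-monoʳ-≤ (- Y) Y≤jd)))

    form-bounded : Below x₀
    form-bounded = go (divide (B + 1ℚ) 1ℚ
      (ℚ.positive (ℚP.+-mono-≤-< 0≤B (ℚP.positive⁻¹ 1ℚ))) (ℚP.positive⁻¹ 1ℚ))
      where
      go : ∃[ τ ] (0ℚ < τ) × ((B + 1ℚ) * τ ≡ 1ℚ) → Below x₀
      go (τ , 0<τ , eq) = climb-to-x₀ τ 0<τ eq
        (multiples-unbounded {Y} {τ * η} (0<count n) (0<p*q 0<τ 0<η))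

-- The real hypotheses turned into rational and natural inequalities.

module Spectrum where
  open import Data.Rational.Base using (_+_; _*_; -_; _-_; ∣_∣; _≤_; _<_)
  open ℚSolver.+-*-Solver using (solve; _:=_; _:+_; _:*_; _:-_; :-_; con)
  open Determinant
  open QuadraticForm

  seq-sum : ∀ {n} (f : Fin n → ℝ) k → seq (sum f) k ≡ ∑ λ i → seq (f i) k
  seq-sum {zero}  f k = refl
  seq-sum {suc n} f k = cong (seq (f zero) k +_) (seq-sum (f ∘ suc) k)

  seq-sign : ∀ i k → seq ((-ᵣ 1ℝ) ^ᵣ i) k ≡ sign i
  seq-sign zero    k = refl
  seq-sign (suc i) k = cong ((- 1ℚ) *_) (seq-sign i k)

  seq-det : ∀ {n} (M : Matrix n) k → seq (det M) k ≡ detℚ λ i j → seq (M i j) k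
  seq-det {zero}  M k = refl
  seq-det {suc n} M k = trans
    (seq-sum (λ j → ((-ᵣ 1ℝ) ^ᵣ toℕ j) *ᵣ (M zero j *ᵣ det (λ i l → M (suc i) (punchIn j l)))) k)
    (sum-cong-≗ λ j → cong₂ (λ s x → s * (seq (M zero j) k * x))
      (seq-sign (toℕ j) k) (seq-det (λ i l → M (suc i) (punchIn j l)) k))

  𝟙 : Bool → ℕ
  𝟙 b = if b then 1 else 0

  adjℚ : ∀ {n} → Graph n → Mat n
  adjℚ G i j = ι (𝟙 (adj G i j))

  -- Operations on ℝ act termwise, and for rational `x` all entries are constant sequences, so every
  -- approximant is the same exact rational.
  seq-charPoly : ∀ {n} (G : Graph n) x k →
    seq (charPoly (adjacencyMatrix G) (fromℚ x)) k ≡ detℚ (charMat (adjℚ G) x)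
  seq-charPoly G x k = trans
    (seq-det (λ i j → (if does (i ≟ᶠ j) then fromℚ x else 0ℝ) -ᵣ adjacencyMatrix G i j) k)
    (detℚ-cong λ i j → cong₂ _-_ (left (does (i ≟ᶠ j))) (right (adj G i j)))
    where
    left : ∀ b → seq (if b then fromℚ x else 0ℝ) k ≡ (if b then x else 0ℚ)
    left true  = refl
    left false = refl
    right : ∀ b → seq (if b then 1ℝ else 0ℝ) k ≡ ι (𝟙 b)
    right true  = refl
    right false = refl

  pow : ℚ → ℕ → ℚ
  pow g zero    = 1ℚ
  pow g (suc n) = g * pow g n

  0<pow : ∀ {g} n → 0ℚ < g → 0ℚ < pow g n
  0<pow zero    0<g = ℚP.positive⁻¹ 1ℚ
  0<pow (suc n) 0<g = 0<p*q 0<g (0<pow n 0<g)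

  pow≤∣product∣ : ∀ {n} (f : Fin n → ℝ) {g} k → 0ℚ ≤ g → (∀ i → g ≤ ∣ seq (f i) k ∣) →
    pow g n ≤ ∣ seq (product f) k ∣
  pow≤∣product∣ {zero}  f k 0≤g h = ℚP.≤-refl
  pow≤∣product∣ {suc n} f {g} k 0≤g h = subst (pow g (suc n) ≤_)
    (sym (ℚP.∣p*q∣≡∣p∣*∣q∣ (seq (f zero) k) (seq (product (f ∘ suc)) k)))
    (ℚP.≤-trans (*-monoˡ 0≤g (pow≤∣product∣ (f ∘ suc) k 0≤g (h ∘ suc)))
      (*-monoʳ (ℚP.0≤∣p∣ (seq (product (f ∘ suc)) k)) (h zero)))

  Eventually : (ℕ → Set) → Set
  Eventually P = ∃[ N ] (∀ k → N ℕ.≤ k → P k)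

  eventually-∧ : ∀ {P Q : ℕ → Set} → Eventually P → Eventually Q → Eventually λ k → P k × Q k
  eventually-∧ (M , p) (N , q) = M ℕ.⊔ N , λ k h →
    p k (ℕP.≤-trans (ℕP.m≤m⊔n M N) h) , q k (ℕP.≤-trans (ℕP.m≤n⊔m M N) h)

  eventually-∀ : ∀ {n} {P : Fin n → ℕ → Set} → (∀ i → Eventually (P i)) → Eventually λ k → ∀ i → P i k
  eventually-∀ {zero}  h = 0 , λ k _ ()
  eventually-∀ {suc n} h with eventually-∧ (h zero) (eventually-∀ (h ∘ suc))
  ... | N , p = N , λ k N≤k → λ where
    zero    → proj₁ (p k N≤k)
    (suc i) → proj₂ (p k N≤k) i

  eventually-map : ∀ {P Q : ℕ → Set} → (∀ k → P k → Q k) → Eventually P → Eventually Q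
  eventually-map f (N , p) = N , λ k h → f k (p k h)

  eventually-const : ∀ {P : Set} → Eventually (λ _ → P) → P
  eventually-const (N , p) = p N ℕP.≤-refl

  module Spectral {n d : ℕ} {ev : ℝ} (G : Graph (suc n)) (ndλ : IsNDλGraph G d ev)
    (y : ℚ) (0≤y : 0ℚ ≤ y) {κ : ℚ} (0<κ : 0ℚ < κ) (ev<y : Eventually λ k → seq ev k + κ ≤ y) where
    open IsNDλGraph ndλ

    -- Two approximations, the order of the eigenvalues and the value of λ, cost ε = κ/4 each; of
    -- the gap κ there remains g = κ/2.
    ε g : ℚ
    ε = ½ * (½ * κ)
    g = ½ * κ
    0<g : 0ℚ < g
    0<g = 0<½*ε 0<κ
    0<ε : 0ℚ < ε
    0<ε = 0<½*ε 0<g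

    last-max : ∀ (i : Fin (suc n)) → toℕ i ℕ.≤ toℕ last
    last-max i = ℕP.≤-trans (FinP.toℕ≤pred[n] i) (ℕP.≤-reflexive (sym (ℕP.suc-injective last≡)))

    combine : ∀ m₁ m₂ mx e → m₁ ≤ m₂ + ε → - m₁ ≤ mx → mx ≤ e + ε → e + κ ≤ y → - y - m₂ ≤ - g
    combine m₁ m₂ mx e h₁ h₂ h₃ h₄ = 0≤q-p⇒p≤q (subst (0ℚ ≤_)
      (solve 6 (λ m₁ m₂ mx e k y →
          (m₂ :+ con ½ :* (con ½ :* k) :- m₁) :+ (mx :- (:- m₁)) :+ (e :+ con ½ :* (con ½ :* k) :- mx) :+ (y :- (e :+ k))
          := (:- (con ½ :* k)) :- (:- y :- m₂)) refl m₁ m₂ mx e κ y)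
      (0≤p+q (0≤p+q (0≤p+q (p≤q⇒0≤q-p h₁) (p≤q⇒0≤q-p h₂)) (p≤q⇒0≤q-p h₃)) (p≤q⇒0≤q-p h₄)))

    below-roots : Eventually λ k → ∀ (i : Fin (suc n)) → - y - seq (μ i) k ≤ - g
    below-roots = eventually-map
      (λ k (order , close , bound) i → combine (seq (μ last) k) (seq (μ i) k) (mx k) (seq ev k)
        (order i) (ℚP.≤-trans (ℚP.p≤q⊔p (seq (μ last) k) (- seq (μ last) k))
          (ℚP.p≤q⊔p (seq (μ second) k ℚ.⊔ - seq (μ second) k) (seq (μ last) k ℚ.⊔ - seq (μ last) k)))
        (∣-∣≤⇒≤+ (mx k) (seq ev k) (subst (_≤ ε) (∣∣-swap (seq ev k) (mx k)) close)) bound)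
      (eventually-∧ (eventually-∀ λ i → proj₁ spectrum i last (last-max i) ε 0<ε)
        (eventually-∧ (ev≈ ε 0<ε) ev<y))
      where
      mx : ℕ → ℚ
      mx k = seq (∣ μ second ∣ᵣ ⊔ᵣ ∣ μ last ∣ᵣ) k

    η : ℚ
    η = ½ * pow g (suc n)

    -- The determinant does not depend on `k`, so one index at which all approximations are good
    -- suffices. That index may depend on `x`, but `η` does not, as the climb requires; half of
    -- g^(n+1) is spent on the distance between determinant and product.
    det-bounded : ∀ x → x ≤ - y → η ≤ ∣ detℚ (charMat (adjℚ G) x) ∣
    det-bounded x x≤-y = eventually-const (eventually-map
      (λ k (below , close) → finish k below close)
      (eventually-∧ below-roots (proj₂ spectrum (fromℚ x) η (0<½*ε (0<pow (suc n) 0<g)))))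
      where
      f : Fin (suc n) → ℝ
      f i = fromℚ x -ᵣ μ i
      D = detℚ (charMat (adjℚ G) x)
      ∣factor∣ : ∀ {z} → z ≤ - g → g ≤ ∣ z ∣
      ∣factor∣ {z} h = ℚP.≤-trans (subst (_≤ - z)
        (solve 1 (λ g → :- (:- g) := g) refl g) (ℚP.neg-antimono-≤ h)) (-p≤∣p∣ z)
      finish : ∀ k → (∀ i → - y - seq (μ i) k ≤ - g) →
        ∣ seq (charPoly (adjacencyMatrix G) (fromℚ x)) k - seq (product f) k ∣ ≤ η → η ≤ ∣ D ∣
      finish k below close = begin
        η ≡⟨ solve 1 (λ w → con ½ :* w := w :- con ½ :* w) refl (pow g (suc n)) ⟩
        pow g (suc n) - η
          ≤⟨ ℚP.+-monoˡ-≤ (- η) (pow≤∣product∣ f k (ℚP.<⇒≤ 0<g)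
               λ i → ∣factor∣ (ℚP.≤-trans (ℚP.+-monoˡ-≤ (- seq (μ i) k) x≤-y) (below i))) ⟩
        ∣ P ∣ - η
          ≤⟨ ℚP.+-monoʳ-≤ ∣ P ∣ (ℚP.neg-antimono-≤ close′) ⟩
        ∣ P ∣ - ∣ P - D ∣
          ≤⟨ ℚP.+-monoˡ-≤ (- ∣ P - D ∣) (subst (λ z → ∣ z ∣ ≤ ∣ D ∣ + ∣ P - D ∣)
               (solve 2 (λ p d → d :+ (p :- d) := p) refl P D) (ℚP.∣p+q∣≤∣p∣+∣q∣ D (P - D))) ⟩
        ∣ D ∣ + ∣ P - D ∣ - ∣ P - D ∣
          ≡⟨ solve 2 (λ a b → a :+ b :- b := a) refl ∣ D ∣ ∣ P - D ∣ ⟩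
        ∣ D ∣ ∎
        where
        open ℚP.≤-Reasoning
        P = seq (product f) k
        close′ : ∣ P - D ∣ ≤ η
        close′ = subst (_≤ η) (trans (cong (λ z → ∣ z - P ∣) (seq-charPoly G x k)) (∣∣-swap D P)) close

    adjℚ-form : ∀ v → - y * (v · v) ≤ v · (adjℚ G ⊛ v)
    adjℚ-form = Descent.form-bounded (adjℚ G) ∣adjℚ∣≤1
      (λ i j → cong (ι ∘ 𝟙) (adj-sym G i j)) (ℚP.neg-antimono-≤ 0≤y)
      (0<½*ε (0<pow (suc n) 0<g)) det-bounded
      where
      ∣adjℚ∣≤1 : ∀ i j → ∣ adjℚ G i j ∣ ≤ 1ℚ
      ∣adjℚ∣≤1 i j with adj G i j
      ... | true  = ℚP.≤-refl
      ... | false = ℚP.nonNegative⁻¹ 1ℚ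

  0≤frac : ∀ a d → 0ℚ ≤ frac a d
  0≤frac a d = frac-≤ {0} {0} {a} {d} ℕ.z≤n

  -- Approximant 0 is the integer part `h`, and by `rootSeq-rate` no approximant exceeds it by more
  -- than 1.
  √-bound : ∀ d → ∃[ h ] h ℕ.^ 2 ℕ.≤ d × d ℕ.< suc h ℕ.^ 2 × (∀ k → rootSeq 2 d k ≤ ι (suc h))
  √-bound d = h , h²≤d , d<[1+h]² , λ k → ℚP.≤-trans (rootSeq-rate 1 d k 0)
    (ℚP.≤-reflexive (frac-suc h 0))
    where
    h = ⌊ d ℕ.* 1 ℕ.^ 2 ^1/ 2 ⌋
    d*1≡d : d ℕ.* 1 ℕ.^ 2 ≡ d
    d*1≡d = ℕP.*-identityʳ d
    h²≤d : h ℕ.^ 2 ℕ.≤ d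
    h²≤d = ℕP.≤-trans (search-lower 1 (d ℕ.* 1 ℕ.^ 2) (d ℕ.* 1 ℕ.^ 2)) (ℕP.≤-reflexive d*1≡d)
    d<[1+h]² : d ℕ.< suc h ℕ.^ 2
    d<[1+h]² = subst (ℕ._< suc h ℕ.^ 2) d*1≡d (iroot-upper 1 (d ℕ.* 1 ℕ.^ 2))

  -- The slack ½ leaves room for replacing λ by the natural number y > λ.
  eigenvalue-bound : ∀ {C ev c d} → Eventually (λ k → seq C k ≤ ι c) → ev ≤ᵣ C *ᵣ √ d → 1 ℕ.≤ d →
    ∃[ y ] y ℕ.^ 2 ℕ.≤ 4 ℕ.* suc c ℕ.^ 2 ℕ.* d × Eventually (λ k → seq ev k + ½ ≤ ι y)
  eigenvalue-bound {C} {ev} {c} {d} C≤c ev≤ 1≤d = go (√-bound d)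
    where
    go : ∃[ h ] h ℕ.^ 2 ℕ.≤ d × d ℕ.< suc h ℕ.^ 2 × (∀ k → rootSeq 2 d k ≤ ι (suc h)) →
      ∃[ y ] y ℕ.^ 2 ℕ.≤ 4 ℕ.* suc c ℕ.^ 2 ℕ.* d × Eventually (λ k → seq ev k + ½ ≤ ι y)
    -- In y = c(h + 1) + 1 the last 1 pays for the error ½ allowed by `≤ᵣ` and for the slack ½. As d
    -- ≥ 1 forces h ≥ 1, y ≤ 2(c + 1)h, whence the factor 4.
    go (h , h²≤d , d< , root≤) = suc (c ℕ.* suc h) , y²≤ , eventually-map
      (λ k (C≤ , ev≤) → bound k C≤ ev≤)
      (eventually-∧ C≤c (ev≤ ½ (ℚP.positive⁻¹ ½)))
      where
      positive : ∀ h → d ℕ.< suc h ℕ.^ 2 → 1 ℕ.≤ h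
      positive zero    d<1 = contradiction (ℕP.<-≤-trans d<1 1≤d) (ℕP.<-irrefl refl)
      positive (suc _) _   = ℕ.s≤s ℕ.z≤n
      1≤h = positive h d<
      y²≤ : suc (c ℕ.* suc h) ℕ.^ 2 ℕ.≤ 4 ℕ.* suc c ℕ.^ 2 ℕ.* d
      y²≤ = begin
        suc (c ℕ.* suc h) ℕ.^ 2        ≤⟨ ℕP.^-monoˡ-≤ 2 (ℕ.s≤s (ℕP.m≤n+m (c ℕ.* suc h) h)) ⟩
        (suc c ℕ.* suc h) ℕ.^ 2
          ≤⟨ ℕP.^-monoˡ-≤ 2 (ℕP.*-monoʳ-≤ (suc c) (ℕP.+-monoˡ-≤ h 1≤h)) ⟩
        (suc c ℕ.* (h ℕ.+ h)) ℕ.^ 2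
          ≡⟨ ℕS.solve 2 (λ c h → (c ℕS.:* (h ℕS.:+ h)) ℕS.:^ 2 ℕS.:= ℕS.con 4 ℕS.:* c ℕS.:^ 2 ℕS.:* h ℕS.:^ 2) refl (suc c) h ⟩
        4 ℕ.* suc c ℕ.^ 2 ℕ.* h ℕ.^ 2
          ≤⟨ ℕP.*-monoʳ-≤ (4 ℕ.* suc c ℕ.^ 2) h²≤d ⟩
        4 ℕ.* suc c ℕ.^ 2 ℕ.* d ∎
        where
        open ℕP.≤-Reasoning
      bound : ∀ k → seq C k ≤ ι c → seq ev k ≤ seq C k * rootSeq 2 d k + ½ →
        seq ev k + ½ ≤ ι (suc (c ℕ.* suc h))
      bound k C≤ ev≤ = begin
        seq ev k + ½
          ≤⟨ ℚP.+-monoˡ-≤ ½ ev≤ ⟩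
        seq C k * rootSeq 2 d k + ½ + ½
          ≡⟨ ℚP.+-assoc (seq C k * rootSeq 2 d k) ½ ½ ⟩
        seq C k * rootSeq 2 d k + 1ℚ
          ≤⟨ ℚP.+-monoˡ-≤ 1ℚ (ℚP.≤-trans (*-monoʳ (0≤frac ⌊ d ℕ.* suc k ℕ.^ 2 ^1/ 2 ⌋ k) C≤) (*-monoˡ (0≤ι c) (root≤ k))) ⟩
        ι c * ι (suc h) + 1ℚ
          ≡⟨ cong (_+ 1ℚ) (sym (ι-* c (suc h))) ⟩
        ι (c ℕ.* suc h) + 1ℚ
          ≡⟨ sym (ι-suc (c ℕ.* suc h)) ⟩
        ι (suc (c ℕ.* suc h)) ∎
        where open ℚP.≤-Reasoning

  rootSeq-perfect : ∀ k x m → ι x ≤ rootSeq (suc k) (x ℕ.^ suc k) m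
  rootSeq-perfect k x m = frac-≤ {x} {0} {r} {m}
    (ℕP.≤-trans (ℕP.≮⇒≥ λ r<xm → ℕP.<-irrefl refl (ℕP.<-≤-trans
        (iroot-upper k (x ℕ.^ suc k ℕ.* suc m ℕ.^ suc k))
        (ℕP.≤-trans (ℕP.^-monoˡ-≤ (suc k) r<xm) (ℕP.≤-reflexive (*-^ x (suc m) (suc k))))))
      (ℕP.≤-reflexive (sym (ℕP.*-identityʳ r))))
    where
    r = ⌊ x ℕ.^ suc k ℕ.* suc m ℕ.^ suc k ^1/ suc k ⌋

  -- At the perfect power a^(k+1) the root is at least the integer a^k. The error in `≤ᵣ` is taken
  -- to be ½/(p + 1); multiplied by p + 1 it becomes ½, and integrality removes it.
  degree-bound : ∀ {c p} k a d → Eventually (λ m → frac 1 p ≤ seq c m) →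
    c *ᵣ ((a ℕ.^ suc k) ^[1-1/ suc k ]) ≤ᵣ fromℕᵣ d → a ℕ.^ k ℕ.≤ suc p ℕ.* d
  degree-bound {c} {p} k a d p≤c h = ℕ.s≤s⁻¹ (ι-cancel-< (eventually-const
    (eventually-map (λ m (lo , hi) → bound m lo hi) (eventually-∧ p≤c (h (½ * f) 0<½f)))))
    where
    f = frac 1 p
    X = a ℕ.^ k
    0<f : 0ℚ < f
    0<f = ℚP.positive⁻¹ f {{ℚP.normalize-pos 1 (suc p)}}
    0<½f = 0<½*ε 0<f
    bound : ∀ m → f ≤ seq c m →
      seq c m * rootSeq (suc k) ((a ℕ.^ suc k) ℕ.^ k) m ≤ ι d + ½ * f → ι X < ι (suc (suc p ℕ.* d))
    bound m lo hi = begin-strict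
      ι X                                ≡⟨ sym (ℚP.*-identityˡ (ι X)) ⟩
      ι 1 * ι X                          ≡⟨ cong (_* ι X) (sym (ι*frac 1 p)) ⟩
      ι (suc p) * f * ι X                ≡⟨ ℚP.*-assoc (ι (suc p)) f (ι X) ⟩
      ι (suc p) * (f * ι X)
        ≤⟨ *-monoˡ (0≤ι (suc p)) (ℚP.≤-trans (*-monoˡ (ℚP.<⇒≤ 0<f)
             (subst (λ z → ι X ≤ rootSeq (suc k) z m) exponents (rootSeq-perfect k X m)))
             (*-monoʳ (0≤frac ⌊ (a ℕ.^ suc k) ℕ.^ k ℕ.* suc m ℕ.^ suc k ^1/ suc k ⌋ m) lo)) ⟩
      ι (suc p) * (seq c m * rootSeq (suc k) ((a ℕ.^ suc k) ℕ.^ k) m)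
        ≤⟨ *-monoˡ (0≤ι (suc p)) hi ⟩
      ι (suc p) * (ι d + ½ * f)
        ≡⟨ solve 3 (λ p d f → p :* (d :+ con ½ :* f) := p :* d :+ con ½ :* (p :* f)) refl (ι (suc p)) (ι d) f ⟩
      ι (suc p) * ι d + ½ * (ι (suc p) * f)
        ≡⟨ cong₂ (λ x z → x + ½ * z) (sym (ι-* (suc p) d)) (ι*frac 1 p) ⟩
      ι (suc p ℕ.* d) + ½ * ι 1
        <⟨ ℚP.+-monoʳ-< (ι (suc p ℕ.* d)) (ℚ.*<* (ℤ.+<+ (ℕ.s≤s (ℕ.s≤s ℕ.z≤n)))) ⟩
      ι (suc p ℕ.* d) + 1ℚ               ≡⟨ sym (ι-suc (suc p ℕ.* d)) ⟩
      ι (suc (suc p ℕ.* d))              ∎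
      where
      open ℚP.≤-Reasoning
      exponents : X ℕ.^ suc k ≡ (a ℕ.^ suc k) ℕ.^ k
      exponents = trans (ℕP.^-*-assoc a k (suc k)) (trans (cong (a ℕ.^_) (ℕP.*-comm k (suc k)))
        (sym (ℕP.^-*-assoc a (suc k) k)))

  -- Edge counts inside vertex sets.

  ι-∑ : ∀ {n} (f : Fin n → ℕ) → ι (∑ℕ.sum f) ≡ ∑ λ i → ι (f i)
  ι-∑ {zero}  f = refl
  ι-∑ {suc n} f = trans (ι-+ (f zero) (∑ℕ.sum (f ∘ suc))) (cong (ι (f zero) +_) (ι-∑ (f ∘ suc)))

  count≡ι : ∀ n → count n ≡ ι n
  count≡ι zero    = refl
  count≡ι (suc n) = trans (cong (1ℚ +_) (count≡ι n)) (sym (ι-+ 1 n))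

  ∣tabulate∣ : ∀ {n} (f : Fin n → Bool) → Subset.∣ tabulate f ∣ ≡ ∑ℕ.sum (𝟙 ∘ f)
  ∣tabulate∣ {zero}  f = refl
  ∣tabulate∣ {suc n} f with f zero
  ... | true  = cong suc (∣tabulate∣ (f ∘ suc))
  ... | false = ∣tabulate∣ (f ∘ suc)

  size : ∀ {n} → (Fin n → Bool) → ℕ
  size U = ∑ℕ.sum λ i → 𝟙 (U i)

  degreeIn : ∀ {n} → Graph n → (Fin n → Bool) → Fin n → ℕ
  degreeIn G U i = ∑ℕ.sum λ j → 𝟙 (adj G i j) ℕ.* 𝟙 (U j)

  edgesIn : ∀ {n} → Graph n → (Fin n → Bool) → ℕ
  edgesIn G U = ∑ℕ.sum λ i → 𝟙 (U i) ℕ.* degreeIn G U i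

  -- The form is evaluated at n 1_U - |U| 1, the scaled projection of 1_U to the
  -- orthogonal complement of the constants.
  mixing : ∀ {n d y} (G : Graph (suc n)) → (∀ i → degree G i ≡ d) →
    (∀ v → - ι y * (v · v) ≤ v · (adjℚ G ⊛ v)) → ∀ U →
    d ℕ.* (size U ℕ.* size U) ℕ.≤ suc n ℕ.* edgesIn G U ℕ.+ y ℕ.* (suc n ℕ.* size U)
  mixing {n} {d} {y} G regular form U = ι-cancel-≤ (subst₂ _≤_
    (sym (trans (ι-* d (size U ℕ.* size U)) (cong (ι d *_) (ι-* (size U) (size U)))))
    (sym (trans (ι-+ (suc n ℕ.* edgesIn G U) (y ℕ.* (suc n ℕ.* size U)))
      (cong₂ _+_ (ι-* (suc n) (edgesIn G U))
        (trans (ι-* y (suc n ℕ.* size U)) (cong (ι y *_) (ι-* (suc n) (size U)))))))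
    (ℚP.*-cancelˡ-≤-pos N {{ℚ.positive 0<N}} scaled))
    where
    A = adjℚ G
    N u D E Y : ℚ
    N = ι (suc n)
    u = ι (size U)
    D = ι d
    E = ι (edgesIn G U)
    Y = ι y
    x one v : Fin (suc n) → ℚ
    x i   = ι (𝟙 (U i))
    one _ = 1ℚ
    v i   = N * x i + (- u) * one i
    0<N : 0ℚ < N
    0<N = ℚP.<-≤-trans (ℚP.positive⁻¹ 1ℚ) (ι-mono {1} {suc n} (ℕ.s≤s ℕ.z≤n))
    x·one : x · one ≡ u
    x·one = trans (sum-cong-≗ λ i → ℚP.*-identityʳ (x i)) (sym (ι-∑ (𝟙 ∘ U)))
    x·x : x · x ≡ u
    x·x = trans (sum-cong-≗ λ i → idem (U i)) (sym (ι-∑ (𝟙 ∘ U)))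
      where
      idem : ∀ b → ι (𝟙 b) * ι (𝟙 b) ≡ ι (𝟙 b)
      idem true  = refl
      idem false = refl
    one·one : one · one ≡ N
    one·one = trans (sum-cong-≗ {suc n} λ _ → ℚP.*-identityʳ 1ℚ) (count≡ι (suc n))
    A⊛one : ∀ i → (A ⊛ one) i ≡ D
    A⊛one i = trans (sum-cong-≗ λ j → ℚP.*-identityʳ (A i j))
      (trans (sym (ι-∑ (𝟙 ∘ adj G i))) (cong ι (trans (sym (∣tabulate∣ (adj G i))) (regular i))))
    ·const : ∀ (w : Fin (suc n) → ℚ) → w · (A ⊛ one) ≡ D * (w · one)
    ·const w = trans (·-congʳ w A⊛one) (trans
      (sum-cong-≗ λ i → solve 2 (λ w d → w :* d := d :* (w :* con 1ℚ)) refl (w i) D)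
      (sym (*-distribˡ-sum D λ i → w i * 1ℚ)))
    x·Ax : x · (A ⊛ x) ≡ E
    x·Ax = sym (trans (ι-∑ λ i → 𝟙 (U i) ℕ.* degreeIn G U i)
      (sum-cong-≗ λ i → trans (ι-* (𝟙 (U i)) (degreeIn G U i)) (cong (x i *_)
        (trans (ι-∑ λ j → 𝟙 (adj G i j) ℕ.* 𝟙 (U j))
          (sum-cong-≗ λ j → ι-* (𝟙 (adj G i j)) (𝟙 (U j)))))))
    vv : v · v ≡ N * (N * u + (- u) * u) + (- u) * (N * u + (- u) * N)
    vv = trans (·-linearʳ N (- u) v x one) (cong₂ (λ p q → N * p + (- u) * q)
      (trans (·-linearˡ N (- u) x one x)
        (cong₂ (λ p q → N * p + (- u) * q) x·x (trans (·-comm one x) x·one)))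
      (trans (·-linearˡ N (- u) x one one)
        (cong₂ (λ p q → N * p + (- u) * q) x·one one·one)))
    vAv : v · (A ⊛ v) ≡ N * (N * E + (- u) * (D * u)) + (- u) * (D * (N * u + (- u) * N))
    vAv = begin
      v · (A ⊛ v)
        ≡⟨ ·-congʳ v (⊛-linear A N (- u) x one) ⟩
      v · (λ i → N * (A ⊛ x) i + (- u) * (A ⊛ one) i)
        ≡⟨ ·-linearʳ N (- u) v (A ⊛ x) (A ⊛ one) ⟩
      N * (v · (A ⊛ x)) + (- u) * (v · (A ⊛ one))
        ≡⟨ cong₂ (λ p q → N * p + (- u) * q)
             (trans (·-linearˡ N (- u) x one (A ⊛ x)) (cong₂ (λ p q → N * p + (- u) * q) x·Ax
               (trans (·-⊛-sym A (λ i j → cong (ι ∘ 𝟙) (adj-sym G i j)) one x)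
                 (trans (·const x) (cong (D *_) x·one)))))
             (trans (·const v) (cong (D *_) (trans (·-linearˡ N (- u) x one one)
               (cong₂ (λ p q → N * p + (- u) * q) x·one one·one)))) ⟩
      N * (N * E + (- u) * (D * u)) + (- u) * (D * (N * u + (- u) * N)) ∎
      where open ≡-Reasoning
    -- The form at `v` reads N²E - NDu² ≥ -Y(N²u - Nu²). The term YNu² is given away, which leaves a
    -- common factor N to cancel.
    scaled : N * (D * (u * u)) ≤ N * (N * E + Y * (N * u))
    scaled = 0≤q-p⇒p≤q (subst (0ℚ ≤_)
      (trans (cong₂ (λ p q → p - (- Y * q) + Y * (N * (u * u))) vAv vv)
        (solve 5 (λ n u d e y →
          n :* (n :* e :+ (:- u) :* (d :* u)) :+ (:- u) :* (d :* (n :* u :+ (:- u) :* n))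
            :- (:- y :* (n :* (n :* u :+ (:- u) :* u) :+ (:- u) :* (n :* u :+ (:- u) :* n)))
            :+ y :* (n :* (u :* u))
          := n :* (n :* e :+ y :* (n :* u)) :- n :* (d :* (u :* u))) refl N u D E Y))
      (0≤p+q (p≤q⇒0≤q-p (form v)) (0≤p*q (0≤ι y) (0≤p*q (0≤ι (suc n)) (0≤p*p u)))))

-- Containers for independent sets.

module IndependentSets where
  open QuadraticForm using (ι; _·_; _⊛_)
  open Spectrum

  ∑ℕ-mono : ∀ {n} {f g : Fin n → ℕ} → (∀ i → f i ℕ.≤ g i) → ∑ℕ.sum f ℕ.≤ ∑ℕ.sum g
  ∑ℕ-mono {zero}  h = ℕ.z≤n
  ∑ℕ-mono {suc n} h = ℕP.+-mono-≤ (h zero) (∑ℕ-mono (h ∘ suc))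

  ∑ℕ-const : ∀ n c → ∑ℕ.sum {n} (λ _ → c) ≡ n ℕ.* c
  ∑ℕ-const zero    c = refl
  ∑ℕ-const (suc n) c = cong (c ℕ.+_) (∑ℕ-const n c)

  ∑-pointˡ : ∀ {n} (u : Fin n) → ∑ℕ.sum (λ v → 𝟙 (does (v ≟ᶠ u))) ≡ 1
  ∑-pointˡ {suc n} zero    = cong suc (trans (∑ℕ-const n 0) (ℕP.*-zeroʳ n))
  ∑-pointˡ {suc n} (suc u) = ∑-pointˡ u

  ∑-pointʳ : ∀ {n} (u : Fin n) → ∑ℕ.sum (λ v → 𝟙 (does (u ≟ᶠ v))) ≡ 1
  ∑-pointʳ {suc n} zero    = cong suc (trans (∑ℕ-const n 0) (ℕP.*-zeroʳ n))
  ∑-pointʳ {suc n} (suc u) = ∑-pointʳ u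

  size-full : ∀ n → size {n} (λ _ → true) ≡ n
  size-full n = trans (∑ℕ-const n 1) (ℕP.*-identityʳ n)

  Independent : ∀ {n} → Graph n → (Fin n → Bool) → Set
  Independent G I = ∀ i j → I i ≡ true → I j ≡ true → adj G i j ≡ false

  infix 4 _⊑_
  _⊑_ : ∀ {n} → (Fin n → Bool) → (Fin n → Bool) → Set
  U ⊑ V = ∀ i → U i ≡ true → V i ≡ true

  insert remove : ∀ {n} → Fin n → (Fin n → Bool) → Fin n → Bool
  insert u U v = if does (v ≟ᶠ u) then true else U v
  remove u U v = if does (v ≟ᶠ u) then false else U v

  removeNbhd : ∀ {n} → Graph n → Fin n → (Fin n → Bool) → Fin n → Bool
  removeNbhd G u U = remove u λ v → U v ∧ not (adj G u v)

  size-insert : ∀ {n} (u : Fin n) U → size (insert u U) ℕ.≤ suc (size U)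
  size-insert u U = ℕP.≤-trans (∑ℕ-mono pointwise) (ℕP.≤-reflexive (trans
    (∑ℕ.∑-distrib-+ (λ v → 𝟙 (does (v ≟ᶠ u))) (𝟙 ∘ U)) (cong (ℕ._+ size U) (∑-pointˡ u))))
    where
    pointwise : ∀ v → 𝟙 (insert u U v) ℕ.≤ 𝟙 (does (v ≟ᶠ u)) ℕ.+ 𝟙 (U v)
    pointwise v with does (v ≟ᶠ u)
    ... | true  = ℕ.s≤s ℕ.z≤n
    ... | false = ℕP.≤-refl

  size-remove : ∀ {n} (u : Fin n) U → U u ≡ true → suc (size (remove u U)) ℕ.≤ size U
  size-remove u U u∈U = ℕP.≤-trans (ℕP.≤-reflexive (sym (trans
    (∑ℕ.∑-distrib-+ (λ v → 𝟙 (does (v ≟ᶠ u))) (𝟙 ∘ remove u U))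
      (cong (ℕ._+ size (remove u U)) (∑-pointˡ u))))) (∑ℕ-mono pointwise)
    where
    pointwise : ∀ v → 𝟙 (does (v ≟ᶠ u)) ℕ.+ 𝟙 (remove u U v) ℕ.≤ 𝟙 (U v)
    pointwise v with v ≟ᶠ u
    ... | yes refl = ℕP.≤-reflexive (cong 𝟙 (sym u∈U))
    ... | no _     = ℕP.≤-refl

  size-removeNbhd : ∀ {n} (G : Graph n) u U → U u ≡ true →
    suc (size (removeNbhd G u U) ℕ.+ degreeIn G U u) ℕ.≤ size U
  size-removeNbhd G u U u∈U = ℕP.≤-trans (ℕP.≤-reflexive (sym (trans
    (∑ℕ.∑-distrib-+ (λ v → 𝟙 (does (v ≟ᶠ u))) (λ v → 𝟙 (removeNbhd G u U v) ℕ.+ 𝟙 (adj G u v) ℕ.* 𝟙 (U v)))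
    (cong₂ ℕ._+_ (∑-pointˡ u)
      (∑ℕ.∑-distrib-+ (𝟙 ∘ removeNbhd G u U) (λ v → 𝟙 (adj G u v) ℕ.* 𝟙 (U v)))))))
    (∑ℕ-mono pointwise)
    where
    split : ∀ a b → 𝟙 (b ∧ not a) ℕ.+ 𝟙 a ℕ.* 𝟙 b ≡ 𝟙 b
    split false false = refl
    split false true  = refl
    split true  false = refl
    split true  true  = refl
    pointwise : ∀ v → 𝟙 (does (v ≟ᶠ u)) ℕ.+ (𝟙 (removeNbhd G u U v) ℕ.+ 𝟙 (adj G u v) ℕ.* 𝟙 (U v)) ℕ.≤ 𝟙 (U v)
    pointwise v with v ≟ᶠ u
    ... | yes refl = ℕP.≤-reflexive (trans (cong (λ a → suc (𝟙 a ℕ.* 𝟙 (U v))) (adj-irrefl G v)) (cong 𝟙 (sym u∈U)))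
    ... | no _     = ℕP.≤-reflexive (split (adj G u v) (U v))

  Dense : ∀ {n} → Graph n → (R g : ℕ) → Set
  Dense G R g = ∀ U → R ℕ.< size U → ∃[ u ] U u ≡ true × size U ℕ.≤ g ℕ.* degreeIn G U u

  record Containers {n} (G : Graph n) (U : Fin n → Bool) (bound width : ℕ) : Set where
    field
      sets   : List (Fin n → Bool)
      few    : length sets ℕ.≤ bound
      small  : All (λ C → size C ℕ.≤ width) sets
      covers : ∀ I → Independent G I → I ⊑ U → Any (I ⊑_) sets

  -- The Kleitman–Winston algorithm: a vertex u of high degree in U is either
  -- avoided or selected, and selecting it shrinks U by the factor g/(g+1).
  containers : ∀ {n} (G : Graph n) {R g} → Dense G R (suc g) → ∀ m q U → size U ℕ.≤ m →
    size U ℕ.* g ℕ.^ q ℕ.≤ R ℕ.* suc g ℕ.^ q → Containers G U (suc m ℕ.^ q) (R ℕ.+ q)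
  containers {n} G {R} {g} dense = go
    where
    trivial : ∀ m q U → size U ℕ.≤ R → Containers G U (suc m ℕ.^ q) (R ℕ.+ q)
    trivial m q U U≤R = record
      { sets   = U ∷ []
      ; few    = ℕP.m^n>0 (suc m) q
      ; small  = ℕP.≤-trans U≤R (ℕP.m≤m+n R q) ∷ []
      ; covers = λ I _ I⊑U → here I⊑U
      }
    branch : ∀ m q U u → Containers G (remove u U) (suc m ℕ.^ suc q) (R ℕ.+ suc q) →
      Containers G (removeNbhd G u U) (suc m ℕ.^ q) (R ℕ.+ q) →
      Containers G U (suc (suc m) ℕ.^ suc q) (R ℕ.+ suc q)
    branch m q U u out inn = record
      { sets   = sets out ++ List.map (insert u) (sets inn)
      ; few    = few′
      ; small  = AllP.++⁺ (small out) (AllP.map⁺ (All.map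
          (λ {C} C≤ → ℕP.≤-trans (size-insert u C)
            (ℕP.≤-trans (ℕ.s≤s C≤) (ℕP.≤-reflexive (sym (ℕP.+-suc R q))))) (small inn)))
      ; covers = covers′
      }
      where
      open Containers
      few′ : length (sets out ++ List.map (insert u) (sets inn)) ℕ.≤ suc (suc m) ℕ.^ suc q
      few′ = begin
        length (sets out ++ List.map (insert u) (sets inn))
          ≡⟨ trans (ListP.length-++ (sets out)) (cong (length (sets out) ℕ.+_) (ListP.length-map (insert u) (sets inn))) ⟩
        length (sets out) ℕ.+ length (sets inn)
          ≤⟨ ℕP.+-mono-≤ (few out) (few inn) ⟩
        suc m ℕ.^ suc q ℕ.+ suc m ℕ.^ q
          ≡⟨ ℕP.+-comm (suc m ℕ.^ suc q) (suc m ℕ.^ q) ⟩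
        suc (suc m) ℕ.* suc m ℕ.^ q
          ≤⟨ ℕP.*-monoʳ-≤ (suc (suc m)) (ℕP.^-monoˡ-≤ q (ℕP.n≤1+n (suc m))) ⟩
        suc (suc m) ℕ.^ suc q ∎
        where open ℕP.≤-Reasoning
      covers′ : ∀ I → Independent G I → I ⊑ U → Any (I ⊑_) (sets out ++ List.map (insert u) (sets inn))
      covers′ I ind I⊑U with I u in u∈I
      ... | false = AnyP.++⁺ˡ (covers out I ind I⊑)
        where
        I⊑ : I ⊑ remove u U
        I⊑ i i∈I with i ≟ᶠ u
        ... | yes refl = contradiction (trans (sym i∈I) u∈I) λ ()
        ... | no _     = I⊑U i i∈I
      ... | true = AnyP.++⁺ʳ (sets out) (AnyP.map⁺ (Any.map extend (covers inn (remove u I) ind′ I⊑)))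
        where
        ⊑I : remove u I ⊑ I
        ⊑I i h with i ≟ᶠ u
        ⊑I i () | yes _
        ⊑I i h  | no _ = h
        ind′ : Independent G (remove u I)
        ind′ i j i∈ j∈ = ind i j (⊑I i i∈) (⊑I j j∈)
        I⊑ : remove u I ⊑ removeNbhd G u U
        I⊑ i i∈ with i ≟ᶠ u
        I⊑ i () | yes _
        I⊑ i i∈ | no _ = cong₂ (λ a b → a ∧ not b) (I⊑U i i∈) (ind u i u∈I i∈)
        extend : ∀ {C} → remove u I ⊑ C → I ⊑ insert u C
        extend h i i∈I with i ≟ᶠ u | h i
        ... | yes _ | _  = refl
        ... | no _  | h′ = h′ i∈I
    -- `q` counts the selections still allowed: the invariant says that q reductions by g/(g+1)
    -- bring U down to R vertices. Each selected vertex returns to its container through `insert`,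
    -- which costs the `+ q` in the width. `m` decreases in both branches, so the recursion
    -- terminates.
    go : ∀ m q U → size U ℕ.≤ m → size U ℕ.* g ℕ.^ q ℕ.≤ R ℕ.* suc g ℕ.^ q →
      Containers G U (suc m ℕ.^ q) (R ℕ.+ q)
    go m q U U≤m inv with size U ℕP.≤? R
    go m q U U≤m inv | yes U≤R = trivial m q U U≤R
    go m zero U U≤m inv | no U≰R = contradiction
      (subst₂ ℕ._≤_ (ℕP.*-identityʳ (size U)) (ℕP.*-identityʳ R) inv) U≰R
    go zero (suc q) U U≤m inv | no U≰R = contradiction (ℕP.≤-trans U≤m ℕ.z≤n) U≰R
    go (suc m) (suc q) U U≤m inv | no U≰R with dense U (ℕP.≰⇒> U≰R)
    ... | u , u∈U , large = branch m q U u
      (go m (suc q) (remove u U) (ℕ.s≤s⁻¹ (ℕP.≤-trans U-u<U U≤m))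
        (ℕP.≤-trans (ℕP.*-monoˡ-≤ (g ℕ.^ suc q) (ℕP.≤-trans (ℕP.n≤1+n _) U-u<U)) inv))
      (go m q U′ (ℕ.s≤s⁻¹ (ℕP.≤-trans (ℕP.≤-trans (ℕ.s≤s (ℕP.m≤m+n (size U′) (degreeIn G U u))) U′<U) U≤m)) inv′)
      where
      U′ = removeNbhd G u U
      U-u<U = size-remove u U u∈U
      U′<U = size-removeNbhd G u U u∈U
      shrink : suc g ℕ.* size U′ ℕ.≤ g ℕ.* size U
      shrink = ℕP.+-cancelˡ-≤ (size U) (suc g ℕ.* size U′) (g ℕ.* size U) (begin
        size U ℕ.+ suc g ℕ.* size U′
          ≤⟨ ℕP.+-monoˡ-≤ (suc g ℕ.* size U′) large ⟩
        suc g ℕ.* degreeIn G U u ℕ.+ suc g ℕ.* size U′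
          ≡⟨ trans (sym (ℕP.*-distribˡ-+ (suc g) (degreeIn G U u) (size U′)))
               (cong (suc g ℕ.*_) (ℕP.+-comm (degreeIn G U u) (size U′))) ⟩
        suc g ℕ.* (size U′ ℕ.+ degreeIn G U u)
          ≤⟨ ℕP.*-monoʳ-≤ (suc g) (ℕP.≤-trans (ℕP.n≤1+n _) U′<U) ⟩
        suc g ℕ.* size U ∎)
        where open ℕP.≤-Reasoning
      inv′ : size U′ ℕ.* g ℕ.^ q ℕ.≤ R ℕ.* suc g ℕ.^ q
      inv′ = ℕP.*-cancelˡ-≤ (suc g) (begin
        suc g ℕ.* (size U′ ℕ.* g ℕ.^ q)
          ≡⟨ sym (ℕP.*-assoc (suc g) (size U′) (g ℕ.^ q)) ⟩
        suc g ℕ.* size U′ ℕ.* g ℕ.^ q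
          ≤⟨ ℕP.*-monoˡ-≤ (g ℕ.^ q) shrink ⟩
        g ℕ.* size U ℕ.* g ℕ.^ q
          ≡⟨ ℕS.solve 3 (λ g u p → g ℕS.:* u ℕS.:* p ℕS.:= u ℕS.:* (g ℕS.:* p)) refl g (size U) (g ℕ.^ q) ⟩
        size U ℕ.* g ℕ.^ suc q
          ≤⟨ inv ⟩
        R ℕ.* suc g ℕ.^ suc q
          ≡⟨ ℕS.solve 3 (λ g r p → r ℕS.:* (g ℕS.:* p) ℕS.:= g ℕS.:* (r ℕS.:* p)) refl (suc g) R (suc g ℕ.^ q) ⟩
        suc g ℕ.* (R ℕ.* suc g ℕ.^ q) ∎)
        where open ℕP.≤-Reasoning

  ∑ℕ-argmin : ∀ {n} (F : Fin (suc n) → ℕ) → ∃[ v ] (∀ w → F v ℕ.≤ F w)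
  ∑ℕ-argmin {zero}  F = zero , λ where zero → ℕP.≤-refl
  ∑ℕ-argmin {suc n} F with ∑ℕ-argmin (F ∘ suc)
  ... | v , least with ℕP.≤-total (F zero) (F (suc v))
  ... | inj₁ h = zero , λ where
    zero    → ℕP.≤-refl
    (suc w) → ℕP.≤-trans h (least w)
  ... | inj₂ h = suc v , λ where
    zero    → h
    (suc w) → least w

  ≤average : ∀ {n} (F : Fin (suc n) → ℕ) → ∃[ v ] suc n ℕ.* F v ℕ.≤ ∑ℕ.sum F
  ≤average {n} F with ∑ℕ-argmin F
  ... | v , least = v , ℕP.≤-trans (ℕP.≤-reflexive (sym (∑ℕ-const (suc n) (F v)))) (∑ℕ-mono least)

  -- Above the threshold the mixing bound yields |U|² ≤ gE, where E is the sum of the degrees inside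
  -- U. If every vertex of U had g deg < |U|, summation over U would give |U| + gE ≤ |U|². A
  -- decidable search turns this contradiction into a witness.
  dense : ∀ {n d y g R} (G : Graph (suc n)) → 1 ℕ.≤ d → 2 ℕ.* suc n ℕ.≤ d ℕ.* g →
    (∀ u → R ℕ.< u → 2 ℕ.* y ℕ.* suc n ℕ.≤ d ℕ.* u) →
    (∀ U → d ℕ.* (size U ℕ.* size U) ℕ.≤ suc n ℕ.* edgesIn G U ℕ.+ y ℕ.* (suc n ℕ.* size U)) →
    Dense G R g
  dense {n} {d} {y} {g} {R} G 1≤d 2n≤dg threshold mix U R<U =
    conclude (FinP.any? λ u → (U u BoolP.≟ true) ×-dec (size U ℕP.≤? g ℕ.* degreeIn G U u))
    where
    s = size U
    E = edgesIn G U
    N = suc n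
    -- d s² ≤ N E + y N s ≤ N E + d s² / 2
    twice : 2 ℕ.* (d ℕ.* (s ℕ.* s)) ℕ.≤ 2 ℕ.* (N ℕ.* E) ℕ.+ d ℕ.* (s ℕ.* s)
    twice = begin
      2 ℕ.* (d ℕ.* (s ℕ.* s))                     ≤⟨ ℕP.*-monoʳ-≤ 2 (mix U) ⟩
      2 ℕ.* (N ℕ.* E ℕ.+ y ℕ.* (N ℕ.* s))
        ≡⟨ ℕS.solve 4 (λ n e y s → ℕS.con 2 ℕS.:* (n ℕS.:* e ℕS.:+ y ℕS.:* (n ℕS.:* s))
             ℕS.:= ℕS.con 2 ℕS.:* (n ℕS.:* e) ℕS.:+ ℕS.con 2 ℕS.:* y ℕS.:* n ℕS.:* s) refl N E y s ⟩
      2 ℕ.* (N ℕ.* E) ℕ.+ 2 ℕ.* y ℕ.* N ℕ.* s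
        ≤⟨ ℕP.+-monoʳ-≤ (2 ℕ.* (N ℕ.* E)) (ℕP.*-monoˡ-≤ s (threshold s R<U)) ⟩
      2 ℕ.* (N ℕ.* E) ℕ.+ d ℕ.* s ℕ.* s           ≡⟨ cong (2 ℕ.* (N ℕ.* E) ℕ.+_) (ℕP.*-assoc d s s) ⟩
      2 ℕ.* (N ℕ.* E) ℕ.+ d ℕ.* (s ℕ.* s)         ∎
      where open ℕP.≤-Reasoning
    s²≤gE : s ℕ.* s ℕ.≤ g ℕ.* E
    s²≤gE = ℕP.*-cancelˡ-≤ d {{ℕ.>-nonZero 1≤d}} (begin
      d ℕ.* (s ℕ.* s)
        ≤⟨ ℕP.+-cancelʳ-≤ (d ℕ.* (s ℕ.* s)) (d ℕ.* (s ℕ.* s)) (2 ℕ.* (N ℕ.* E))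
             (ℕP.≤-trans (ℕP.≤-reflexive (cong (d ℕ.* (s ℕ.* s) ℕ.+_) (sym (ℕP.+-identityʳ (d ℕ.* (s ℕ.* s)))))) twice) ⟩
      2 ℕ.* (N ℕ.* E)   ≡⟨ sym (ℕP.*-assoc 2 N E) ⟩
      2 ℕ.* N ℕ.* E     ≤⟨ ℕP.*-monoˡ-≤ E 2n≤dg ⟩
      d ℕ.* g ℕ.* E     ≡⟨ ℕP.*-assoc d g E ⟩
      d ℕ.* (g ℕ.* E)   ∎)
      where open ℕP.≤-Reasoning
    conclude : Dec (∃[ u ] U u ≡ true × s ℕ.≤ g ℕ.* degreeIn G U u) →
      ∃[ u ] U u ≡ true × s ℕ.≤ g ℕ.* degreeIn G U u
    conclude (yes found) = found
    conclude (no none)   = contradiction too-few (ℕP.<⇒≱ (ℕP.≤-<-trans (ℕ.z≤n {R}) R<U))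
      where
      pointwise : ∀ i → 𝟙 (U i) ℕ.+ g ℕ.* (𝟙 (U i) ℕ.* degreeIn G U i) ℕ.≤ 𝟙 (U i) ℕ.* s
      pointwise i with U i in i∈U
      ... | false = ℕP.≤-reflexive (ℕP.*-zeroʳ g)
      ... | true  = subst₂ ℕ._≤_ (cong (λ z → suc (g ℕ.* z)) (sym (ℕP.+-identityʳ (degreeIn G U i))))
        (sym (ℕP.+-identityʳ s)) (ℕP.≰⇒> λ h → none (i , i∈U , h))
      total : s ℕ.+ g ℕ.* E ℕ.≤ s ℕ.* s
      total = subst₂ ℕ._≤_
        (trans (∑ℕ.∑-distrib-+ (𝟙 ∘ U) (λ i → g ℕ.* (𝟙 (U i) ℕ.* degreeIn G U i)))
          (cong (s ℕ.+_) (sym (∑ℕ.*-distribˡ-sum g λ i → 𝟙 (U i) ℕ.* degreeIn G U i))))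
        (sym (∑ℕ.*-distribʳ-sum s (𝟙 ∘ U)))
        (∑ℕ-mono pointwise)
      too-few : s ℕ.≤ 0
      too-few = ℕP.+-cancelʳ-≤ (g ℕ.* E) s 0 (ℕP.≤-trans total s²≤gE)

  -- A light map and the pulled back graph.

  hits : ∀ {n r} → (Fin n → Bool) → (Fin r → Fin n) → ℕ
  hits C f = size (C ∘ f)

  -- The exponential moment of Chernoff's bound: a single container that is hit t times already
  -- contributes 2^t.
  weight : ∀ {n r} → List (Fin n → Bool) → (Fin r → Fin n) → ℕ
  weight []       f = 0
  weight (C ∷ Cs) f = 2 ℕ.^ hits C f ℕ.+ weight Cs f

  -- As 2^𝟙(C v) = 1 + 𝟙(C v), summing over one further image v multiplies the term of C by n + |C|.
  ∑-weight : ∀ {n r X} (Cs : List (Fin n → Bool)) → All (λ C → n ℕ.+ size C ℕ.≤ X) Cs → (f : Fin r → Fin n) →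
    ∑ℕ.sum (λ v → weight Cs (v Vector.∷ f)) ℕ.≤ X ℕ.* weight Cs f
  ∑-weight {n} {X = X} []       []       f = ℕP.≤-trans (ℕP.≤-reflexive (trans (∑ℕ-const n 0) (ℕP.*-zeroʳ n))) ℕ.z≤n
  ∑-weight {n} {X = X} (C ∷ Cs) (h ∷ hs) f = begin
    ∑ℕ.sum (λ v → 2 ℕ.^ (𝟙 (C v) ℕ.+ hits C f) ℕ.+ weight Cs (v Vector.∷ f))
      ≡⟨ ∑ℕ.∑-distrib-+ (λ v → 2 ℕ.^ (𝟙 (C v) ℕ.+ hits C f)) (λ v → weight Cs (v Vector.∷ f)) ⟩
    ∑ℕ.sum (λ v → 2 ℕ.^ (𝟙 (C v) ℕ.+ hits C f)) ℕ.+ ∑ℕ.sum (λ v → weight Cs (v Vector.∷ f))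
      ≤⟨ ℕP.+-mono-≤ (ℕP.≤-trans (ℕP.≤-reflexive head-sum) (ℕP.*-monoˡ-≤ (2 ℕ.^ hits C f) h)) (∑-weight Cs hs f) ⟩
    X ℕ.* 2 ℕ.^ hits C f ℕ.+ X ℕ.* weight Cs f
      ≡⟨ sym (ℕP.*-distribˡ-+ X (2 ℕ.^ hits C f) (weight Cs f)) ⟩
    X ℕ.* (2 ℕ.^ hits C f ℕ.+ weight Cs f) ∎
    where
    open ℕP.≤-Reasoning
    2^𝟙 : ∀ b → 2 ℕ.^ 𝟙 b ≡ 1 ℕ.+ 𝟙 b
    2^𝟙 true  = refl
    2^𝟙 false = refl
    head-sum : ∑ℕ.sum (λ v → 2 ℕ.^ (𝟙 (C v) ℕ.+ hits C f)) ≡ (n ℕ.+ size C) ℕ.* 2 ℕ.^ hits C f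
    head-sum = trans
      (∑ℕ.sum-cong-≗ λ v → trans (ℕP.^-distribˡ-+-* 2 (𝟙 (C v)) (hits C f))
        (cong (ℕ._* 2 ℕ.^ hits C f) (2^𝟙 (C v))))
      (trans (sym (∑ℕ.*-distribʳ-sum (2 ℕ.^ hits C f) (λ v → 1 ℕ.+ 𝟙 (C v))))
        (cong (ℕ._* 2 ℕ.^ hits C f) (trans (∑ℕ.∑-distrib-+ {n} (λ _ → 1) (𝟙 ∘ C)) (cong (ℕ._+ size C) (size-full n)))))

  -- The method of conditional expectations for a uniformly random f.
  light-map : ∀ {n X} (Cs : List (Fin (suc n) → Bool)) → All (λ C → suc n ℕ.+ size C ℕ.≤ X) Cs → ∀ r →
    ∃[ f ] suc n ℕ.^ r ℕ.* weight {r = r} Cs f ℕ.≤ X ℕ.^ r ℕ.* length Cs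
  light-map {n} {X} Cs hs zero = (λ ()) , ℕP.*-monoʳ-≤ 1 (start Cs)
    where
    start : ∀ (Cs : List (Fin (suc n) → Bool)) → weight {r = 0} Cs (λ ()) ℕ.≤ length Cs
    start []       = ℕ.z≤n
    start (C ∷ Cs) = ℕ.s≤s (start Cs)
  light-map {n} {X} Cs hs (suc r) with light-map Cs hs r
  ... | f , light with ≤average (λ v → weight Cs (v Vector.∷ f))
  ... | v , light′ = v Vector.∷ f , (begin
    suc n ℕ.* suc n ℕ.^ r ℕ.* w
      ≡⟨ ℕS.solve 3 (λ a b c → a ℕS.:* b ℕS.:* c ℕS.:= b ℕS.:* (a ℕS.:* c)) refl (suc n) (suc n ℕ.^ r) w ⟩
    suc n ℕ.^ r ℕ.* (suc n ℕ.* w)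
      ≤⟨ ℕP.*-monoʳ-≤ (suc n ℕ.^ r) (ℕP.≤-trans light′ (∑-weight Cs hs f)) ⟩
    suc n ℕ.^ r ℕ.* (X ℕ.* weight Cs f)
      ≡⟨ ℕS.solve 3 (λ a b c → a ℕS.:* (b ℕS.:* c) ℕS.:= b ℕS.:* (a ℕS.:* c)) refl (suc n ℕ.^ r) X (weight Cs f) ⟩
    X ℕ.* (suc n ℕ.^ r ℕ.* weight Cs f)
      ≤⟨ ℕP.*-monoʳ-≤ X light ⟩
    X ℕ.* (X ℕ.^ r ℕ.* length Cs)
      ≡⟨ sym (ℕP.*-assoc X (X ℕ.^ r) (length Cs)) ⟩
    X ℕ.* X ℕ.^ r ℕ.* length Cs ∎)
    where
    open ℕP.≤-Reasoning
    w = weight Cs (v Vector.∷ f)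

  2^hits≤weight : ∀ {n r t} {Cs : List (Fin n → Bool)} (f : Fin r → Fin n) →
    Any (λ C → t ℕ.≤ hits C f) Cs → 2 ℕ.^ t ℕ.≤ weight Cs f
  2^hits≤weight {Cs = C ∷ Cs} f (here h)  = ℕP.≤-trans (ℕP.^-monoʳ-≤ 2 h) (ℕP.m≤m+n (2 ℕ.^ hits C f) (weight Cs f))
  2^hits≤weight {Cs = C ∷ Cs} f (there h) = ℕP.≤-trans (2^hits≤weight f h) (ℕP.m≤n+m (weight Cs f) (2 ℕ.^ hits C f))

  pullback : ∀ {n r} → Graph n → (Fin r → Fin n) → Graph r
  pullback G f = record
    { adj        = λ i j → adj G (f i) (f j)
    ; adj-sym    = λ i j → adj-sym G (f i) (f j)
    ; adj-irrefl = λ i → adj-irrefl G (f i)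
    }

  ∣_∣≡size : ∀ {n} (S : Subset.Subset n) → Subset.∣ S ∣ ≡ size (Vec.lookup S)
  ∣ S ∣≡size = trans (cong Subset.∣_∣ (sym (VecP.tabulate∘lookup S))) (∣tabulate∣ (Vec.lookup S))

  ∑ℕ-pos⇒∃ : ∀ {n} (f : Fin n → ℕ) → 0 ℕ.< ∑ℕ.sum f → ∃[ i ] 0 ℕ.< f i
  ∑ℕ-pos⇒∃ {suc n} f h with f zero in eq
  ... | suc _ = zero , subst (0 ℕ.<_) (sym eq) (ℕ.s≤s ℕ.z≤n)
  ... | zero with ∑ℕ-pos⇒∃ (f ∘ suc) h
  ... | i , p = suc i , p

  ∑ℕ≤1 : ∀ {n} (f : Fin n → ℕ) → (∀ i → f i ℕ.≤ 1) → (∀ i j → 0 ℕ.< f i → 0 ℕ.< f j → i ≡ j) →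
    ∑ℕ.sum f ℕ.≤ 1
  ∑ℕ≤1 {zero}  f f≤1 unique = ℕ.z≤n
  ∑ℕ≤1 {suc n} f f≤1 unique with ∑ℕ.sum (f ∘ suc) in eq
  ... | zero  = subst (ℕ._≤ 1) (sym (ℕP.+-identityʳ (f zero))) (f≤1 zero)
  ... | suc k with ∑ℕ-pos⇒∃ (f ∘ suc) (subst (0 ℕ.<_) (sym eq) (ℕ.s≤s ℕ.z≤n)) | f zero in eq₀
  ...   | i , p | zero  = subst (ℕ._≤ 1) eq (∑ℕ≤1 (f ∘ suc) (f≤1 ∘ suc)
    λ i j p q → FinP.suc-injective (unique (suc i) (suc j) p q))
  ...   | i , p | suc _ = contradiction (unique zero (suc i) (subst (0 ℕ.<_) (sym eq₀) (ℕ.s≤s ℕ.z≤n)) p) λ ()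

  𝟙≤1 : ∀ b → 𝟙 b ℕ.≤ 1
  𝟙≤1 true  = ℕP.≤-refl
  𝟙≤1 false = ℕ.z≤n

  𝟙*𝟙-pos : ∀ a {P : Set} (p? : Dec P) → 0 ℕ.< 𝟙 a ℕ.* 𝟙 (does p?) → a ≡ true × P
  𝟙*𝟙-pos true  (yes p) _ = refl , p

  does-true : ∀ {P : Set} (p? : Dec P) → does p? ≡ true → P
  does-true (yes p) _ = p

  -- `f` may identify vertices, but never two of a clique, since vertices with equal images are not
  -- adjacent. Each fibre thus meets S at most once, and counting S along the fibres gives |T| =
  -- |S|.
  pullback-clique : ∀ {n r s} (G : Graph n) (f : Fin r → Fin n) → HasClique (pullback G f) s → HasClique G s
  pullback-clique {n} {r} {s} G f (S , ∣S∣≡s , clique) = T , ∣T∣≡s , T-clique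
    where
    fibre : Fin n → Fin r → ℕ
    fibre v i = 𝟙 (Vec.lookup S i) ℕ.* 𝟙 (does (f i ≟ᶠ v))
    inFibre : ∀ v i → 0 ℕ.< fibre v i → i Subset.∈ S × f i ≡ v
    inFibre v i h with 𝟙*𝟙-pos (Vec.lookup S i) (f i ≟ᶠ v) h
    ... | i∈S , e = VecP.lookup⇒[]= i S i∈S , e
    c : Fin n → ℕ
    c v = ∑ℕ.sum (fibre v)
    c≤1 : ∀ v → c v ℕ.≤ 1
    c≤1 v = ∑ℕ≤1 (fibre v)
      (λ i → ℕP.*-mono-≤ (𝟙≤1 (Vec.lookup S i)) (𝟙≤1 (does (f i ≟ᶠ v)))) unique
      where
      unique : ∀ i j → 0 ℕ.< fibre v i → 0 ℕ.< fibre v j → i ≡ j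
      unique i j p q with i ≟ᶠ j | inFibre v i p | inFibre v j q
      ... | yes e | _ | _ = e
      ... | no i≢j | i∈S , refl | j∈S , e = contradiction
        (trans (sym (clique i j i∈S j∈S i≢j)) (trans (cong (adj G (f i)) e) (adj-irrefl G (f i)))) λ ()
    T : Subset.Subset n
    T = tabulate λ v → does (1 ℕP.≤? c v)
    𝟙T : ∀ k → k ℕ.≤ 1 → 𝟙 (does (1 ℕP.≤? k)) ≡ k
    𝟙T zero    _ = refl
    𝟙T (suc zero) _ = refl
    𝟙T (suc (suc k)) (ℕ.s≤s ())
    ∣T∣≡s : Subset.∣ T ∣ ≡ s
    ∣T∣≡s = begin
      Subset.∣ T ∣
        ≡⟨ ∣tabulate∣ (λ v → does (1 ℕP.≤? c v)) ⟩
      ∑ℕ.sum (λ v → 𝟙 (does (1 ℕP.≤? c v)))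
        ≡⟨ ∑ℕ.sum-cong-≗ (λ v → 𝟙T (c v) (c≤1 v)) ⟩
      ∑ℕ.sum (λ v → ∑ℕ.sum (fibre v))
        ≡⟨ ∑ℕ.∑-comm fibre ⟩
      ∑ℕ.sum (λ i → ∑ℕ.sum λ v → fibre v i)
        ≡⟨ (∑ℕ.sum-cong-≗ λ i → trans
             (sym (∑ℕ.*-distribˡ-sum (𝟙 (Vec.lookup S i)) λ v → 𝟙 (does (f i ≟ᶠ v))))
             (trans (cong (𝟙 (Vec.lookup S i) ℕ.*_) (∑-pointʳ (f i))) (ℕP.*-identityʳ (𝟙 (Vec.lookup S i))))) ⟩
      size (Vec.lookup S)
        ≡⟨ trans (sym ∣ S ∣≡size) ∣S∣≡s ⟩
      s ∎
      where open ≡-Reasoning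
    preimage : ∀ v → v Subset.∈ T → ∃[ i ] i Subset.∈ S × f i ≡ v
    preimage v v∈T = let i , p = ∑ℕ-pos⇒∃ (fibre v) (does-true (1 ℕP.≤? c v) v∈T′) in i , inFibre v i p
      where
      v∈T′ = trans (sym (VecP.lookup∘tabulate (λ v → does (1 ℕP.≤? c v)) v)) (VecP.[]=⇒lookup v∈T)
    T-clique : IsClique G T
    T-clique v w v∈T w∈T v≢w with preimage v v∈T | preimage w w∈T
    ... | i , i∈S , refl | j , j∈S , refl = clique i j i∈S j∈S (v≢w ∘ cong f)

  image : ∀ {n r} → (Fin r → Fin n) → (Fin r → Bool) → Fin n → Bool
  image f T v = does (FinP.any? λ i → (T i BoolP.≟ true) ×-dec (f i ≟ᶠ v))

  image-intro : ∀ {n r} (f : Fin r → Fin n) T i → T i ≡ true → image f T (f i) ≡ true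
  image-intro f T i i∈T = dec-true (FinP.any? λ j → (T j BoolP.≟ true) ×-dec (f j ≟ᶠ f i)) (i , i∈T , refl)

  image-elim : ∀ {n r} (f : Fin r → Fin n) T v → image f T v ≡ true → ∃[ i ] T i ≡ true × f i ≡ v
  image-elim f T v = does-true (FinP.any? λ i → (T i BoolP.≟ true) ×-dec (f i ≟ᶠ v))

  -- A map f under which every container is hit fewer than t times pulls G back
  -- to a graph without independent sets of size t.
  ¬Forces : ∀ {n s t r b w} (G : Graph (suc n)) → K[ s ]-Free G → Containers G (λ _ → true) b w →
    (suc n ℕ.+ w) ℕ.^ r ℕ.* b ℕ.< suc n ℕ.^ r ℕ.* 2 ℕ.^ t → ¬ Forces s t r
  ¬Forces {n} {s} {t} {r} {b} {w} G free K count forces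
    with light-map sets (All.map (ℕP.+-monoʳ-≤ (suc n)) small) r
    where open Containers K
  ... | f , light with forces (pullback G f)
  ... | inj₁ clique = free (pullback-clique G f clique)
  ... | inj₂ (T , ∣T∣≡t , ind) = ℕP.<-irrefl refl (begin-strict
    suc n ℕ.^ r ℕ.* 2 ℕ.^ t          ≤⟨ ℕP.*-monoʳ-≤ (suc n ℕ.^ r) (2^hits≤weight f hit) ⟩
    suc n ℕ.^ r ℕ.* weight sets f    ≤⟨ light ⟩
    (suc n ℕ.+ w) ℕ.^ r ℕ.* length sets ≤⟨ ℕP.*-monoʳ-≤ ((suc n ℕ.+ w) ℕ.^ r) few ⟩
    (suc n ℕ.+ w) ℕ.^ r ℕ.* b        <⟨ count ⟩
    suc n ℕ.^ r ℕ.* 2 ℕ.^ t          ∎)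
    where
    open Containers K
    open ℕP.≤-Reasoning
    -- Several vertices of T may share an image, but `hits` counts them with multiplicity, so a
    -- container of the image of T is hit by all t of them.
    I = image f (Vec.lookup T)
    I-ind : Independent G I
    I-ind v w v∈I w∈I with image-elim f (Vec.lookup T) v v∈I | image-elim f (Vec.lookup T) w w∈I
    ... | i , i∈T , refl | j , j∈T , refl =
      ind i j (VecP.lookup⇒[]= i T i∈T) (VecP.lookup⇒[]= j T j∈T)
    many : ∀ {C} → I ⊑ C → t ℕ.≤ hits C f
    many {C} I⊑C = subst (ℕ._≤ hits C f) (trans (sym ∣ T ∣≡size) ∣T∣≡t) (∑ℕ-mono pointwise)
      where
      pointwise : ∀ i → 𝟙 (Vec.lookup T i) ℕ.≤ 𝟙 (C (f i))
      pointwise i with Vec.lookup T i in i∈T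
      ... | false = ℕ.z≤n
      ... | true  = ℕP.≤-reflexive (cong 𝟙 (sym (I⊑C (f i) (image-intro f (Vec.lookup T) i i∈T))))
    hit : Any (λ C → t ℕ.≤ hits C f) sets
    hit = Any.map many (covers I I-ind λ _ _ → refl)

  -- Inequalities for powers and the finite Ramsey bound.

  bernoulli : ∀ x k → x ℕ.^ suc k ℕ.+ suc k ℕ.* x ℕ.^ k ℕ.≤ suc x ℕ.^ suc k
  bernoulli x zero    = ℕP.≤-reflexive (ℕP.+-comm (x ℕ.* 1) 1)
  bernoulli x (suc k) = begin
    x ℕ.* (x ℕ.* z) ℕ.+ suc (suc k) ℕ.* (x ℕ.* z)
      ≤⟨ ℕP.m≤m+n _ (suc k ℕ.* z) ⟩
    x ℕ.* (x ℕ.* z) ℕ.+ suc (suc k) ℕ.* (x ℕ.* z) ℕ.+ suc k ℕ.* z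
      ≡⟨ ℕS.solve 3 (λ x z k → x ℕS.:* (x ℕS.:* z) ℕS.:+ (ℕS.con 1 ℕS.:+ k) ℕS.:* (x ℕS.:* z) ℕS.:+ k ℕS.:* z
           ℕS.:= (ℕS.con 1 ℕS.:+ x) ℕS.:* (x ℕS.:* z ℕS.:+ k ℕS.:* z)) refl x z (suc k) ⟩
    suc x ℕ.* (x ℕ.* z ℕ.+ suc k ℕ.* z)
      ≤⟨ ℕP.*-monoʳ-≤ (suc x) (bernoulli x k) ⟩
    suc x ℕ.* suc x ℕ.^ suc k ∎
    where
    open ℕP.≤-Reasoning
    z = x ℕ.^ k

  2*g^≤ : ∀ g → 2 ℕ.* g ℕ.^ suc g ℕ.≤ suc g ℕ.^ suc g
  2*g^≤ g = begin
    2 ℕ.* g ℕ.^ suc g                       ≡⟨ cong (g ℕ.^ suc g ℕ.+_) (ℕP.+-identityʳ _) ⟩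
    g ℕ.^ suc g ℕ.+ g ℕ.* g ℕ.^ g           ≤⟨ ℕP.+-monoʳ-≤ (g ℕ.^ suc g) (ℕP.*-monoˡ-≤ (g ℕ.^ g) (ℕP.n≤1+n g)) ⟩
    g ℕ.^ suc g ℕ.+ suc g ℕ.* g ℕ.^ g       ≤⟨ bernoulli g g ⟩
    suc g ℕ.^ suc g                         ∎
    where open ℕP.≤-Reasoning

  -- Explains q = (g + 1)L in `ramsey-lower`: that many reductions by g/(g+1) bring any size up to
  -- 2^L down to 1.
  2^*g^≤ : ∀ g L → 2 ℕ.^ L ℕ.* g ℕ.^ (suc g ℕ.* L) ℕ.≤ suc g ℕ.^ (suc g ℕ.* L)
  2^*g^≤ g L = begin
    2 ℕ.^ L ℕ.* g ℕ.^ (suc g ℕ.* L)       ≡⟨ cong (2 ℕ.^ L ℕ.*_) (sym (ℕP.^-*-assoc g (suc g) L)) ⟩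
    2 ℕ.^ L ℕ.* (g ℕ.^ suc g) ℕ.^ L       ≡⟨ sym (*-^ 2 (g ℕ.^ suc g) L) ⟩
    (2 ℕ.* g ℕ.^ suc g) ℕ.^ L             ≤⟨ ℕP.^-monoˡ-≤ L (2*g^≤ g) ⟩
    (suc g ℕ.^ suc g) ℕ.^ L               ≡⟨ ℕP.^-*-assoc (suc g) (suc g) L ⟩
    suc g ℕ.^ (suc g ℕ.* L)               ∎
    where open ℕP.≤-Reasoning

  -- Bernoulli's inequality (1 - 1/(b+1))^j ≥ 1 - j/(b+1), cleared of denominators, with i for b + 1
  -- - j to avoid subtraction.
  ^-decay : ∀ b j i → j ℕ.+ i ≡ suc b → suc b ℕ.^ j ℕ.* i ℕ.≤ suc b ℕ.* b ℕ.^ j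
  ^-decay b zero    i refl = ℕP.≤-reflexive (ℕP.*-comm 1 (suc b))
  ^-decay b (suc j) i e = begin
    suc b ℕ.* B ℕ.* i           ≡⟨ ℕS.solve 3 (λ b B i → b ℕS.:* B ℕS.:* i ℕS.:= B ℕS.:* (b ℕS.:* i)) refl (suc b) B i ⟩
    B ℕ.* (suc b ℕ.* i)
      ≤⟨ ℕP.*-monoʳ-≤ B (ℕP.≤-trans (ℕP.+-monoˡ-≤ (b ℕ.* i)
           (subst (i ℕ.≤_) (ℕP.suc-injective e) (ℕP.m≤n+m i j))) (ℕP.≤-reflexive (sym (ℕP.*-suc b i)))) ⟩
    B ℕ.* (b ℕ.* suc i)         ≡⟨ ℕS.solve 3 (λ b B i → B ℕS.:* (b ℕS.:* i) ℕS.:= b ℕS.:* (B ℕS.:* i)) refl b B (suc i) ⟩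
    b ℕ.* (B ℕ.* suc i)         ≤⟨ ℕP.*-monoʳ-≤ b (^-decay b j (suc i) (trans (ℕP.+-suc j i) e)) ⟩
    b ℕ.* (suc b ℕ.* b ℕ.^ j)   ≡⟨ ℕS.solve 3 (λ b c B → b ℕS.:* (c ℕS.:* B) ℕS.:= c ℕS.:* (b ℕS.:* B)) refl b (suc b) (b ℕ.^ j) ⟩
    suc b ℕ.* b ℕ.^ suc j       ∎
    where
    open ℕP.≤-Reasoning
    B = suc b ℕ.^ j

  -- (1 + 1/(2b)) ^ (2b) ≤ 4, by squaring (1 - 1/(2b+1)) ^ b ≥ 1/2.
  ^≤4*^ : ∀ b → suc (b ℕ.+ b) ℕ.^ (b ℕ.+ b) ℕ.≤ 4 ℕ.* (b ℕ.+ b) ℕ.^ (b ℕ.+ b)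
  ^≤4*^ b = begin
    suc c ℕ.^ (b ℕ.+ b)                     ≡⟨ ℕP.^-distribˡ-+-* (suc c) b b ⟩
    suc c ℕ.^ b ℕ.* suc c ℕ.^ b             ≤⟨ ℕP.*-mono-≤ half half ⟩
    2 ℕ.* c ℕ.^ b ℕ.* (2 ℕ.* c ℕ.^ b)
      ≡⟨ ℕS.solve 1 (λ x → ℕS.con 2 ℕS.:* x ℕS.:* (ℕS.con 2 ℕS.:* x) ℕS.:= ℕS.con 4 ℕS.:* (x ℕS.:* x)) refl (c ℕ.^ b) ⟩
    4 ℕ.* (c ℕ.^ b ℕ.* c ℕ.^ b)             ≡⟨ cong (4 ℕ.*_) (sym (ℕP.^-distribˡ-+-* c b b)) ⟩
    4 ℕ.* c ℕ.^ (b ℕ.+ b)                   ∎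
    where
    open ℕP.≤-Reasoning
    c = b ℕ.+ b
    half : suc c ℕ.^ b ℕ.≤ 2 ℕ.* c ℕ.^ b
    half = ℕP.*-cancelʳ-≤ (suc c ℕ.^ b) (2 ℕ.* c ℕ.^ b) (suc b) (begin
      suc c ℕ.^ b ℕ.* suc b           ≤⟨ ^-decay c b (suc b) (ℕP.+-suc b b) ⟩
      suc c ℕ.* c ℕ.^ b
        ≤⟨ ℕP.*-monoˡ-≤ (c ℕ.^ b) (ℕ.s≤s (ℕP.+-monoʳ-≤ b (ℕP.n≤1+n b))) ⟩
      (suc b ℕ.+ suc b) ℕ.* c ℕ.^ b
        ≡⟨ ℕS.solve 2 (λ b x → (b ℕS.:+ b) ℕS.:* x ℕS.:= ℕS.con 2 ℕS.:* x ℕS.:* b) refl (suc b) (c ℕ.^ b) ⟩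
      2 ℕ.* c ℕ.^ b ℕ.* suc b         ∎)

  -- With c = 2(b + 1), w/N ≤ 1/c gives (1 + w/N)^c ≤ (1 + 1/c)^c ≤ 4. So c further vertices of the
  -- random map cost at most a factor 4 in the bound on the weight.
  growth-step : ∀ b {N w} → (suc b ℕ.+ suc b) ℕ.* w ℕ.≤ N →
    (N ℕ.+ w) ℕ.^ (suc b ℕ.+ suc b) ℕ.≤ 4 ℕ.* N ℕ.^ (suc b ℕ.+ suc b)
  growth-step b {N} {w} h = ℕP.*-cancelˡ-≤ (c ℕ.^ c) {{ℕP.m^n≢0 c c}} (begin
    c ℕ.^ c ℕ.* (N ℕ.+ w) ℕ.^ c     ≡⟨ sym (*-^ c (N ℕ.+ w) c) ⟩
    (c ℕ.* (N ℕ.+ w)) ℕ.^ c         ≤⟨ ℕP.^-monoˡ-≤ c widen ⟩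
    (suc c ℕ.* N) ℕ.^ c             ≡⟨ *-^ (suc c) N c ⟩
    suc c ℕ.^ c ℕ.* N ℕ.^ c         ≤⟨ ℕP.*-monoˡ-≤ (N ℕ.^ c) (^≤4*^ (suc b)) ⟩
    4 ℕ.* c ℕ.^ c ℕ.* N ℕ.^ c
      ≡⟨ ℕS.solve 2 (λ x y → ℕS.con 4 ℕS.:* x ℕS.:* y ℕS.:= x ℕS.:* (ℕS.con 4 ℕS.:* y)) refl (c ℕ.^ c) (N ℕ.^ c) ⟩
    c ℕ.^ c ℕ.* (4 ℕ.* N ℕ.^ c)     ∎)
    where
    open ℕP.≤-Reasoning
    c = suc b ℕ.+ suc b
    widen : c ℕ.* (N ℕ.+ w) ℕ.≤ suc c ℕ.* N
    widen = begin
      c ℕ.* (N ℕ.+ w)         ≡⟨ ℕP.*-distribˡ-+ c N w ⟩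
      c ℕ.* N ℕ.+ c ℕ.* w     ≤⟨ ℕP.+-monoʳ-≤ (c ℕ.* N) h ⟩
      c ℕ.* N ℕ.+ N           ≡⟨ ℕP.+-comm (c ℕ.* N) N ⟩
      suc c ℕ.* N             ∎

  -- The exponent r is padded to c j, which is harmless because N ≤ N + w; the power then splits
  -- into j blocks of length c.
  growth : ∀ b {n w} → (suc b ℕ.+ suc b) ℕ.* w ℕ.≤ suc n → ∀ j r → r ℕ.≤ (suc b ℕ.+ suc b) ℕ.* j →
    (suc n ℕ.+ w) ℕ.^ r ℕ.≤ suc n ℕ.^ r ℕ.* 2 ℕ.^ (2 ℕ.* j)
  growth b {n} {w} h j r r≤ = ℕP.*-cancelʳ-≤ (X ℕ.^ r) (N ℕ.^ r ℕ.* 2 ℕ.^ (2 ℕ.* j)) (N ℕ.^ i) {{ℕP.m^n≢0 N i}} (begin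
    X ℕ.^ r ℕ.* N ℕ.^ i             ≤⟨ ℕP.*-monoʳ-≤ (X ℕ.^ r) (ℕP.^-monoˡ-≤ i (ℕP.m≤m+n N w)) ⟩
    X ℕ.^ r ℕ.* X ℕ.^ i             ≡⟨ trans (sym (ℕP.^-distribˡ-+-* X r i)) (cong (X ℕ.^_) r+i) ⟩
    X ℕ.^ (c ℕ.* j)                 ≡⟨ sym (ℕP.^-*-assoc X c j) ⟩
    (X ℕ.^ c) ℕ.^ j                 ≤⟨ ℕP.^-monoˡ-≤ j (growth-step b h) ⟩
    (4 ℕ.* N ℕ.^ c) ℕ.^ j           ≡⟨ *-^ 4 (N ℕ.^ c) j ⟩
    4 ℕ.^ j ℕ.* (N ℕ.^ c) ℕ.^ j     ≡⟨ cong₂ ℕ._*_ (ℕP.^-*-assoc 2 2 j) (trans (ℕP.^-*-assoc N c j) (cong (N ℕ.^_) (sym r+i))) ⟩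
    2 ℕ.^ (2 ℕ.* j) ℕ.* N ℕ.^ (r ℕ.+ i) ≡⟨ cong (2 ℕ.^ (2 ℕ.* j) ℕ.*_) (ℕP.^-distribˡ-+-* N r i) ⟩
    2 ℕ.^ (2 ℕ.* j) ℕ.* (N ℕ.^ r ℕ.* N ℕ.^ i)
      ≡⟨ ℕS.solve 3 (λ x y z → x ℕS.:* (y ℕS.:* z) ℕS.:= y ℕS.:* x ℕS.:* z) refl (2 ℕ.^ (2 ℕ.* j)) (N ℕ.^ r) (N ℕ.^ i) ⟩
    N ℕ.^ r ℕ.* 2 ℕ.^ (2 ℕ.* j) ℕ.* N ℕ.^ i ∎)
    where
    open ℕP.≤-Reasoning
    N = suc n
    X = suc n ℕ.+ w
    c = suc b ℕ.+ suc b
    i = c ℕ.* j ℕ.∸ r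
    r+i : r ℕ.+ i ≡ c ℕ.* j
    r+i = ℕP.m+[n∸m]≡n r≤

  -- With N = n + 1 there are at most (N + 1)^q ≤ 2^(Lq) containers, and r ≤ 2(b + 1)j vertices
  -- raise the bound on their total weight by at most 2^(2j). The product is below 2^t, so `¬Forces`
  -- would apply.
  ramsey-lower : ∀ {n s t r R g} (G : Graph (suc n)) → K[ s ]-Free G → Dense G R (suc g) → 1 ℕ.≤ R →
    ∀ L b j → suc (suc n) ℕ.≤ 2 ℕ.^ L →
    (suc b ℕ.+ suc b) ℕ.* (R ℕ.+ suc g ℕ.* L) ℕ.≤ suc n →
    L ℕ.* (suc g ℕ.* L) ℕ.+ 2 ℕ.* j ℕ.< t →
    Forces s t r → (suc b ℕ.+ suc b) ℕ.* j ℕ.< r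
  ramsey-lower {n} {s} {t} {r} {R} {g} G free dense 1≤R L b j N<2^L width<N room forces =
    ℕP.≰⇒> λ r≤ → ¬Forces G free (containers G dense (suc n) q (λ _ → true)
      (ℕP.≤-reflexive (size-full (suc n))) initial) (fewer r≤) forces
    where
    q = suc g ℕ.* L
    open ℕP.≤-Reasoning
    initial : size {suc n} (λ _ → true) ℕ.* g ℕ.^ q ℕ.≤ R ℕ.* suc g ℕ.^ q
    initial = begin
      size {suc n} (λ _ → true) ℕ.* g ℕ.^ q  ≡⟨ cong (ℕ._* g ℕ.^ q) (size-full (suc n)) ⟩
      suc n ℕ.* g ℕ.^ q      ≤⟨ ℕP.*-monoˡ-≤ (g ℕ.^ q) (ℕP.≤-trans (ℕP.n≤1+n (suc n)) N<2^L) ⟩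
      2 ℕ.^ L ℕ.* g ℕ.^ q    ≤⟨ 2^*g^≤ g L ⟩
      suc g ℕ.^ q            ≡⟨ sym (ℕP.*-identityˡ _) ⟩
      1 ℕ.* suc g ℕ.^ q      ≤⟨ ℕP.*-monoˡ-≤ (suc g ℕ.^ q) 1≤R ⟩
      R ℕ.* suc g ℕ.^ q      ∎
    fewer : r ℕ.≤ (suc b ℕ.+ suc b) ℕ.* j →
      (suc n ℕ.+ (R ℕ.+ q)) ℕ.^ r ℕ.* suc (suc n) ℕ.^ q ℕ.< suc n ℕ.^ r ℕ.* 2 ℕ.^ t
    fewer r≤ = begin-strict
      (suc n ℕ.+ (R ℕ.+ q)) ℕ.^ r ℕ.* suc (suc n) ℕ.^ q
        ≤⟨ ℕP.*-mono-≤ (growth b width<N j r r≤) (ℕP.^-monoˡ-≤ q N<2^L) ⟩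
      suc n ℕ.^ r ℕ.* 2 ℕ.^ (2 ℕ.* j) ℕ.* (2 ℕ.^ L) ℕ.^ q
        ≡⟨ trans (ℕP.*-assoc (suc n ℕ.^ r) _ _) (cong (suc n ℕ.^ r ℕ.*_) (trans
             (cong (2 ℕ.^ (2 ℕ.* j) ℕ.*_) (ℕP.^-*-assoc 2 L q))
             (trans (sym (ℕP.^-distribˡ-+-* 2 (2 ℕ.* j) (L ℕ.* q))) (cong (2 ℕ.^_) (ℕP.+-comm (2 ℕ.* j) (L ℕ.* q)))))) ⟩
      suc n ℕ.^ r ℕ.* 2 ℕ.^ (L ℕ.* q ℕ.+ 2 ℕ.* j)
        <⟨ ℕP.*-monoʳ-< (suc n ℕ.^ r) {{ℕP.m^n≢0 (suc n) r}} (ℕP.^-monoʳ-< 2 (ℕ.s≤s (ℕ.s≤s ℕ.z≤n)) room) ⟩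
      suc n ℕ.^ r ℕ.* 2 ℕ.^ t ∎

-- Choice of parameters and the asymptotic bound.

module Asymptotics where
  open import Data.Rational.Base using (_+_; _*_; -_; _-_; ∣_∣; _≤_; _<_)
  open ℚSolver.+-*-Solver using (solve; _:=_; _:+_; _:*_; _:-_; :-_; con)
  open QuadraticForm
  open Spectrum
  open IndependentSets

  m<[1+m/n]*n : ∀ m n .{{_ : ℕ.NonZero n}} → m ℕ.< suc (m / n) ℕ.* n
  m<[1+m/n]*n m n = subst (ℕ._< suc (m / n) ℕ.* n) (sym (m≡m%n+[m/n]*n m n))
    (ℕP.+-monoˡ-< (m / n ℕ.* n) (m%n<n m n))

  m*n≤o⇒m≤o/n : ∀ m n o .{{_ : ℕ.NonZero n}} → m ℕ.* n ℕ.≤ o → m ℕ.≤ o / n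
  m*n≤o⇒m≤o/n m n o h = subst (ℕ._≤ o / n) (m*n/n≡m m n) (/-monoˡ-≤ n h)

  suc≤2^ : ∀ x → suc x ℕ.≤ 2 ℕ.^ x
  suc≤2^ zero    = ℕP.≤-refl
  suc≤2^ (suc x) = ℕP.≤-trans (ℕP.+-mono-≤ (ℕP.m^n>0 2 x) (suc≤2^ x))
    (ℕP.≤-reflexive (cong (2 ℕ.^ x ℕ.+_) (sym (ℕP.+-identityʳ (2 ℕ.^ x)))))

  -- For x = ⌊ℓ/4⌋ one has ℓ ≤ 4(x + 1) ≤ 4·2^x, and the fourth power turns 2^x into at most 2^ℓ.
  ^4≤ : ∀ ℓ → ℓ ℕ.^ 4 ℕ.≤ 256 ℕ.* 2 ℕ.^ ℓ
  ^4≤ ℓ = begin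
    ℓ ℕ.^ 4                     ≤⟨ ℕP.^-monoˡ-≤ 4 ℓ≤ ⟩
    (suc x ℕ.* 4) ℕ.^ 4         ≡⟨ *-^ (suc x) 4 4 ⟩
    suc x ℕ.^ 4 ℕ.* 256         ≡⟨ ℕP.*-comm (suc x ℕ.^ 4) 256 ⟩
    256 ℕ.* suc x ℕ.^ 4         ≤⟨ ℕP.*-monoʳ-≤ 256 (ℕP.^-monoˡ-≤ 4 (suc≤2^ x)) ⟩
    256 ℕ.* (2 ℕ.^ x) ℕ.^ 4     ≡⟨ cong (256 ℕ.*_) (ℕP.^-*-assoc 2 x 4) ⟩
    256 ℕ.* 2 ℕ.^ (x ℕ.* 4)     ≤⟨ ℕP.*-monoʳ-≤ 256 (ℕP.^-monoʳ-≤ 2 (m/n*n≤m ℓ 4)) ⟩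
    256 ℕ.* 2 ℕ.^ ℓ             ∎
    where
    open ℕP.≤-Reasoning
    x = ℓ / 4
    ℓ≤ : ℓ ℕ.≤ suc x ℕ.* 4
    ℓ≤ = ℕP.<⇒≤ (m<[1+m/n]*n ℓ 4)

  -- Applied with Z = MQ, it makes the quotient ⌊t / (Qℓ²)⌋ at least Mℓ. The 512 is the 256 of `^4≤`
  -- times the 2 of 2^ℓ ≤ 2t.
  cube-bound : ∀ Z ℓ t → 512 ℕ.* Z ℕ.≤ ℓ → 2 ℕ.^ ℓ ℕ.≤ 2 ℕ.* t → Z ℕ.* ℓ ℕ.^ 3 ℕ.≤ t
  cube-bound Z ℓ t Z≤ℓ 2^ℓ≤ = ℕP.*-cancelˡ-≤ 512 (begin
    512 ℕ.* (Z ℕ.* ℓ ℕ.^ 3)     ≡⟨ sym (ℕP.*-assoc 512 Z (ℓ ℕ.^ 3)) ⟩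
    512 ℕ.* Z ℕ.* ℓ ℕ.^ 3       ≤⟨ ℕP.*-monoˡ-≤ (ℓ ℕ.^ 3) Z≤ℓ ⟩
    ℓ ℕ.^ 4                     ≤⟨ ^4≤ ℓ ⟩
    256 ℕ.* 2 ℕ.^ ℓ             ≤⟨ ℕP.*-monoʳ-≤ 256 2^ℓ≤ ⟩
    256 ℕ.* (2 ℕ.* t)           ≡⟨ sym (ℕP.*-assoc 256 2 t) ⟩
    512 ℕ.* t                   ∎)
    where open ℕP.≤-Reasoning

  binary-length : ∀ u → ∃[ i ] 2 ℕ.^ i ℕ.≤ suc u × suc u ℕ.< 2 ℕ.^ suc i
  binary-length zero = 0 , ℕP.≤-refl , ℕP.≤-refl
  binary-length (suc u) with binary-length u
  ... | i , lo , hi with suc (suc u) ℕP.<? 2 ℕ.^ suc i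
  ... | yes hi′ = i , ℕP.≤-trans lo (ℕP.n≤1+n (suc u)) , hi′
  ... | no ¬hi  = suc i , ℕP.≮⇒≥ ¬hi , ℕP.≤-<-trans hi
    (ℕP.^-monoʳ-< 2 (ℕ.s≤s (ℕ.s≤s ℕ.z≤n)) (ℕP.n<1+n (suc i)))

  harmonic-mono : ∀ {m n} → m ℕ.≤ n → harmonic m ≤ harmonic n
  harmonic-mono {m} {n} m≤n = subst (λ z → harmonic m ≤ harmonic z) (ℕP.m+[n∸m]≡n m≤n) (go (n ℕ.∸ m))
    where
    go : ∀ r → harmonic m ≤ harmonic (m ℕ.+ r)
    go zero    = ℚP.≤-reflexive (cong harmonic (sym (ℕP.+-identityʳ m)))
    go (suc r) = subst (λ z → harmonic m ≤ harmonic z) (sym (ℕP.+-suc m r))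
      (ℚP.≤-trans (go r) (subst (_≤ harmonic (suc (m ℕ.+ r))) (ℚP.+-identityʳ (harmonic (m ℕ.+ r)))
        (ℚP.+-monoʳ-≤ (harmonic (m ℕ.+ r)) (0≤frac 1 (m ℕ.+ r)))))

  harmonic-double : ∀ K → harmonic (suc K) + ½ ≤ harmonic (suc K ℕ.+ suc K)
  harmonic-double K = subst (λ z → harmonic (suc K) + z ≤ harmonic (suc K ℕ.+ suc K))
    (frac-≡ {suc K} {K ℕ.+ suc K} {1} {1} (trans (ℕP.*-comm (suc K) 2) (trans
      (cong (suc K ℕ.+_) (ℕP.+-identityʳ (suc K))) (sym (ℕP.+-identityʳ _)))))
    (block-lower (K ℕ.+ suc K) (suc K) (suc K) ℕP.≤-refl)

  -- Each doubling of the argument adds at least ½, a rational substitute for log 2. The bound is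
  -- uniform in `m`, so it holds for every approximant of the logarithm.
  harmonic-2^ : ∀ i m → harmonic (suc m) + ι i * ½ ≤ harmonic (2 ℕ.^ i ℕ.* suc m)
  harmonic-2^ zero m = ℚP.≤-reflexive (trans (cong (harmonic (suc m) +_) (ℚP.*-zeroˡ ½))
    (trans (ℚP.+-identityʳ (harmonic (suc m))) (cong harmonic (sym (ℕP.+-identityʳ (suc m))))))
  harmonic-2^ (suc i) m = begin
    harmonic (suc m) + ι (suc i) * ½         ≡⟨ cong (λ z → harmonic (suc m) + z * ½) (ι-suc i) ⟩
    harmonic (suc m) + (ι i + 1ℚ) * ½
      ≡⟨ solve 3 (λ h i c → h :+ (i :+ con 1ℚ) :* c := h :+ i :* c :+ c) refl (harmonic (suc m)) (ι i) ½ ⟩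
    harmonic (suc m) + ι i * ½ + ½           ≤⟨ ℚP.+-monoˡ-≤ ½ (harmonic-2^ i m) ⟩
    harmonic (2 ℕ.^ i ℕ.* suc m) + ½         ≤⟨ double (2 ℕ.^ i ℕ.* suc m) (ℕP.*-mono-≤ (ℕP.m^n>0 2 i) (ℕ.s≤s ℕ.z≤n)) ⟩
    harmonic (2 ℕ.^ i ℕ.* suc m ℕ.+ 2 ℕ.^ i ℕ.* suc m)
      ≡⟨ cong harmonic (ℕS.solve 2 (λ x y → x ℕS.:* y ℕS.:+ x ℕS.:* y ℕS.:= ℕS.con 2 ℕS.:* x ℕS.:* y) refl (2 ℕ.^ i) (suc m)) ⟩
    harmonic (2 ℕ.^ suc i ℕ.* suc m)         ∎
    where
    open ℚP.≤-Reasoning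
    double : ∀ K → 1 ℕ.≤ K → harmonic K + ½ ≤ harmonic (K ℕ.+ K)
    double (suc K) _ = harmonic-double K

  logSeq-lower : ∀ i t m → 2 ℕ.^ i ℕ.≤ t → ι i * ½ ≤ logSeq t m
  logSeq-lower i t m 2^i≤t = subst (_≤ logSeq t m)
    (solve 2 (λ h x → h :+ x :- h := x) refl (harmonic (suc m)) (ι i * ½))
    (ℚP.+-monoˡ-≤ (- harmonic (suc m)) (ℚP.≤-trans (harmonic-2^ i m)
      (harmonic-mono (ℕP.*-monoˡ-≤ (suc m) 2^i≤t))))

  -- Positive numbers enter through inequalities and not as successors, so that compound expressions
  -- can be substituted for them.
  finite-bound : ∀ N g b {s t r R d y} (G : Graph N) → 1 ℕ.≤ N → 1 ℕ.≤ g → 1 ℕ.≤ b →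
    K[ s ]-Free G → (∀ i → degree G i ≡ d) → (∀ v → - ι y * (v · v) ≤ v · (adjℚ G ⊛ v)) →
    1 ℕ.≤ d → 2 ℕ.* N ℕ.≤ d ℕ.* g → (∀ u → R ℕ.< u → 2 ℕ.* y ℕ.* N ℕ.≤ d ℕ.* u) → 1 ℕ.≤ R →
    ∀ L j → suc N ℕ.≤ 2 ℕ.^ L → (b ℕ.+ b) ℕ.* (R ℕ.+ g ℕ.* L) ℕ.≤ N →
    L ℕ.* (g ℕ.* L) ℕ.+ 2 ℕ.* j ℕ.< t → Forces s t r → (b ℕ.+ b) ℕ.* j ℕ.< r
  finite-bound (suc n) (suc g) (suc b) {y = y} G _ _ _ free regular form 1≤d 2N≤dg threshold 1≤R L j =
    ramsey-lower {g = g} G free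
      (dense {y = y} {g = suc g} G 1≤d 2N≤dg threshold (mixing {y = y} G regular form)) 1≤R L b j

  square-cancel-≤ : ∀ x y → x ℕ.* x ℕ.≤ y ℕ.* y → x ℕ.≤ y
  square-cancel-≤ x y h = ℕP.≮⇒≥ λ y<x → ℕP.<⇒≱ (ℕP.*-mono-< y<x y<x) h

  ^-self : ∀ x k → 1 ℕ.≤ k → 1 ℕ.≤ x → x ℕ.≤ x ℕ.^ k
  ^-self x (suc k) _ 1≤x = ℕP.m≤m*n x (x ℕ.^ k) {{ℕP.m^n≢0 x k {{ℕ.>-nonZero 1≤x}}}}

  -- Up to rounding, e is t / (Q ℓ²) and ℓ is log₂ t; the constant P is chosen for
  -- 64 b² W ≤ d, and Q for 2 g L² ≤ t.
  module Parameters {s σ p W P Q : ℕ} (1≤σ : 1 ℕ.≤ σ) (1≤p : 1 ℕ.≤ p) (1≤W : 1 ℕ.≤ W)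
    (P≡ : P ≡ 64 ℕ.* (W ℕ.* p))
    (Q≡ : Q ≡ 16 ℕ.* (p ℕ.* P ℕ.* (suc (σ ℕ.+ σ) ℕ.* suc (σ ℕ.+ σ))))
    {e ℓ t r d y : ℕ} (G : Graph ((P ℕ.* e) ℕ.^ suc (σ ℕ.+ σ))) (free : K[ s ]-Free G)
    (regular : ∀ i → degree G i ≡ d) (form : ∀ v → - ι y * (v · v) ≤ v · (adjℚ G ⊛ v))
    (y²≤Wd : y ℕ.^ 2 ℕ.≤ W ℕ.* d) (a^≤pd : (P ℕ.* e) ℕ.^ (σ ℕ.+ σ) ℕ.≤ p ℕ.* d)
    (1≤ℓ : 1 ℕ.≤ ℓ) (P≤e : P ℕ.≤ e) (L≤e : (ℓ ℕ.+ ℓ) ℕ.* suc (σ ℕ.+ σ) ℕ.≤ e)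
    (eQℓ²≤t : e ℕ.* (Q ℕ.* (ℓ ℕ.* ℓ)) ℕ.≤ t) (t<eQℓ² : t ℕ.< suc e ℕ.* (Q ℕ.* (ℓ ℕ.* ℓ)))
    (t<2^ℓ : t ℕ.< 2 ℕ.^ ℓ) (8≤t : 8 ℕ.≤ t) (forces : Forces s t r) where

    open ℕP.≤-Reasoning
    k a N g b L j : ℕ
    k = suc (σ ℕ.+ σ)
    a = P ℕ.* e
    N = a ℕ.^ k
    g = 2 ℕ.* (p ℕ.* a)
    b = e ℕ.^ σ
    L = (ℓ ℕ.+ ℓ) ℕ.* k
    j = t / 8

    1≤Wp : 1 ℕ.≤ W ℕ.* p
    1≤Wp = ℕP.*-mono-≤ 1≤W 1≤p
    1≤P : 1 ℕ.≤ P
    1≤P = subst (1 ℕ.≤_) (sym P≡) (ℕP.*-mono-≤ (ℕ.s≤s {0} {63} ℕ.z≤n) 1≤Wp)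
    1≤e : 1 ℕ.≤ e
    1≤e = ℕP.≤-trans 1≤P P≤e
    1≤a : 1 ℕ.≤ a
    1≤a = ℕP.*-mono-≤ 1≤P 1≤e
    e≤a : e ℕ.≤ a
    e≤a = ℕP.m≤n*m e P {{ℕ.>-nonZero 1≤P}}
    1≤x^ : ∀ {x} i → 1 ℕ.≤ x → 1 ℕ.≤ x ℕ.^ i
    1≤x^ i 1≤x = ℕP.m^n>0 _ {{ℕ.>-nonZero 1≤x}} i
    1≤Q : 1 ℕ.≤ Q
    1≤Q = subst (1 ℕ.≤_) (sym Q≡)
      (ℕP.*-mono-≤ (ℕ.s≤s {0} {15} ℕ.z≤n) (ℕP.*-mono-≤ (ℕP.*-mono-≤ 1≤p 1≤P) (ℕP.*-mono-≤ {1} {k} (ℕ.s≤s ℕ.z≤n) (ℕ.s≤s {0} ℕ.z≤n))))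
    1≤Qℓ² : 1 ℕ.≤ Q ℕ.* (ℓ ℕ.* ℓ)
    1≤Qℓ² = ℕP.*-mono-≤ 1≤Q (ℕP.*-mono-≤ 1≤ℓ 1≤ℓ)
    1≤d : 1 ℕ.≤ d
    1≤d = ℕP.n≢0⇒n>0 λ d≡0 → ℕP.<⇒≱ (1≤x^ (σ ℕ.+ σ) 1≤a)
      (ℕP.≤-trans a^≤pd (ℕP.≤-reflexive (trans (cong (p ℕ.*_) d≡0) (ℕP.*-zeroʳ p))))

    2N≤dg : 2 ℕ.* N ℕ.≤ d ℕ.* g
    2N≤dg = begin
      2 ℕ.* (a ℕ.* a ℕ.^ (σ ℕ.+ σ))  ≤⟨ ℕP.*-monoʳ-≤ 2 (ℕP.*-monoʳ-≤ a a^≤pd) ⟩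
      2 ℕ.* (a ℕ.* (p ℕ.* d))
        ≡⟨ ℕS.solve 3 (λ a p d → ℕS.con 2 ℕS.:* (a ℕS.:* (p ℕS.:* d)) ℕS.:= d ℕS.:* (ℕS.con 2 ℕS.:* (p ℕS.:* a))) refl a p d ⟩
      d ℕ.* g                        ∎

    -- P = 64Wp and P ≤ P^(2σ) give 64Wp e^(2σ) ≤ a^(2σ) ≤ pd, and p cancels.
    64b²W≤d : 64 ℕ.* (b ℕ.* b) ℕ.* W ℕ.≤ d
    64b²W≤d = ℕP.*-cancelˡ-≤ p {{ℕ.>-nonZero 1≤p}} (begin
      p ℕ.* (64 ℕ.* (b ℕ.* b) ℕ.* W)
        ≡⟨ ℕS.solve 4 (λ p c x w → p ℕS.:* (c ℕS.:* x ℕS.:* w) ℕS.:= c ℕS.:* (w ℕS.:* p) ℕS.:* x) refl p 64 (b ℕ.* b) W ⟩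
      64 ℕ.* (W ℕ.* p) ℕ.* (b ℕ.* b)
        ≡⟨ cong₂ ℕ._*_ (sym P≡) (sym (ℕP.^-distribˡ-+-* e σ σ)) ⟩
      P ℕ.* e ℕ.^ (σ ℕ.+ σ)
        ≤⟨ ℕP.*-monoˡ-≤ (e ℕ.^ (σ ℕ.+ σ)) (^-self P (σ ℕ.+ σ) (ℕP.≤-trans 1≤σ (ℕP.m≤m+n σ σ)) 1≤P) ⟩
      P ℕ.^ (σ ℕ.+ σ) ℕ.* e ℕ.^ (σ ℕ.+ σ)  ≡⟨ sym (*-^ P e (σ ℕ.+ σ)) ⟩
      a ℕ.^ (σ ℕ.+ σ)                      ≤⟨ a^≤pd ⟩
      p ℕ.* d                              ∎)

    -- Squares are compared because `y` is controlled only through y² ≤ Wd. The outcome is that the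
    -- density threshold 2yN/d is at most N/(4b).
    8by≤d : 8 ℕ.* b ℕ.* y ℕ.≤ d
    8by≤d = square-cancel-≤ (8 ℕ.* b ℕ.* y) d (begin
      8 ℕ.* b ℕ.* y ℕ.* (8 ℕ.* b ℕ.* y)
        ≡⟨ ℕS.solve 2 (λ b y → ℕS.con 8 ℕS.:* b ℕS.:* y ℕS.:* (ℕS.con 8 ℕS.:* b ℕS.:* y)
             ℕS.:= ℕS.con 64 ℕS.:* (b ℕS.:* b) ℕS.:* y ℕS.:^ 2) refl b y ⟩
      64 ℕ.* (b ℕ.* b) ℕ.* y ℕ.^ 2     ≤⟨ ℕP.*-monoʳ-≤ (64 ℕ.* (b ℕ.* b)) y²≤Wd ⟩
      64 ℕ.* (b ℕ.* b) ℕ.* (W ℕ.* d)   ≡⟨ sym (ℕP.*-assoc (64 ℕ.* (b ℕ.* b)) W d) ⟩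
      64 ℕ.* (b ℕ.* b) ℕ.* W ℕ.* d     ≤⟨ ℕP.*-monoˡ-≤ d 64b²W≤d ⟩
      d ℕ.* d                          ∎)

    -- R is the integer part of 2yN/d. The threshold in use is `suc R`, since rounding up also makes
    -- it positive.
    quotient : ∃[ R ] d ℕ.* R ℕ.≤ 2 ℕ.* y ℕ.* N × (∀ u → suc R ℕ.< u → 2 ℕ.* y ℕ.* N ℕ.≤ d ℕ.* u)
    quotient = go d 1≤d
      where
      go : ∀ d → 1 ℕ.≤ d → ∃[ R ] d ℕ.* R ℕ.≤ 2 ℕ.* y ℕ.* N × (∀ u → suc R ℕ.< u → 2 ℕ.* y ℕ.* N ℕ.≤ d ℕ.* u)
      go d@(suc _) _ = (2 ℕ.* y ℕ.* N) / d
        , ℕP.≤-trans (ℕP.≤-reflexive (ℕP.*-comm d _)) (m/n*n≤m (2 ℕ.* y ℕ.* N) d)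
        , λ u R<u → ℕP.≤-trans (ℕP.<⇒≤ (m<[1+m/n]*n (2 ℕ.* y ℕ.* N) d))
            (ℕP.≤-trans (ℕP.≤-reflexive (ℕP.*-comm _ d)) (ℕP.*-monoʳ-≤ d (ℕP.<⇒≤ R<u)))

    16pL≤a : 16 ℕ.* p ℕ.* L ℕ.≤ a
    16pL≤a = ℕP.*-mono-≤ (subst (16 ℕ.* p ℕ.≤_) (sym P≡)
      (ℕP.*-mono-≤ {16} {64} (ℕP.m≤m+n 16 48) (ℕP.m≤n*m p W {{ℕ.>-nonZero 1≤W}}))) L≤e

    -- The number a^(2σ+1) is split as a·a^σ·a^σ: the first factor comes from g, the second bounds b
    -- = e^σ, and the third has room for the logarithmic factor 16pL ≤ a.
    8bgL≤N : 8 ℕ.* b ℕ.* (g ℕ.* L) ℕ.≤ N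
    8bgL≤N = begin
      8 ℕ.* b ℕ.* (2 ℕ.* (p ℕ.* a) ℕ.* L)
        ≡⟨ ℕS.solve 4 (λ b p a l → ℕS.con 8 ℕS.:* b ℕS.:* (ℕS.con 2 ℕS.:* (p ℕS.:* a) ℕS.:* l)
             ℕS.:= a ℕS.:* (b ℕS.:* (ℕS.con 16 ℕS.:* p ℕS.:* l))) refl b p a L ⟩
      a ℕ.* (b ℕ.* (16 ℕ.* p ℕ.* L))
        ≤⟨ ℕP.*-monoʳ-≤ a (ℕP.*-mono-≤ (ℕP.^-monoˡ-≤ σ e≤a) (ℕP.≤-trans 16pL≤a (^-self a σ 1≤σ 1≤a))) ⟩
      a ℕ.* (a ℕ.^ σ ℕ.* a ℕ.^ σ)
        ≡⟨ cong (a ℕ.*_) (sym (ℕP.^-distribˡ-+-* a σ σ)) ⟩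
      N ∎

    1≤gL : 1 ℕ.≤ g ℕ.* L
    1≤gL = ℕP.*-mono-≤ {1} {g} {1} {L}
      (ℕP.*-mono-≤ (ℕ.s≤s {0} {1} ℕ.z≤n) (ℕP.*-mono-≤ 1≤p 1≤a))
      (ℕP.*-mono-≤ {1} {ℓ ℕ.+ ℓ} {1} {k} (ℕP.≤-trans 1≤ℓ (ℕP.m≤m+n ℓ ℓ)) (ℕ.s≤s ℕ.z≤n))

    width : ∀ R → d ℕ.* R ℕ.≤ 2 ℕ.* y ℕ.* N → (b ℕ.+ b) ℕ.* (suc R ℕ.+ g ℕ.* L) ℕ.≤ N
    width R dR≤ = ℕP.*-cancelˡ-≤ 2 (begin
      2 ℕ.* ((b ℕ.+ b) ℕ.* (suc R ℕ.+ g ℕ.* L))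
        ≡⟨ ℕS.solve 3 (λ b r q → ℕS.con 2 ℕS.:* ((b ℕS.:+ b) ℕS.:* (ℕS.con 1 ℕS.:+ r ℕS.:+ q))
             ℕS.:= ℕS.con 4 ℕS.:* b ℕS.:* r ℕS.:+ ℕS.con 4 ℕS.:* b ℕS.:* (ℕS.con 1 ℕS.:+ q)) refl b R (g ℕ.* L) ⟩
      4 ℕ.* b ℕ.* R ℕ.+ 4 ℕ.* b ℕ.* (1 ℕ.+ g ℕ.* L)
        ≤⟨ ℕP.+-mono-≤ 4bR≤N (ℕP.≤-trans
             (ℕP.*-monoʳ-≤ (4 ℕ.* b) (ℕP.+-monoˡ-≤ (g ℕ.* L) 1≤gL))
             (ℕP.≤-trans (ℕP.≤-reflexive (ℕS.solve 2 (λ b q → ℕS.con 4 ℕS.:* b ℕS.:* (q ℕS.:+ q)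
               ℕS.:= ℕS.con 8 ℕS.:* b ℕS.:* q) refl b (g ℕ.* L))) 8bgL≤N)) ⟩
      N ℕ.+ N ≡⟨ cong (N ℕ.+_) (sym (ℕP.+-identityʳ N)) ⟩
      2 ℕ.* N ∎)
      where
      4bR≤N : 4 ℕ.* b ℕ.* R ℕ.≤ N
      4bR≤N = ℕP.*-cancelˡ-≤ d {{ℕ.>-nonZero 1≤d}} (begin
        d ℕ.* (4 ℕ.* b ℕ.* R)
          ≡⟨ ℕS.solve 3 (λ d b r → d ℕS.:* (ℕS.con 4 ℕS.:* b ℕS.:* r) ℕS.:= ℕS.con 4 ℕS.:* b ℕS.:* (d ℕS.:* r)) refl d b R ⟩
        4 ℕ.* b ℕ.* (d ℕ.* R)            ≤⟨ ℕP.*-monoʳ-≤ (4 ℕ.* b) dR≤ ⟩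
        4 ℕ.* b ℕ.* (2 ℕ.* y ℕ.* N)
          ≡⟨ ℕS.solve 3 (λ b y n → ℕS.con 4 ℕS.:* b ℕS.:* (ℕS.con 2 ℕS.:* y ℕS.:* n) ℕS.:= ℕS.con 8 ℕS.:* b ℕS.:* y ℕS.:* n) refl b y N ⟩
        8 ℕ.* b ℕ.* y ℕ.* N              ≤⟨ ℕP.*-monoˡ-≤ N 8by≤d ⟩
        d ℕ.* N                          ∎)

    -- P ≤ e gives a ≤ e², and e ≤ t < 2^ℓ; hence a^k < 2^(2ℓk), which is the origin of L = 2ℓk.
    N<2^L : suc N ℕ.≤ 2 ℕ.^ L
    N<2^L = begin-strict
      a ℕ.^ k                       ≤⟨ ℕP.^-monoˡ-≤ k (ℕP.*-monoˡ-≤ e P≤e) ⟩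
      (e ℕ.* e) ℕ.^ k               <⟨ ℕP.^-monoˡ-< k (ℕP.*-mono-< e<2^ℓ e<2^ℓ) ⟩
      (2 ℕ.^ ℓ ℕ.* 2 ℕ.^ ℓ) ℕ.^ k   ≡⟨ cong (ℕ._^ k) (sym (ℕP.^-distribˡ-+-* 2 ℓ ℓ)) ⟩
      (2 ℕ.^ (ℓ ℕ.+ ℓ)) ℕ.^ k       ≡⟨ ℕP.^-*-assoc 2 (ℓ ℕ.+ ℓ) k ⟩
      2 ℕ.^ L                       ∎
      where
      e<2^ℓ : e ℕ.< 2 ℕ.^ ℓ
      e<2^ℓ = ℕP.≤-<-trans (ℕP.≤-trans (ℕP.m≤m*n e (Q ℕ.* (ℓ ℕ.* ℓ)) {{ℕ.>-nonZero 1≤Qℓ²}}) eQℓ²≤t) t<2^ℓ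

    -- `Q` is made so that L²g = eQℓ²/2 ≤ t/2, while j = ⌊t/8⌋ gives 2j ≤ t/4. Together they leave a
    -- quarter of t.
    room : L ℕ.* (g ℕ.* L) ℕ.+ 2 ℕ.* j ℕ.< t
    room = ℕP.*-cancelˡ-< 4 _ t (begin-strict
      4 ℕ.* (L ℕ.* (g ℕ.* L) ℕ.+ 2 ℕ.* j)
        ≡⟨ ℕS.solve 6 (λ l k p P e j →
             ℕS.con 4 ℕS.:* ((l ℕS.:+ l) ℕS.:* k ℕS.:* (ℕS.con 2 ℕS.:* (p ℕS.:* (P ℕS.:* e)) ℕS.:* ((l ℕS.:+ l) ℕS.:* k)) ℕS.:+ ℕS.con 2 ℕS.:* j)
             ℕS.:= ℕS.con 2 ℕS.:* (e ℕS.:* (ℕS.con 16 ℕS.:* (p ℕS.:* P ℕS.:* (k ℕS.:* k)) ℕS.:* (l ℕS.:* l))) ℕS.:+ j ℕS.:* ℕS.con 8)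
             refl ℓ k p P e j ⟩
      2 ℕ.* (e ℕ.* (16 ℕ.* (p ℕ.* P ℕ.* (k ℕ.* k)) ℕ.* (ℓ ℕ.* ℓ))) ℕ.+ j ℕ.* 8
        ≡⟨ cong (λ z → 2 ℕ.* (e ℕ.* (z ℕ.* (ℓ ℕ.* ℓ))) ℕ.+ j ℕ.* 8) (sym Q≡) ⟩
      2 ℕ.* (e ℕ.* (Q ℕ.* (ℓ ℕ.* ℓ))) ℕ.+ j ℕ.* 8
        ≤⟨ ℕP.+-mono-≤ (ℕP.*-monoʳ-≤ 2 eQℓ²≤t) (m/n*n≤m t 8) ⟩
      2 ℕ.* t ℕ.+ t       ≡⟨ ℕP.+-comm (2 ℕ.* t) t ⟩
      3 ℕ.* t             <⟨ ℕP.*-monoˡ-< t {{ℕ.>-nonZero (ℕP.≤-trans (ℕ.s≤s {0} {7} ℕ.z≤n) 8≤t)}} (ℕP.n<1+n 3) ⟩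
      4 ℕ.* t             ∎)

    2bj<r : (b ℕ.+ b) ℕ.* j ℕ.< r
    2bj<r = go quotient
      where
      go : ∃[ R ] d ℕ.* R ℕ.≤ 2 ℕ.* y ℕ.* N × (∀ u → suc R ℕ.< u → 2 ℕ.* y ℕ.* N ℕ.≤ d ℕ.* u) → (b ℕ.+ b) ℕ.* j ℕ.< r
      go (R , dR≤ , threshold) = finite-bound N g b {R = suc R} {y = y} G (1≤x^ k 1≤a)
        (ℕP.*-mono-≤ (ℕ.s≤s {0} {1} ℕ.z≤n) (ℕP.*-mono-≤ 1≤p 1≤a)) (1≤x^ σ 1≤e)
        free regular form 1≤d 2N≤dg threshold (ℕ.s≤s ℕ.z≤n) L j N<2^L (width R dR≤) room forces

    -- Multiply t ≤ 16j by the σ-th power of t ≤ 2Qℓ²e. The factor e^σ is b, so 2bj appears and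
    -- `2bj<r` applies.
    t^≤ : t ℕ.^ suc σ ℕ.≤ 8 ℕ.* (2 ℕ.* Q) ℕ.^ σ ℕ.* (ℓ ℕ.^ (σ ℕ.+ σ) ℕ.* r)
    t^≤ = begin
      t ℕ.* t ℕ.^ σ
        ≤⟨ ℕP.*-mono-≤ t≤16j (ℕP.^-monoˡ-≤ σ t≤2Qℓ²e) ⟩
      16 ℕ.* j ℕ.* (2 ℕ.* Q ℕ.* (ℓ ℕ.* ℓ) ℕ.* e) ℕ.^ σ
        ≡⟨ cong (16 ℕ.* j ℕ.*_) (trans (*-^ (2 ℕ.* Q ℕ.* (ℓ ℕ.* ℓ)) e σ) (cong (ℕ._* b) (trans (*-^ (2 ℕ.* Q) (ℓ ℕ.* ℓ) σ)
             (cong ((2 ℕ.* Q) ℕ.^ σ ℕ.*_) (trans (*-^ ℓ ℓ σ) (sym (ℕP.^-distribˡ-+-* ℓ σ σ))))))) ⟩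
      16 ℕ.* j ℕ.* ((2 ℕ.* Q) ℕ.^ σ ℕ.* ℓ ℕ.^ (σ ℕ.+ σ) ℕ.* b)
        ≡⟨ ℕS.solve 4 (λ j q l b → ℕS.con 16 ℕS.:* j ℕS.:* (q ℕS.:* l ℕS.:* b) ℕS.:= ℕS.con 8 ℕS.:* q ℕS.:* (l ℕS.:* ((b ℕS.:+ b) ℕS.:* j))) refl
             j ((2 ℕ.* Q) ℕ.^ σ) (ℓ ℕ.^ (σ ℕ.+ σ)) b ⟩
      8 ℕ.* (2 ℕ.* Q) ℕ.^ σ ℕ.* (ℓ ℕ.^ (σ ℕ.+ σ) ℕ.* ((b ℕ.+ b) ℕ.* j))
        ≤⟨ ℕP.*-monoʳ-≤ (8 ℕ.* (2 ℕ.* Q) ℕ.^ σ) (ℕP.*-monoʳ-≤ (ℓ ℕ.^ (σ ℕ.+ σ)) (ℕP.<⇒≤ 2bj<r)) ⟩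
      8 ℕ.* (2 ℕ.* Q) ℕ.^ σ ℕ.* (ℓ ℕ.^ (σ ℕ.+ σ) ℕ.* r) ∎
      where
      1≤j : 1 ℕ.≤ j
      1≤j = m*n≤o⇒m≤o/n 1 8 t 8≤t
      t≤16j : t ℕ.≤ 16 ℕ.* j
      t≤16j = begin
        t               ≤⟨ ℕP.<⇒≤ (m<[1+m/n]*n t 8) ⟩
        suc j ℕ.* 8     ≤⟨ ℕP.*-monoˡ-≤ 8 (ℕP.+-monoˡ-≤ j 1≤j) ⟩
        (j ℕ.+ j) ℕ.* 8 ≡⟨ ℕS.solve 1 (λ j → (j ℕS.:+ j) ℕS.:* ℕS.con 8 ℕS.:= ℕS.con 16 ℕS.:* j) refl j ⟩
        16 ℕ.* j        ∎
      t≤2Qℓ²e : t ℕ.≤ 2 ℕ.* Q ℕ.* (ℓ ℕ.* ℓ) ℕ.* e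
      t≤2Qℓ²e = begin
        t                                    ≤⟨ ℕP.<⇒≤ t<eQℓ² ⟩
        suc e ℕ.* (Q ℕ.* (ℓ ℕ.* ℓ))          ≤⟨ ℕP.*-monoˡ-≤ (Q ℕ.* (ℓ ℕ.* ℓ)) (ℕP.+-monoˡ-≤ e 1≤e) ⟩
        (e ℕ.+ e) ℕ.* (Q ℕ.* (ℓ ℕ.* ℓ))
          ≡⟨ ℕS.solve 3 (λ e q l → (e ℕS.:+ e) ℕS.:* (q ℕS.:* l) ℕS.:= ℕS.con 2 ℕS.:* q ℕS.:* l ℕS.:* e) refl e Q (ℓ ℕ.* ℓ) ⟩
        2 ℕ.* Q ℕ.* (ℓ ℕ.* ℓ) ℕ.* e          ∎

  -- Transfer between the natural numbers and the reals.

  pow-mono : ∀ {p q} k → 0ℚ ≤ p → p ≤ q → pow p k ≤ pow q k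
  pow-mono zero    0≤p p≤q = ℚP.≤-refl
  pow-mono (suc k) 0≤p p≤q = ℚP.≤-trans (*-monoˡ 0≤p (pow-mono k 0≤p p≤q))
    (*-monoʳ (0≤pow k (ℚP.≤-trans 0≤p p≤q)) p≤q)
    where
    0≤pow : ∀ {q} k → 0ℚ ≤ q → 0ℚ ≤ pow q k
    0≤pow zero    0≤q = ℚP.nonNegative⁻¹ 1ℚ
    0≤pow (suc k) 0≤q = 0≤p*q 0≤q (0≤pow k 0≤q)

  pow-* : ∀ p q k → pow (p * q) k ≡ pow p k * pow q k
  pow-* p q zero    = refl
  pow-* p q (suc k) = trans (cong (p * q *_) (pow-* p q k))
    (solve 4 (λ p q a b → p :* q :* (a :* b) := p :* a :* (q :* b)) refl p q (pow p k) (pow q k))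

  ι-^ : ∀ n k → ι (n ℕ.^ k) ≡ pow (ι n) k
  ι-^ n zero    = refl
  ι-^ n (suc k) = trans (ι-* n (n ℕ.^ k)) (cong (ι n *_) (ι-^ n k))

  seq-^ : ∀ x k m → seq (x ^ᵣ k) m ≡ pow (seq x m) k
  seq-^ x zero    m = refl
  seq-^ x (suc k) m = cong (seq x m *_) (seq-^ x k m)

  pointwise-≤ᵣ : ∀ {x y} → (∀ m → seq x m ≤ seq y m) → x ≤ᵣ y
  pointwise-≤ᵣ {x} {y} h ε 0<ε = 0 , λ m _ → ℚP.≤-trans (h m)
    (subst (_≤ seq y m + ε) (ℚP.+-identityʳ (seq y m)) (ℚP.+-monoʳ-≤ (seq y m) (ℚP.<⇒≤ 0<ε)))

  monomial-≤ᵣ : ∀ q t k r x l → (∀ m → q * pow (ι t) k ≤ ι r * pow (seq x m) l) →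
    fromℚ q *ᵣ (fromℕᵣ t ^ᵣ k) ≤ᵣ fromℕᵣ r *ᵣ (x ^ᵣ l)
  monomial-≤ᵣ q t k r x l h = pointwise-≤ᵣ {fromℚ q *ᵣ (fromℕᵣ t ^ᵣ k)} {fromℕᵣ r *ᵣ (x ^ᵣ l)}
    λ m → subst₂ _≤_ (cong (q *_) (sym (seq-^ (fromℕᵣ t) k m))) (cong (ι r *_) (sym (seq-^ x l m))) (h m)

  -- i + 1 ≤ 2i, and i/2 is below each approximant of log t. The 4 is the origin of 4^(2σ) in `V`.
  log-bound : ∀ i t m → 1 ℕ.≤ i → 2 ℕ.^ i ℕ.≤ t → ι (suc i) ≤ ι 4 * logSeq t m
  log-bound i t m 1≤i 2^i≤t = begin
    ι (suc i)            ≤⟨ ι-mono {suc i} {i ℕ.+ i} (ℕP.+-monoˡ-≤ i 1≤i) ⟩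
    ι (i ℕ.+ i)          ≡⟨ ι-+ i i ⟩
    ι i + ι i            ≡⟨ solve 1 (λ i → i :+ i := con (ι 4) :* (i :* con ½)) refl (ι i) ⟩
    ι 4 * (ι i * ½)      ≤⟨ *-monoˡ (0≤ι 4) (logSeq-lower i t m 2^i≤t) ⟩
    ι 4 * logSeq t m     ∎
    where open ℚP.≤-Reasoning

  eventually-≤ι : ∀ (C : ℝ) → ∃[ c ] Eventually λ k → seq C k ≤ ι c
  eventually-≤ι C = go (bounded {seq C} (cauchy C))
    where
    go : ∃[ B ] ℚ.Positive B × Eventually (λ k → ∣ seq C k ∣ ≤ B) → ∃[ c ] Eventually λ k → seq C k ≤ ι c
    go (B , 0<B , ∣C∣≤B) = finish (multiples-unbounded (ℚP.positive⁻¹ B {{0<B}}) (ℚP.positive⁻¹ 1ℚ))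
      where
      finish : ∃[ c ] B ≤ ι c * 1ℚ → ∃[ c ] Eventually λ k → seq C k ≤ ι c
      finish (c , B≤c) = c , eventually-map (λ k h → ℚP.≤-trans (p≤∣p∣ (seq C k))
        (ℚP.≤-trans h (subst (B ≤_) (ℚP.*-identityʳ (ι c)) B≤c))) ∣C∣≤B

  eventually-frac≤ : ∀ (c : ℝ) → 0ℝ <ᵣ c → ∃[ p ] Eventually λ k → frac 1 p ≤ seq c k
  eventually-frac≤ c (ε , 0<ε , ε≤c) = go (archimedean 0<ε)
    where
    go : ∃[ N ] (∀ n → N ℕ.≤ n → frac 1 n ≤ ε) → ∃[ p ] Eventually λ k → frac 1 p ≤ seq c k
    go (N , small) = N , eventually-map
      (λ k h → ℚP.≤-trans (small N ℕP.≤-refl) (subst (_≤ seq c k) (ℚP.+-identityˡ ε) h)) ε≤c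

  form-bound : ∀ {N d ev y} (G : Graph N) → 1 ℕ.≤ N → IsNDλGraph G d ev →
    Eventually (λ k → seq ev k + ½ ≤ ι y) → ∀ v → - ι y * (v · v) ≤ v · (adjℚ G ⊛ v)
  form-bound {suc n} {y = y} G _ ndλ ev<y =
    Spectral.adjℚ-form G ndλ (ι y) (0≤ι y) (ℚP.positive⁻¹ ½) ev<y

  -- The exponents `k` and `l` stay variables tied to σ by equations, so that 2s - 3 and 2s - 4 are
  -- rewritten only where `degree-bound` and the final inequality are applied.
  module LowerBound (s σ k l : ℕ) (1≤σ : 1 ℕ.≤ σ) (k≡ : k ≡ suc (σ ℕ.+ σ)) (l≡ : l ≡ σ ℕ.+ σ)
    (C c : ℝ) (C′ p : ℕ) (C≤C′ : Eventually λ m → seq C m ≤ ι C′) (p≤c : Eventually λ m → frac 1 p ≤ seq c m) where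

    W P Q V z : ℕ
    W = 4 ℕ.* suc C′ ℕ.^ 2
    P = 64 ℕ.* (W ℕ.* suc p)
    Q = 16 ℕ.* (suc p ℕ.* P ℕ.* (suc (σ ℕ.+ σ) ℕ.* suc (σ ℕ.+ σ)))
    -- `V` joins the constant of `Parameters.t^≤` to the cost of replacing ℓ by the logarithm. As
    -- `frac 1 z` is 1/(z + 1), z = V - 1 yields c′ = 1/V.
    V = 8 ℕ.* (2 ℕ.* Q) ℕ.^ σ ℕ.* 4 ℕ.^ (σ ℕ.+ σ)
    z = ℕ.pred V

    1≤W : 1 ℕ.≤ W
    1≤W = ℕP.*-mono-≤ {1} {4} (ℕ.s≤s ℕ.z≤n) (ℕP.m^n>0 (suc C′) 2)
    1≤P : 1 ℕ.≤ P
    1≤P = ℕP.*-mono-≤ {1} {64} (ℕ.s≤s ℕ.z≤n) (ℕP.*-mono-≤ {1} {W} {1} {suc p} 1≤W (ℕ.s≤s ℕ.z≤n))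
    1≤Q : 1 ℕ.≤ Q
    1≤Q = ℕP.*-mono-≤ {1} {16} (ℕ.s≤s ℕ.z≤n) (ℕP.*-mono-≤ {1} {suc p ℕ.* P}
      (ℕP.*-mono-≤ {1} {suc p} (ℕ.s≤s ℕ.z≤n) 1≤P) (ℕ.s≤s ℕ.z≤n))
    V≡ : suc z ≡ V
    V≡ = ℕP.suc-pred V {{ℕ.>-nonZero (ℕP.*-mono-≤ (ℕP.*-mono-≤ {1} {8} (ℕ.s≤s ℕ.z≤n)
      (ℕP.m^n>0 (2 ℕ.* Q) {{ℕ.>-nonZero (ℕP.*-mono-≤ {1} {2} (ℕ.s≤s ℕ.z≤n) 1≤Q)}} σ)) (ℕP.m^n>0 4 (σ ℕ.+ σ)))}}

    c′ : ℝ
    c′ = fromℚ (frac 1 z)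

    0<c′ : 0ℝ <ᵣ c′
    0<c′ = frac 1 z , ℚP.positive⁻¹ (frac 1 z) {{ℚP.normalize-pos 1 (suc z)}} ,
      0 , λ _ _ → ℚP.≤-reflexive (ℚP.+-identityˡ (frac 1 z))

    Hypothesis : ℕ → Set
    Hypothesis n = ∃[ G ] ∃[ d ] ∃[ ev ]
      IsNDλGraph {n} G d ev × K[ s ]-Free G × ev ≤ᵣ C *ᵣ √ d × c *ᵣ (n ^[1-1/ k ]) ≤ᵣ fromℕᵣ d

    conclusion : ∀ {t r} → ∀ i → 1 ℕ.≤ i → 2 ℕ.^ i ℕ.≤ t →
      t ℕ.^ suc σ ℕ.≤ 8 ℕ.* (2 ℕ.* Q) ℕ.^ σ ℕ.* (suc i ℕ.^ (σ ℕ.+ σ) ℕ.* r) →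
      ∀ m → frac 1 z * pow (ι t) (suc σ) ≤ ι r * pow (logSeq t m) (σ ℕ.+ σ)
    conclusion {t} {r} i 1≤i 2^i≤t t^≤ m = begin
      frac 1 z * pow (ι t) (suc σ)
        ≡⟨ cong (frac 1 z *_) (sym (ι-^ t (suc σ))) ⟩
      frac 1 z * ι (t ℕ.^ suc σ)
        ≤⟨ *-monoˡ (0≤frac 1 z) (ι-mono t^≤) ⟩
      frac 1 z * ι (v ℕ.* (suc i ℕ.^ (σ ℕ.+ σ) ℕ.* r))
        ≡⟨ cong (frac 1 z *_) (trans (ι-* v (suc i ℕ.^ (σ ℕ.+ σ) ℕ.* r))
             (cong (ι v *_) (trans (ι-* (suc i ℕ.^ (σ ℕ.+ σ)) r) (cong (_* ι r) (ι-^ (suc i) (σ ℕ.+ σ)))))) ⟩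
      frac 1 z * (ι v * (pow (ι (suc i)) (σ ℕ.+ σ) * ι r))
        ≤⟨ *-monoˡ (0≤frac 1 z) (*-monoˡ (0≤ι v) (*-monoʳ (0≤ι r)
             (pow-mono (σ ℕ.+ σ) (0≤ι (suc i)) (log-bound i t m 1≤i 2^i≤t)))) ⟩
      frac 1 z * (ι v * (pow (ι 4 * lg) (σ ℕ.+ σ) * ι r))
        ≡⟨ cong (λ x → frac 1 z * (ι v * (x * ι r))) (trans (pow-* (ι 4) lg (σ ℕ.+ σ))
             (cong (_* pow lg (σ ℕ.+ σ)) (sym (ι-^ 4 (σ ℕ.+ σ))))) ⟩
      frac 1 z * (ι v * (ι (4 ℕ.^ (σ ℕ.+ σ)) * pow lg (σ ℕ.+ σ) * ι r))
        ≡⟨ solve 5 (λ f v w x r → f :* (v :* (w :* x :* r)) := (v :* w :* f) :* (r :* x)) refl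
             (frac 1 z) (ι v) (ι (4 ℕ.^ (σ ℕ.+ σ))) (pow lg (σ ℕ.+ σ)) (ι r) ⟩
      ι v * ι (4 ℕ.^ (σ ℕ.+ σ)) * frac 1 z * (ι r * pow lg (σ ℕ.+ σ))
        ≡⟨ cong (λ x → x * frac 1 z * (ι r * pow lg (σ ℕ.+ σ)))
             (trans (sym (ι-* v (4 ℕ.^ (σ ℕ.+ σ)))) (cong ι (sym V≡))) ⟩
      ι (suc z) * frac 1 z * (ι r * pow lg (σ ℕ.+ σ))
        ≡⟨ cong (_* (ι r * pow lg (σ ℕ.+ σ))) (ι*frac 1 z) ⟩
      1ℚ * (ι r * pow lg (σ ℕ.+ σ))
        ≡⟨ ℚP.*-identityˡ (ι r * pow lg (σ ℕ.+ σ)) ⟩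
      ι r * pow lg (σ ℕ.+ σ) ∎
      where
      open ℚP.≤-Reasoning
      lg = logSeq t m
      v = 8 ℕ.* (2 ℕ.* Q) ℕ.^ σ

    t^≤ : ∀ {e ℓ t r} → Hypothesis ((P ℕ.* e) ℕ.^ suc (σ ℕ.+ σ)) → 1 ℕ.≤ ℓ → P ℕ.≤ e →
      (ℓ ℕ.+ ℓ) ℕ.* suc (σ ℕ.+ σ) ℕ.≤ e → e ℕ.* (Q ℕ.* (ℓ ℕ.* ℓ)) ℕ.≤ t →
      t ℕ.< suc e ℕ.* (Q ℕ.* (ℓ ℕ.* ℓ)) → t ℕ.< 2 ℕ.^ ℓ → 8 ℕ.≤ t → Forces s t r →
      t ℕ.^ suc σ ℕ.≤ 8 ℕ.* (2 ℕ.* Q) ℕ.^ σ ℕ.* (ℓ ℕ.^ (σ ℕ.+ σ) ℕ.* r)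
    t^≤ {e} {ℓ} {t} {r} (G , d , ev , ndλ , free , ev≤ , d≥) 1≤ℓ P≤e L≤e eQℓ²≤t t<eQℓ² t<2^ℓ 8≤t forces =
      go (eigenvalue-bound {C} {ev} {C′} {d} C≤C′ ev≤ 1≤d)
      where
      a = P ℕ.* e
      1≤a : 1 ℕ.≤ a
      1≤a = ℕP.*-mono-≤ 1≤P (ℕP.≤-trans 1≤P P≤e)
      a^≤pd : a ℕ.^ (σ ℕ.+ σ) ℕ.≤ suc p ℕ.* d
      a^≤pd = degree-bound {c} {p} (σ ℕ.+ σ) a d p≤c
        (subst (λ k → c *ᵣ ((a ℕ.^ suc (σ ℕ.+ σ)) ^[1-1/ k ]) ≤ᵣ fromℕᵣ d) k≡ d≥)
      1≤d : 1 ℕ.≤ d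
      1≤d = ℕP.n≢0⇒n>0 λ d≡0 → ℕP.<⇒≱ (ℕP.m^n>0 a {{ℕ.>-nonZero 1≤a}} (σ ℕ.+ σ))
        (ℕP.≤-trans a^≤pd (ℕP.≤-reflexive (trans (cong (suc p ℕ.*_) d≡0) (ℕP.*-zeroʳ p))))
      go : ∃[ y ] y ℕ.^ 2 ℕ.≤ W ℕ.* d × Eventually (λ m → seq ev m + ½ ≤ ι y) → _
      go (y , y²≤ , ev<y) = Parameters.t^≤ {s} {σ} {suc p} {W} {P} {Q} 1≤σ (ℕ.s≤s ℕ.z≤n) 1≤W refl refl
        {e} {ℓ} {t} {r} {d} {y} G free (IsNDλGraph.regular ndλ)
        (form-bound {y = y} G (ℕP.m^n>0 a {{ℕ.>-nonZero 1≤a}} (suc (σ ℕ.+ σ))) ndλ ev<y)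
        y²≤ a^≤pd 1≤ℓ P≤e L≤e eQℓ²≤t t<eQℓ² t<2^ℓ 8≤t forces

    -- `c′` is fixed before `n₀` is known; only `t₀` depends on `n₀`, as the order of the
    -- quantifiers demands.
    module _ (n₀ : ℕ) (hyp : ∀ n → n₀ ℕ.≤ n → Hypothesis n) where
      -- `M` collects three lower bounds on e: n₀ so that the hypothesis applies, P, and 2k, which
      -- gives L = 2kℓ ≤ e. `B` is the bound on ℓ demanded by `cube-bound`, and the additional 3
      -- ensures t ≥ 8.
      M B t₀ : ℕ
      M = n₀ ℕ.+ P ℕ.+ 2 ℕ.* suc (σ ℕ.+ σ)
      B = 512 ℕ.* (M ℕ.* Q)
      t₀ = 2 ℕ.^ (B ℕ.+ 3)

      large : ∀ u r → t₀ ℕ.≤ suc u → Forces s (suc u) r → ∀ i → 2 ℕ.^ i ℕ.≤ suc u → suc u ℕ.< 2 ℕ.^ suc i →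
        ∀ m → frac 1 z * pow (ι (suc u)) (suc σ) ≤ ι r * pow (logSeq (suc u) m) (σ ℕ.+ σ)
      large u r t₀≤t forces i lo hi = conclusion i 1≤i lo
        (t^≤ {e} {ℓ} {t} {r} (hyp _ n₀≤N) (ℕ.s≤s ℕ.z≤n) P≤e L≤e (m/n*n≤m t D) (m<[1+m/n]*n t D) hi 8≤t forces)
        where
        open ℕP.≤-Reasoning
        t ℓ D e : ℕ
        t = suc u
        ℓ = suc i
        D = Q ℕ.* (ℓ ℕ.* ℓ)
        instance
          D≢0 : ℕ.NonZero D
          D≢0 = ℕ.>-nonZero (ℕP.*-mono-≤ {1} {Q} {1} {ℓ ℕ.* ℓ} 1≤Q (ℕ.s≤s ℕ.z≤n))
        e = t / D
        B+3≤i : B ℕ.+ 3 ℕ.≤ i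
        B+3≤i = ℕ.s≤s⁻¹ (ℕP.≰⇒> λ h → ℕP.<⇒≱ hi (ℕP.≤-trans (ℕP.^-monoʳ-≤ 2 h) t₀≤t))
        1≤i : 1 ℕ.≤ i
        1≤i = ℕP.≤-trans (ℕ.s≤s ℕ.z≤n) (ℕP.≤-trans (ℕP.m≤n+m 3 B) B+3≤i)
        8≤t : 8 ℕ.≤ t
        8≤t = ℕP.≤-trans (ℕP.^-monoʳ-≤ 2 (ℕP.m≤n+m 3 B)) t₀≤t
        Mℓ≤e : M ℕ.* ℓ ℕ.≤ e
        Mℓ≤e = m*n≤o⇒m≤o/n (M ℕ.* ℓ) D t (begin
          M ℕ.* ℓ ℕ.* (Q ℕ.* (ℓ ℕ.* ℓ))
            ≡⟨ ℕS.solve 3 (λ m l q → m ℕS.:* l ℕS.:* (q ℕS.:* (l ℕS.:* l)) ℕS.:= m ℕS.:* q ℕS.:* l ℕS.:^ 3) refl M ℓ Q ⟩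
          M ℕ.* Q ℕ.* ℓ ℕ.^ 3
            ≤⟨ cube-bound (M ℕ.* Q) ℓ t (ℕP.≤-trans (ℕP.m≤m+n B 3) (ℕP.≤-trans B+3≤i (ℕP.n≤1+n i))) (ℕP.*-monoʳ-≤ 2 lo) ⟩
          t ∎)
        M≤e : M ℕ.≤ e
        M≤e = ℕP.≤-trans (ℕP.m≤m*n M ℓ) Mℓ≤e
        P≤e : P ℕ.≤ e
        P≤e = ℕP.≤-trans (ℕP.≤-trans (ℕP.m≤n+m P n₀) (ℕP.m≤m+n (n₀ ℕ.+ P) _)) M≤e
        L≤e : (ℓ ℕ.+ ℓ) ℕ.* suc (σ ℕ.+ σ) ℕ.≤ e
        L≤e = begin
          (ℓ ℕ.+ ℓ) ℕ.* suc (σ ℕ.+ σ)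
            ≡⟨ ℕS.solve 2 (λ l k → (l ℕS.:+ l) ℕS.:* k ℕS.:= ℕS.con 2 ℕS.:* k ℕS.:* l) refl ℓ (suc (σ ℕ.+ σ)) ⟩
          2 ℕ.* suc (σ ℕ.+ σ) ℕ.* ℓ
            ≤⟨ ℕP.*-monoˡ-≤ ℓ (ℕP.m≤n+m (2 ℕ.* suc (σ ℕ.+ σ)) (n₀ ℕ.+ P)) ⟩
          M ℕ.* ℓ ≤⟨ Mℓ≤e ⟩
          e       ∎
        1≤e = ℕP.≤-trans 1≤P P≤e
        n₀≤N : n₀ ℕ.≤ (P ℕ.* e) ℕ.^ suc (σ ℕ.+ σ)
        n₀≤N = begin
          n₀      ≤⟨ ℕP.≤-trans (ℕP.m≤m+n n₀ P) (ℕP.m≤m+n (n₀ ℕ.+ P) _) ⟩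
          M       ≤⟨ M≤e ⟩
          e       ≤⟨ ℕP.m≤n*m e P {{ℕ.>-nonZero 1≤P}} ⟩
          P ℕ.* e ≤⟨ ^-self (P ℕ.* e) (suc (σ ℕ.+ σ)) (ℕ.s≤s ℕ.z≤n) (ℕP.*-mono-≤ 1≤P 1≤e) ⟩
          (P ℕ.* e) ℕ.^ suc (σ ℕ.+ σ) ∎

      lower-bound : ∀ t r → t₀ ℕ.≤ t → IsRamseyNumber s t r →
        c′ *ᵣ (fromℕᵣ t ^ᵣ suc σ) ≤ᵣ fromℕᵣ r *ᵣ (log t ^ᵣ l)
      lower-bound zero    r t₀≤0 _ = contradiction {A = 1 ℕ.≤ t₀} (ℕP.m^n>0 2 (B ℕ.+ 3)) (ℕP.≤⇒≯ t₀≤0)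
      lower-bound (suc u) r t₀≤t (forces , _) = subst
        (λ l → c′ *ᵣ (fromℕᵣ (suc u) ^ᵣ suc σ) ≤ᵣ fromℕᵣ r *ᵣ (log (suc u) ^ᵣ l)) (sym l≡)
        (go (binary-length u))
        where
        go : ∃[ i ] 2 ℕ.^ i ℕ.≤ suc u × suc u ℕ.< 2 ℕ.^ suc i →
          c′ *ᵣ (fromℕᵣ (suc u) ^ᵣ suc σ) ≤ᵣ fromℕᵣ r *ᵣ (log (suc u) ^ᵣ (σ ℕ.+ σ))
        go (i , lo , hi) = monomial-≤ᵣ (frac 1 z) (suc u) (suc σ) r (log (suc u)) (σ ℕ.+ σ)
          (large u r t₀≤t forces i lo hi)

  RamseyBound : (s σ k l : ℕ) (C c : ℝ) → Set
  RamseyBound s σ k l C c = ∃[ c′ ] 0ℝ <ᵣ c′ ×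
    ((∃[ n₀ ] ((n : ℕ) → n₀ ℕ.≤ n →
        ∃[ G ] ∃[ d ] ∃[ ev ]
          IsNDλGraph {n} G d ev × K[ s ]-Free G ×
          ev ≤ᵣ C *ᵣ √ d ×
          c *ᵣ (n ^[1-1/ k ]) ≤ᵣ fromℕᵣ d)) →
     ∃[ t₀ ] ((t r : ℕ) → t₀ ℕ.≤ t → IsRamseyNumber s t r →
       c′ *ᵣ (fromℕᵣ t ^ᵣ suc σ) ≤ᵣ fromℕᵣ r *ᵣ (log t ^ᵣ l)))

  ramsey-bound : ∀ s σ k l → 1 ℕ.≤ σ → k ≡ suc (σ ℕ.+ σ) → l ≡ σ ℕ.+ σ →
    ∀ C c → 0ℝ <ᵣ c → RamseyBound s σ k l C c
  ramsey-bound s σ k l 1≤σ k≡ l≡ C c 0<c = go (eventually-≤ι C) (eventually-frac≤ c 0<c)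
    where
    go : ∃[ C′ ] Eventually (λ m → seq C m ≤ ι C′) → ∃[ p ] Eventually (λ m → frac 1 p ≤ seq c m) →
      RamseyBound s σ k l C c
    go (C′ , C≤C′) (p , p≤c) = c′ , 0<c′ , λ (n₀ , hyp) → t₀ n₀ hyp , lower-bound n₀ hyp
      where open LowerBound s σ k l 1≤σ k≡ l≡ C c C′ p C≤C′ p≤c

open import Data.Nat using (ℕ; _≤_; _*_; _∸_)
open import Data.Product using (∃-syntax; _×_)

theorem4 : (s : ℕ) → 3 ≤ s →
    (C c : ℝ) → 0ℝ <ᵣ C → 0ℝ <ᵣ c →
    ∃[ c′ ] 0ℝ <ᵣ c′ ×
    ((∃[ n₀ ] ((n : ℕ) → n₀ ≤ n →
    ∃[ G ] ∃[ d ] ∃[ ev ]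
    IsNDλGraph {n} G d ev × K[ s ]-Free G ×
    ev ≤ᵣ C *ᵣ √ d ×
    c *ᵣ (n ^[1-1/ 2 * s ∸ 3 ]) ≤ᵣ fromℕᵣ d)) →
    ∃[ t₀ ] ((t r : ℕ) → t₀ ≤ t → IsRamseyNumber s t r →
    c′ *ᵣ (fromℕᵣ t ^ᵣ (s ∸ 1)) ≤ᵣ fromℕᵣ r *ᵣ (log t ^ᵣ (2 * s ∸ 4))))
theorem4 s@(suc (suc (suc s′))) (ℕ.s≤s (ℕ.s≤s (ℕ.s≤s ℕ.z≤n))) C c _ 0<c =
  -- σ = s - 2 = s′ + 1 is positive, with s - 1 = σ + 1, 2s - 3 = 2σ + 1 and 2s - 4 = 2σ.
  Asymptotics.ramsey-bound s (suc s′) (2 ℕ.* s ℕ.∸ 3) (2 ℕ.* s ℕ.∸ 4) (ℕ.s≤s ℕ.z≤n) k≡ l≡ C c 0<c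
  where
  k≡ : 2 ℕ.* s ℕ.∸ 3 ≡ suc (suc s′ ℕ.+ suc s′)
  k≡ = ℕS.solve 1 (λ x → x ℕS.:+ (ℕS.con 3 ℕS.:+ (x ℕS.:+ ℕS.con 0))
    ℕS.:= ℕS.con 1 ℕS.:+ ((ℕS.con 1 ℕS.:+ x) ℕS.:+ (ℕS.con 1 ℕS.:+ x))) refl s′
  l≡ : 2 ℕ.* s ℕ.∸ 4 ≡ suc s′ ℕ.+ suc s′
  l≡ = trans (sym (ℕP.∸-+-assoc (2 ℕ.* s) 3 1)) (cong (ℕ._∸ 1) k≡)
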